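{- Let $F$ be a subfield of $\mathbb{R}$. Let $S\subseteq\mathbb{R}^n$ ($n\ge1$) be an $F$-rational polyhedral subset. Let $f: \mathrm{int}(S) \cap F^n \to \mathbb{R}$ be a function such that for every $F$-rational line $L\subseteq\mathbb{R}^n$, the restriction of $f$ to $\mathrm{int}(S)\cap F^n\cap L$ is $F$-integral polyhedral. Then $f$ is $F$-integral polyhedral.
   Context: $\mathrm{int}(S)$ denotes the relative interior of the convex set $S$, i.e. its topological interior relative to its affine hull. An affine functional $\lambda(x_1,\dots,x_n)=a_1x_1+\cdots+a_nx_n+b$ on $\mathbb{R}^n$ is $F$-integral if $a_1,\dots,a_n\in\mathbb{Z}$ and $b\in F$. An $F$-rational polyhedral subset of $\mathbb{R}^n$ is an intersection of finitely many (possibly zero) closed halfspaces $\{x:\lambda(x)\ge 0\}$ with each $\lambda$ an $F$-integral affine functional with $(a_1,\dots,a_n)\neq 0$ (it need not be bounded). An $F$-rational line is an affine line in $\mathbb{R}^n$ that is an $F$-rational polyhedral subset. For any $T\subseteq\mathbb{R}^n$, a function $g:T\to\mathbb{R}$ is $F$-integral polyhedral if $g(x)=\max\{\lambda_1(x),\dots,\lambda_m(x)\}$ for all $x\in T$, for some finite list of $F$-integral affine functionals $\lambda_1,\dots,\lambda_m$ on $\mathbb{R}^n$. -}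

module Defs where

open import Algebra.Bundles using (CommutativeRing)
import Algebra.Definitions.RawMonoid as RawMonoidDefinitions
open import Data.Integer.Base using (ℤ; +_; -[1+_]; 0ℤ)
import Data.List.Extrema as Extrema
open import Data.List.Base using (List; map)
open import Data.List.Relation.Unary.All using (All)
open import Data.Nat.Base using (ℕ; suc)
open import Data.Product.Base using (_×_; ∃; ∃-syntax)
open import Data.Vec.Functional using (Vector)
import Data.Vec.Functional.Relation.Binary.Equality.Setoid as VectorEquality
open import Function.Bundles using (_⇔_)
open import Level using (0ℓ) renaming (suc to lsuc)
open import Relation.Binary.Bundles using (TotalOrder)
open import Relation.Binary.Core using (Rel)
import Relation.Binary.Construct.NonStrictToStrict as NonStrictToStrict
open import Relation.Binary.Definitions using (_Respects_)
open import Relation.Binary.PropositionalEquality.Core using (_≗_)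
open import Relation.Binary.Structures using (IsTotalOrder)
open import Relation.Nullary.Negation.Core using (¬_)
open import Relation.Unary using (Pred; _∈_; _∩_; _⊆_)

-- ℝ is specified by its classical characterisation as the (unique up to
-- isomorphism) Dedekind-complete ordered field, over a setoid equality.
record CompleteOrderedField : Set (lsuc 0ℓ) where
  infix 4 _≤_
  field
    commutativeRing : CommutativeRing 0ℓ 0ℓ

  open CommutativeRing commutativeRing public

  field
    _≤_          : Rel Carrier 0ℓ
    isTotalOrder : IsTotalOrder _≈_ _≤_
    0≉1          : ¬ (0# ≈ 1#)
    inverse      : ∀ x → ¬ (x ≈ 0#) → ∃[ y ] x * y ≈ 1#
    +-monoʳ-≤    : ∀ x {y z} → y ≤ z → x + y ≤ x + z
    *-nonNeg     : ∀ {x y} → 0# ≤ x → 0# ≤ y → 0# ≤ x * y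

  UpperBound : Pred Carrier 0ℓ → Pred Carrier 0ℓ
  UpperBound P b = ∀ x → x ∈ P → x ≤ b

  field
    supremum : (P : Pred Carrier 0ℓ) → ∃ P → ∃ (UpperBound P) →
               ∃[ s ] (s ∈ UpperBound P × (∀ b → b ∈ UpperBound P → s ≤ b))

  totalOrder : TotalOrder 0ℓ 0ℓ 0ℓ
  totalOrder = record { isTotalOrder = isTotalOrder }

  open NonStrictToStrict _≈_ _≤_ public using (_<_)
  open Extrema totalOrder public using (max)
  open VectorEquality setoid public using (_≋_)
  open RawMonoidDefinitions +-rawMonoid public
    using (sum) renaming (_×_ to _ℕ·_)

  fromℤ : ℤ → Carrier
  fromℤ (+ n)    = n ℕ· 1#
  fromℤ -[1+ n ] = - (suc n ℕ· 1#)

record Subfield (ℝ : CompleteOrderedField) : Set (lsuc 0ℓ) where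
  open CompleteOrderedField ℝ
  field
    Member     : Pred Carrier 0ℓ
    respects   : Member Respects _≈_
    0-closed   : 0# ∈ Member
    1-closed   : 1# ∈ Member
    +-closed   : ∀ {x y} → x ∈ Member → y ∈ Member → x + y ∈ Member
    neg-closed : ∀ {x} → x ∈ Member → - x ∈ Member
    *-closed   : ∀ {x y} → x ∈ Member → y ∈ Member → x * y ∈ Member
    inv-closed : ∀ {x y} → x ∈ Member → x * y ≈ 1# → y ∈ Member

module Euclidean (ℝ : CompleteOrderedField) where
  open CompleteOrderedField ℝ

  Point : ℕ → Set
  Point n = Vector Carrier n

  module _ {n : ℕ} where

    AffineHull : Pred (Point n) 0ℓ → Pred (Point n) 0ℓ
    AffineHull S x =
      ∃ λ (k : ℕ) → ∃ λ (c : Vector Carrier k) → ∃ λ (p : Vector (Point n) k) →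
        (∀ j → p j ∈ S)
        × sum c ≈ 1#
        × x ≋ (λ i → sum (λ j → c j * p j i))

    -- Open cubes form a neighbourhood basis of the usual topology on ℝⁿ.
    OpenCube : Point n → Carrier → Pred (Point n) 0ℓ
    OpenCube x ε y = ∀ i → (- ε < y i - x i) × (y i - x i < ε)

    int : Pred (Point n) 0ℓ → Pred (Point n) 0ℓ
    int S x =
      x ∈ AffineHull S
      × ∃[ ε ] (0# < ε × (OpenCube x ε ∩ AffineHull S) ⊆ S)

    IsLine : Pred (Point n) 0ℓ → Set
    IsLine L =
      ∃ λ (p : Point n) → ∃ λ (d : Point n) →
        ¬ (d ≋ (λ _ → 0#))
        × (∀ x → x ∈ L ⇔ (∃[ t ] x ≋ (λ i → p i + t * d i)))

  -- Real functions on a subset T ⊆ ℝⁿ.  By `cong` the value depends neither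
  -- on the membership proof nor on the representative of the point.
  record FunctionOn {n : ℕ} (T : Pred (Point n) 0ℓ) : Set where
    field
      apply : ∀ x → x ∈ T → Carrier
      cong  : ∀ {x y} (x∈T : x ∈ T) (y∈T : y ∈ T) →
              x ≋ y → apply x x∈T ≈ apply y y∈T

  open FunctionOn public

  restrict : ∀ {n} {T U : Pred (Point n) 0ℓ} →
             U ⊆ T → FunctionOn T → FunctionOn U
  restrict U⊆T f .apply x x∈U      = apply f x (U⊆T x∈U)
  restrict U⊆T f .cong x∈U y∈U x≋y = cong f (U⊆T x∈U) (U⊆T y∈U) x≋y

module Polyhedral (ℝ : CompleteOrderedField) (F : Subfield ℝ) where
  open CompleteOrderedField ℝ
  open Subfield F using (Member)
  open Euclidean ℝ public

  F^ : (n : ℕ) → Pred (Point n) 0ℓ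
  F^ n x = ∀ i → x i ∈ Member

  record IntegralAffine (n : ℕ) : Set where
    field
      gradient   : Vector ℤ n
      constant   : Carrier
      constant∈F : constant ∈ Member

    eval : Point n → Carrier
    eval x = sum (λ i → fromℤ (gradient i) * x i) + constant

  open IntegralAffine public

  module _ {n : ℕ} where

    NonConstant : Pred (IntegralAffine n) 0ℓ
    NonConstant l = ¬ (gradient l ≗ (λ _ → 0ℤ))

    IsRationalPolyhedral : Pred (Point n) 0ℓ → Set
    IsRationalPolyhedral S =
      ∃ λ (ls : List (IntegralAffine n)) →
        All NonConstant ls
        × (∀ x → x ∈ S ⇔ All (λ l → 0# ≤ eval l x) ls)

    IsRationalLine : Pred (Point n) 0ℓ → Set
    IsRationalLine L = IsLine L × IsRationalPolyhedral L

    -- The list of functionals is l ∷ ls, so that the maximum is taken over a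
    -- nonempty list; `max a as` is the maximum of a ∷ as.
    IsIntegralPolyhedral : {T : Pred (Point n) 0ℓ} → FunctionOn T → Set
    IsIntegralPolyhedral {T} g =
      ∃ λ (l : IntegralAffine n) → ∃ λ (ls : List (IntegralAffine n)) →
        ∀ x (x∈T : x ∈ T) →
        apply g x x∈T ≈ max (eval l x) (map (λ l′ → eval l′ x) ls)

module Submission where

-- Call an integral affine functional below f a minorant.
--
-- (1) Every point of int S ∩ Fⁿ lies on a minorant that is exact there.  The
-- one-sided slopes of f at p are integers and form a sublinear function on the
-- lattice of directions of S, so an integral Hahn–Banach theorem gives an
-- integral linear function below them.  This bounds f from below at all points
-- reached from p along integral directions; these are dense, and f is upper
-- semicontinuous because it is convex along the integral directions.
--
-- (2) At every w ∈ S ∩ Fⁿ, boundary included, some minorant is largest: choose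
-- an integral direction d from w into int S and a minorant exact at w + t d,
-- with t so small that f is affine on the segment from w to w + 2 t d.
--
-- (3) By induction on the number of inequalities, each closed face of S has
-- finitely many minorants among which a largest one is found at each of its
-- points.  Let p be off the smaller faces and l largest at p.  Along an integral
-- direction d of the face, the slope of l is bounded by that of f at infinity if
-- p + t d stays in S, and otherwise, by monotonicity of subgradients, by the
-- slope of one of the finitely many minorants of the smaller face where p + t d
-- leaves S.  So l takes finitely many values on finitely many directions that span
-- those of the face, and these values and p determine its restriction to the face.

open import Defs
open import Algebra.Bundles using (CommutativeRing)
open import Algebra.Bundles.Raw using (RawRing)
import Algebra.Properties.AbelianGroup as AbelianGroupProperties
import Algebra.Properties.Ring as RingProperties
import Algebra.Properties.Semiring.Mult as SemiringMult
import Algebra.Properties.Semiring.Sum as SemiringSum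
import Algebra.Solver.Ring as RingSolver
open import Algebra.Solver.Ring.AlmostCommutativeRing using (fromCommutativeRing; _-Raw-AlmostCommutative⟶_)
open import Axiom.ExcludedMiddle using (ExcludedMiddle)
open import Data.Fin.Base using (Fin; zero; suc; punchIn; punchOut)
import Data.Fin.Properties as Finₚ
open import Data.Integer.Base as ℤ using (ℤ; +_; -[1+_]; 0ℤ; 1ℤ; _⊖_)
import Data.Integer.Properties as ℤₚ
open import Data.Integer.Solver using (module +-*-Solver)
open import Data.List.Base as List using (List)
import Data.List.Extrema as Extrema
import Data.List.Membership.Propositional as Membership
open import Data.List.Relation.Unary.All as All using (All)
import Data.List.Relation.Unary.All.Properties as Allₚ
open import Data.List.Relation.Unary.Any as Any using (Any; here; there)
import Data.List.Relation.Unary.Any.Properties as Anyₚ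
open import Data.Maybe.Base using (Maybe; just; nothing)
open import Data.Nat.Base as ℕ using (ℕ; zero; suc)
open import Data.Nat.Divisibility using (divides; _∣_)
import Data.Nat.GCD as GCD
import Data.Nat.Properties as ℕₚ
open import Data.Product.Base using (_×_; _,_; ∃; proj₁; proj₂; ∃-syntax)
open import Data.Sum.Base using (_⊎_; inj₁; inj₂)
open import Data.Vec.Functional as Vector using (Vector; head; tail; removeAt)
open import Function.Base using (id)
open import Function.Bundles using (mk⇔; Equivalence)
open import Level using (0ℓ)
open import Relation.Binary.PropositionalEquality.Core as ≡ using (_≡_; _≗_)
import Relation.Binary.PropositionalEquality.Properties as ≡ₚ
import Relation.Binary.Reasoning.Setoid as SetoidReasoning
open import Relation.Binary.Structures using (IsTotalOrder)
open import Relation.Nullary.Decidable.Core using (Dec; yes; no)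
open import Relation.Nullary.Negation.Core using (¬_; contradiction)
open import Relation.Unary using (Pred; _∈_; _∩_)

-- The gradients are integral, so two points of Fⁿ are in general not joined by an F-rational line:
-- only integral directions are available. Convexity of f between arbitrary points is therefore not
-- given, and a functional supporting f at p is at first known to lie below f only on the rays from
-- p in integral directions. Density and semicontinuity have to bridge this gap. A real Hahn-Banach
-- functional could have fractional coefficients; an integral one is found because each coefficient
-- in turn is pushed to its extreme value, which is an integer. As S may be of lower dimension, the
-- slopes live on a sublattice of ℤⁿ, and a projection of ℤⁿ onto that sublattice carries them to
-- the whole of it. f is not defined on the boundary of S, so the induction over faces cannot be
-- about f. It is about the set of minorants, which can be compared at boundary points too. Near the
-- boundary nothing bounds their slopes a priori; the bounds are imported from the smaller faces.

-- Integer vectors: Bézout combinations and integral Hahn-Banach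

module IntegerVectors where

  open import Data.Integer.Base using (_+_; _*_; -_; _-_; _≤_; _<_; ∣_∣)
  open ℤₚ
  open +-*-Solver
  open Vector using (_∷_)
  open ≡ using (refl; sym; trans; cong; cong₂; subst; subst₂)
  open ≡ₚ using (module ≡-Reasoning)

  infix 8 _∙_
  _∙_ : ∀ {n} → Vector ℤ n → Vector ℤ n → ℤ
  _∙_ {zero}  a x = 0ℤ
  _∙_ {suc n} a x = head a * head x + tail a ∙ tail x

  i<suc[j]⇒i≤j : ∀ {i j} → i < ℤ.suc j → i ≤ j
  i<suc[j]⇒i≤j {i} {j} p = subst₂ _≤_ (pred-suc i) (pred-suc j) (pred-mono (i<j⇒suc[i]≤j p))

  sign-abs : ∀ a → ∃[ s ] (a ≡ s * + ∣ a ∣ × + ∣ a ∣ ≡ s * a)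
  sign-abs (+ n)    = 1ℤ , sym (*-identityˡ (+ n)) , sym (*-identityˡ (+ n))
  sign-abs -[1+ n ] = - 1ℤ , sym (-1*i≡-i (+ suc n)) , sym (-1*i≡-i -[1+ n ])

  -- The gcd appears only as the combination `a * x + b * y` that divides a and b. In this form a =
  -- b = 0 needs no exception, and signs are absorbed by `sign-abs`.
  bézout : ∀ a b → ∃[ x ] ∃[ y ] ∃[ p ] ∃[ q ]
           (a ≡ p * (a * x + b * y) × b ≡ q * (a * x + b * y))
  bézout a b with GCD.Bézout.lemma ∣ a ∣ ∣ b ∣
  ... | GCD.Bézout.result d g i =
    let x , y , d≡ = combination i
        p , a≡ = multiple a (proj₁ (GCD.GCD.commonDivisor g))
        q , b≡ = multiple b (proj₂ (GCD.GCD.commonDivisor g))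
    in x , y , p , q , trans a≡ (cong (p *_) d≡) , trans b≡ (cong (q *_) d≡)
    where
    open ≡-Reasoning
    difference : ∀ u v m n → d ℕ.+ v ℕ.* n ≡ u ℕ.* m → + d ≡ + u * + m - + v * + n
    difference u v m n eq = begin
      + d                                 ≡⟨ solve 2 (λ d e → d := (d :+ e) :- e) refl (+ d) (+ v * + n) ⟩
      (+ d + + v * + n) - + v * + n       ≡⟨ cong (λ z → (+ d + z) - + v * + n) (sym (pos-* v n)) ⟩
      + (d ℕ.+ v ℕ.* n) - + v * + n       ≡⟨ cong (λ z → + z - + v * + n) eq ⟩
      + (u ℕ.* m) - + v * + n             ≡⟨ cong (_- + v * + n) (pos-* u m) ⟩
      + u * + m - + v * + n               ∎
    s = proj₁ (sign-abs a)
    t = proj₁ (sign-abs b)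
    combination : GCD.Bézout.Identity d ∣ a ∣ ∣ b ∣ → ∃[ x ] ∃[ y ] + d ≡ a * x + b * y
    combination (GCD.Bézout.+- u v eq) = s * + u , - (t * + v) , (begin
      + d                                       ≡⟨ difference u v ∣ a ∣ ∣ b ∣ eq ⟩
      + u * + ∣ a ∣ - + v * + ∣ b ∣
        ≡⟨ cong₂ (λ m n → + u * m - + v * n) (proj₂ (proj₂ (sign-abs a))) (proj₂ (proj₂ (sign-abs b))) ⟩
      + u * (s * a) - + v * (t * b)
        ≡⟨ solve 6 (λ u s a v t b → u :* (s :* a) :- v :* (t :* b) := a :* (s :* u) :+ b :* :- (t :* v)) refl
        (+ u) s a (+ v) t b ⟩
      a * (s * + u) + b * - (t * + v)           ∎)
    combination (GCD.Bézout.-+ u v eq) = - (s * + u) , t * + v , (begin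
      + d                                       ≡⟨ difference v u ∣ b ∣ ∣ a ∣ eq ⟩
      + v * + ∣ b ∣ - + u * + ∣ a ∣
        ≡⟨ cong₂ (λ n m → + v * n - + u * m) (proj₂ (proj₂ (sign-abs b))) (proj₂ (proj₂ (sign-abs a))) ⟩
      + v * (t * b) - + u * (s * a)
        ≡⟨ solve 6 (λ u s a v t b → v :* (t :* b) :- u :* (s :* a) := a :* :- (s :* u) :+ b :* (t :* v)) refl
        (+ u) s a (+ v) t b ⟩
      a * - (s * + u) + b * (t * + v)           ∎)
    multiple : ∀ c → d ∣ ∣ c ∣ → ∃[ q ] c ≡ q * + d
    multiple c (divides k eq) = proj₁ (sign-abs c) * + k , (begin
      c                                      ≡⟨ proj₁ (proj₂ (sign-abs c)) ⟩
      proj₁ (sign-abs c) * + ∣ c ∣           ≡⟨ cong (λ z → proj₁ (sign-abs c) * + z) eq ⟩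
      proj₁ (sign-abs c) * + (k ℕ.* d)       ≡⟨ cong (proj₁ (sign-abs c) *_) (pos-* k d) ⟩
      proj₁ (sign-abs c) * (+ k * + d)       ≡⟨ sym (*-assoc (proj₁ (sign-abs c)) (+ k) (+ d)) ⟩
      proj₁ (sign-abs c) * + k * + d         ∎)

  ∙-scaleʳ : ∀ {n} (a : Vector ℤ n) k x → a ∙ (λ i → k * x i) ≡ k * a ∙ x
  ∙-scaleʳ {zero}  a k x = sym (*-zeroʳ k)
  ∙-scaleʳ {suc n} a k x = trans (cong (λ z → a zero * (k * x zero) + z) (∙-scaleʳ (tail a) k (tail x)))
    (solve 4 (λ a k x r → a :* (k :* x) :+ k :* r := k :* (a :* x :+ r)) refl (a zero) k (x zero)
      (tail a ∙ tail x))

  bézout-vector : ∀ {n} (c : Vector ℤ n) →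
                  ∃ λ (x : Vector ℤ n) → ∃ λ (q : Vector ℤ n) → ∀ i → c i ≡ q i * c ∙ x
  bézout-vector {zero}  c = (λ ()) , (λ ()) , λ ()
  bézout-vector {suc n} c = u ∷ (λ i → v * y i) , p ∷ (λ i → r i * q) , λ
    { zero    → trans p≡ (cong (p *_) g≡)
    ; (suc i) → trans (r≡ i) (trans (cong (r i *_) (trans q≡ (cong (q *_) g≡)))
                  (sym (*-assoc (r i) q (c ∙ (u ∷ λ i → v * y i))))) }
    where
    ih = bézout-vector (tail c)
    y = proj₁ ih
    r = proj₁ (proj₂ ih)
    r≡ = proj₂ (proj₂ ih)
    bz = bézout (head c) (tail c ∙ y)
    u = proj₁ bz
    v = proj₁ (proj₂ bz)
    p = proj₁ (proj₂ (proj₂ bz))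
    q = proj₁ (proj₂ (proj₂ (proj₂ bz)))
    p≡ = proj₁ (proj₂ (proj₂ (proj₂ (proj₂ bz))))
    q≡ = proj₂ (proj₂ (proj₂ (proj₂ (proj₂ bz))))
    g≡ : head c * u + tail c ∙ y * v ≡ c ∙ (u ∷ λ i → v * y i)
    g≡ = cong (λ z → head c * u + z) (trans (*-comm (tail c ∙ y) v) (sym (∙-scaleʳ (tail c) v y)))

  module _ (em : ExcludedMiddle 0ℓ) where

    -- Every strict drop lowers s by at least 1, and the distance to the lower bound l, kept as
    -- fuel, allows only finitely many drops. Excluded middle decides whether a further drop is to
    -- come.
    antitone-stabilises : (s : ℕ → ℤ) (l : ℤ) → (∀ m k → s (m ℕ.+ k) ≤ s m) → (∀ m → l ≤ s m) →
                          ∃[ m₀ ] ∀ m → m₀ ℕ.≤ m → s m ≡ s m₀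
    antitone-stabilises s l antitone l≤s = from ∣ s 0 - l ∣ 0 (≤-reflexive (sym (0≤i⇒+∣i∣≡i (i≤j⇒0≤j-i (l≤s 0)))))
      where
      from : ∀ fuel m → s m - l ≤ + fuel → ∃[ m₀ ] ∀ m → m₀ ℕ.≤ m → s m ≡ s m₀
      from fuel m le with em {∃[ k ] s (m ℕ.+ k) < s m}
      ... | no ∄ = m , λ m′ m≤m′ → subst (λ z → s z ≡ s m) (ℕₚ.m+[n∸m]≡n m≤m′)
                     (≤-antisym (antitone m (m′ ℕ.∸ m)) (≮⇒≥ λ lt → ∄ (m′ ℕ.∸ m , lt)))
      from zero m le | yes (k , lt) = contradiction (≤-<-trans (l≤s (m ℕ.+ k)) (<-≤-trans lt (i-j≤0⇒i≤j le)))
        (<-irrefl refl)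
      from (suc fuel) m le | yes (k , lt) = from fuel (m ℕ.+ k) (i<suc[j]⇒i≤j (<-≤-trans (+-monoˡ-< (- l) lt) le))
  module _ {n : ℕ} where

    Congruent : (Vector ℤ n → ℤ) → Set
    Congruent h = ∀ {x y} → x ≗ y → h x ≡ h y

    Subadditive : (Vector ℤ n → ℤ) → Set
    Subadditive h = ∀ x y → h (λ i → x i + y i) ≤ h x + h y

    Homogeneous : (Vector ℤ n → ℤ) → Set
    Homogeneous h = ∀ k x → h (λ i → + k * x i) ≡ + k * h x

  -- Subtracting from h the linear function z ↦ c z along the first axis leaves an
  -- antitone bounded function of z, which stabilises because it is integral.
  module FirstAxisLimit {n} {h : Vector ℤ (suc n) → ℤ}
    (h-cong : Congruent h) (h-sub : Subadditive h) (h-hom : Homogeneous h) where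
    open ≤-Reasoning

    c : ℤ
    c = h (1ℤ ∷ λ _ → 0ℤ)

    slope : ℤ → Vector ℤ n → ℤ
    slope z y = h (z ∷ y) - z * c

    h-axis : ∀ k → h (+ k ∷ λ _ → 0ℤ) ≡ + k * c
    h-axis k = trans (h-cong λ { zero → sym (*-identityʳ (+ k)) ; (suc i) → sym (*-zeroʳ (+ k)) })
      (h-hom k (1ℤ ∷ λ _ → 0ℤ))

    slope-antitone : ∀ z k y → slope (z + + k) y ≤ slope z y
    slope-antitone z k y = begin
      h (z + + k ∷ y) - (z + + k) * c
        ≡⟨ cong (_- (z + + k) * c) (h-cong λ { zero → refl ; (suc i) → sym (+-identityʳ (y i)) }) ⟩
      h (λ i → (z ∷ y) i + (+ k ∷ λ _ → 0ℤ) i) - (z + + k) * c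
        ≤⟨ +-monoˡ-≤ (- ((z + + k) * c)) (h-sub (z ∷ y) (+ k ∷ λ _ → 0ℤ)) ⟩
      h (z ∷ y) + h (+ k ∷ λ _ → 0ℤ) - (z + + k) * c
        ≡⟨ cong (λ w → h (z ∷ y) + w - (z + + k) * c) (h-axis k) ⟩
      h (z ∷ y) + + k * c - (z + + k) * c
        ≡⟨ solve 4 (λ r k c z → r :+ k :* c :- (z :+ k) :* c := r :- z :* c) refl (h (z ∷ y)) (+ k) c z ⟩
      slope z y ∎

    -- Subadditivity for (m, y) + (0, -y) = (m, 0), where h has the value m c.
    slope-bounded : ∀ y m → - h (0ℤ ∷ λ i → - y i) ≤ slope (+ m) y
    slope-bounded y m = begin
      - h₋                                     ≡⟨ solve 2 (λ r k → :- r := k :+ (:- r :- k)) refl h₋ (+ m * c) ⟩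
      + m * c + (- h₋ - + m * c)               ≡⟨ cong (_+ (- h₋ - + m * c)) (sym (h-axis m)) ⟩
      h (+ m ∷ λ _ → 0ℤ) + (- h₋ - + m * c)
        ≡⟨ cong (_+ (- h₋ - + m * c))
          (h-cong λ { zero → sym (+-identityʳ (+ m)) ; (suc i) → sym (+-inverseʳ (y i)) }) ⟩
      h (λ i → (+ m ∷ y) i + (0ℤ ∷ λ i → - y i) i) + (- h₋ - + m * c)
        ≤⟨ +-monoˡ-≤ (- h₋ - + m * c) (h-sub (+ m ∷ y) (0ℤ ∷ λ i → - y i)) ⟩
      h (+ m ∷ y) + h₋ + (- h₋ - + m * c)
        ≡⟨ solve 3 (λ r s k → r :+ s :+ (:- s :- k) := r :- k) refl (h (+ m ∷ y)) h₋ (+ m * c) ⟩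
      slope (+ m) y ∎
      where h₋ = h (0ℤ ∷ λ i → - y i)

    -- As an eventual value of antitone slopes, g y is the minimum over all integers z of h (z, y) -
    -- z c. A partial minimum of a sublinear function is again sublinear, which reduces the
    -- dimension by one.
    module Limit (g : Vector ℤ n → ℤ)
      (stable : ∀ y → ∃[ m₀ ] ∀ m → m₀ ℕ.≤ m → slope (+ m) y ≡ g y) where

      threshold : Vector ℤ n → ℕ
      threshold y = proj₁ (stable y)

      g≡ : ∀ y {m} → threshold y ℕ.≤ m → slope (+ m) y ≡ g y
      g≡ y = proj₂ (stable y) _

      g≤ : ∀ z y → g y ≤ slope z y
      g≤ z y = begin
        g y                                       ≡⟨ g≡ y (ℕₚ.m≤m+n (threshold y) ∣ z ∣) ⟨
        slope (+ m) y                             ≡⟨ cong (λ w → slope w y) shift ⟩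
        slope (z + + ∣ + m - z ∣) y               ≤⟨ slope-antitone z _ y ⟩
        slope z y ∎
        where
        -- Large enough to be past the threshold and to exceed z by a natural number.
        m = threshold y ℕ.+ ∣ z ∣
        i≤∣i∣ : ∀ i → i ≤ + ∣ i ∣
        i≤∣i∣ (+ n) = ≤-refl
        i≤∣i∣ -[1+ n ] = ℤ.-≤+
        shift : + m ≡ z + + ∣ + m - z ∣
        shift = trans (solve 2 (λ w z → w := z :+ (w :- z)) refl (+ m) z)
          (cong (λ w → z + w) (sym (0≤i⇒+∣i∣≡i
            (i≤j⇒0≤j-i (≤-trans (i≤∣i∣ z) (ℤ.+≤+ (ℕₚ.m≤n+m ∣ z ∣ (threshold y))))))))

      g-cong : Congruent g
      g-cong {x} {y} x≗y = trans (sym (g≡ x (ℕₚ.m≤m⊔n _ _)))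
        (trans (cong (_- + m * c) (h-cong λ { zero → refl ; (suc i) → x≗y i })) (g≡ y (ℕₚ.m≤n⊔m _ _)))
        where m = threshold x ℕ.⊔ threshold y

      g-sub : Subadditive g
      g-sub x y = begin
        g (λ i → x i + y i)                          ≤⟨ g≤ (+ m + + m) (λ i → x i + y i) ⟩
        h (+ m + + m ∷ λ i → x i + y i) - (+ m + + m) * c
          ≡⟨ cong (_- (+ m + + m) * c) (h-cong λ { zero → refl ; (suc i) → refl }) ⟩
        h (λ i → (+ m ∷ x) i + (+ m ∷ y) i) - (+ m + + m) * c
          ≤⟨ +-monoˡ-≤ (- ((+ m + + m) * c)) (h-sub (+ m ∷ x) (+ m ∷ y)) ⟩
        h (+ m ∷ x) + h (+ m ∷ y) - (+ m + + m) * c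
          ≡⟨ solve 4 (λ r s m c → r :+ s :- (m :+ m) :* c := (r :- m :* c) :+ (s :- m :* c)) refl (h (+ m ∷ x))
            (h (+ m ∷ y)) (+ m) c ⟩
        slope (+ m) x + slope (+ m) y                ≡⟨ cong₂ _+_ (g≡ x (ℕₚ.m≤m⊔n _ _)) (g≡ y (ℕₚ.m≤n⊔m _ _)) ⟩
        g x + g y                                    ∎
        where m = threshold x ℕ.⊔ threshold y

      slope-hom : ∀ k m x → slope (+ k * + m) (λ i → + k * x i) ≡ + k * slope (+ m) x
      slope-hom k m x = trans
        (cong (_- + k * + m * c) (trans (h-cong λ { zero → refl ; (suc i) → refl }) (h-hom k (+ m ∷ x))))
        (solve 4 (λ k r m c → k :* r :- k :* m :* c := k :* (r :- m :* c)) refl (+ k) (h (+ m ∷ x)) (+ m) c)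

      g-hom⁺ : ∀ k .{{_ : ℕ.NonZero k}} x → g (λ i → + k * x i) ≡ + k * g x
      g-hom⁺ k x = begin-equality
        g (λ i → + k * x i)
          ≡⟨ g≡ (λ i → + k * x i) (ℕₚ.≤-trans (ℕₚ.m≤m⊔n _ _) (ℕₚ.m≤n*m m k)) ⟨
        slope (+ (k ℕ.* m)) (λ i → + k * x i)      ≡⟨ cong (λ z → slope z (λ i → + k * x i)) (pos-* k m) ⟩
        slope (+ k * + m) (λ i → + k * x i)        ≡⟨ slope-hom k m x ⟩
        + k * slope (+ m) x                        ≡⟨ cong (+ k *_) (g≡ x (ℕₚ.m≤n⊔m _ _)) ⟩
        + k * g x                                  ∎
        where m = threshold (λ i → + k * x i) ℕ.⊔ threshold x

      g-hom : Homogeneous g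
      -- For k = 0 the multiple `+ k * + m` does not get past the threshold; instead h is evaluated
      -- on the first axis, where it is known.
      g-hom zero x = begin-equality
        g (λ i → 0ℤ * x i)                         ≡⟨ g≡ (λ i → 0ℤ * x i) ℕₚ.≤-refl ⟨
        slope (+ m) (λ i → 0ℤ * x i)
          ≡⟨ cong (_- + m * c) (trans (h-cong λ { zero → refl ; (suc i) → refl }) (h-axis m)) ⟩
        + m * c - + m * c                          ≡⟨ +-inverseʳ (+ m * c) ⟩
        0ℤ * g x                                   ∎
        where m = threshold (λ i → 0ℤ * x i)
      g-hom (suc k) x = g-hom⁺ (suc k) x

      extend : (∃ λ (a : Vector ℤ n) → ∀ y → a ∙ y ≤ g y) → ∃ λ (a : Vector ℤ (suc n)) → ∀ x → a ∙ x ≤ h x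
      extend (a , a≤g) = c ∷ a , λ x → begin
        c * head x + a ∙ tail x                         ≤⟨ +-monoʳ-≤ (c * head x) (a≤g (tail x)) ⟩
        c * head x + g (tail x)                         ≤⟨ +-monoʳ-≤ (c * head x) (g≤ (head x) (tail x)) ⟩
        c * head x + (h (head x ∷ tail x) - head x * c)
          ≡⟨ solve 3 (λ c x r → c :* x :+ (r :- x :* c) := r) refl c (head x) (h (head x ∷ tail x)) ⟩
        h (head x ∷ tail x)                             ≡⟨ h-cong (λ { zero → refl ; (suc i) → refl }) ⟩
        h x                                             ∎

  -- The coefficient chosen for the first axis is the value of h at the first unit vector. No
  -- functional below h can have a larger one, and it is an integer because h is integer-valued.
  -- What remains is to stay below g in one dimension less; in dimension 0, homogeneity with factor
  -- 0 gives h = 0.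
  integral-hahn-banach :
    ExcludedMiddle 0ℓ → ∀ {n} {h : Vector ℤ n → ℤ} →
    Congruent h → Subadditive h → Homogeneous h → ∃ λ (a : Vector ℤ n) → ∀ x → a ∙ x ≤ h x
  integral-hahn-banach em {zero}      h-cong h-sub h-hom =
    (λ ()) , λ x → ≤-reflexive (sym (trans (h-cong λ ()) (h-hom 0 x)))
  integral-hahn-banach em {suc n} {h} h-cong h-sub h-hom =
    through (λ y → slope (+ proj₁ (stable y)) y) (λ y → proj₁ (stable y) , proj₂ (stable y))
    where
    open FirstAxisLimit h-cong h-sub h-hom
    stable : ∀ y → ∃[ m₀ ] ∀ m → m₀ ℕ.≤ m → slope (+ m) y ≡ slope (+ m₀) y
    stable y = antitone-stabilises em (λ m → slope (+ m) y) (- h (0ℤ ∷ λ i → - y i))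
      (λ m k → slope-antitone (+ m) k y) (slope-bounded y)
    through : ∀ g → (∀ y → ∃[ m₀ ] ∀ m → m₀ ℕ.≤ m → slope (+ m) y ≡ g y) →
              ∃ λ (a : Vector ℤ (suc n)) → ∀ x → a ∙ x ≤ h x
    through g g-stable = extend (integral-hahn-banach em g-cong g-sub g-hom)
      where open Limit g g-stable

open IntegerVectors

-- Arithmetic and order in a complete ordered field

module OrderedField (em : ExcludedMiddle 0ℓ) (ℝ : CompleteOrderedField) where

  open CompleteOrderedField ℝ public hiding (zero)
  private
    module ≤ = IsTotalOrder isTotalOrder

  open SemiringMult semiring using (×-homo-+; ×1-homo-*)
  open RingProperties ring using (-‿distribˡ-*; -‿distribʳ-*; -‿involutive; -0#≈0#)
  open AbelianGroupProperties +-abelianGroup using (⁻¹-∙-comm)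

  module ≈-Reasoning = SetoidReasoning setoid

  private
    module _ where
      open ≈-Reasoning

      cancel-suc : ∀ a b → a - b ≈ (1# + a) - (1# + b)
      cancel-suc a b = begin
        a - b                       ≈⟨ +-identityˡ _ ⟨
        0# + (a - b)                ≈⟨ +-congʳ (-‿inverseʳ 1#) ⟨
        (1# - 1#) + (a - b)         ≈⟨ +-assoc _ _ _ ⟩
        1# + (- 1# + (a - b))       ≈⟨ +-congˡ (+-assoc _ _ _) ⟨
        1# + ((- 1# + a) - b)       ≈⟨ +-congˡ (+-congʳ (+-comm _ _)) ⟩
        1# + ((a - 1#) - b)         ≈⟨ +-congˡ (+-assoc _ _ _) ⟩
        1# + (a + (- 1# - b))       ≈⟨ +-assoc _ _ _ ⟨
        (1# + a) + (- 1# - b)       ≈⟨ +-congˡ (⁻¹-∙-comm 1# b) ⟩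
        (1# + a) - (1# + b)         ∎

      fromℤ-⊖ : ∀ m n → fromℤ (m ⊖ n) ≈ m ℕ· 1# - n ℕ· 1#
      fromℤ-⊖ zero    zero    = sym (-‿inverseʳ 0#)
      fromℤ-⊖ zero    (suc n) = sym (+-identityˡ _)
      fromℤ-⊖ (suc m) zero    = sym (trans (+-congˡ -0#≈0#) (+-identityʳ _))
      fromℤ-⊖ (suc m) (suc n) = begin
        fromℤ (suc m ⊖ suc n)           ≡⟨ ≡.cong fromℤ (ℤₚ.[1+m]⊖[1+n]≡m⊖n m n) ⟩
        fromℤ (m ⊖ n)                   ≈⟨ fromℤ-⊖ m n ⟩
        m ℕ· 1# - n ℕ· 1#               ≈⟨ cancel-suc _ _ ⟩
        suc m ℕ· 1# - suc n ℕ· 1#       ∎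

  module _ where
    open ≈-Reasoning

    fromℤ-neg : ∀ a → fromℤ (ℤ.- a) ≈ - fromℤ a
    fromℤ-neg (+ zero)  = sym -0#≈0#
    fromℤ-neg (+ suc n) = refl
    fromℤ-neg -[1+ n ]  = sym (-‿involutive _)

    fromℤ-+ : ∀ a b → fromℤ (a ℤ.+ b) ≈ fromℤ a + fromℤ b
    fromℤ-+ (+ m)    (+ n)    = ×-homo-+ 1# m n
    fromℤ-+ (+ m)    -[1+ n ] = fromℤ-⊖ m (suc n)
    fromℤ-+ -[1+ m ] (+ n)    = trans (fromℤ-⊖ n (suc m)) (+-comm _ _)
    fromℤ-+ -[1+ m ] -[1+ n ] = begin
      - (suc (suc (m ℕ.+ n)) ℕ· 1#)     ≡⟨ ≡.cong (λ k → - (k ℕ· 1#)) (≡.cong suc (≡.sym (ℕₚ.+-suc m n))) ⟩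
      - ((suc m ℕ.+ suc n) ℕ· 1#)       ≈⟨ -‿cong (×-homo-+ 1# (suc m) (suc n)) ⟩
      - (suc m ℕ· 1# + suc n ℕ· 1#)     ≈⟨ ⁻¹-∙-comm _ _ ⟨
      - (suc m ℕ· 1#) - (suc n ℕ· 1#)   ∎

    private
      fromℤ-*⁺ : ∀ m b → fromℤ (+ m ℤ.* b) ≈ m ℕ· 1# * fromℤ b
      fromℤ-*⁺ m (+ n)    = begin
        fromℤ (+ m ℤ.* + n)      ≡⟨ ≡.cong fromℤ (≡.sym (ℤₚ.pos-* m n)) ⟩
        (m ℕ.* n) ℕ· 1#          ≈⟨ ×1-homo-* m n ⟩
        m ℕ· 1# * n ℕ· 1#        ∎
      fromℤ-*⁺ m -[1+ n ] = begin
        fromℤ (+ m ℤ.* ℤ.- (+ suc n))      ≡⟨ ≡.cong fromℤ (≡.sym (ℤₚ.neg-distribʳ-* (+ m) (+ suc n))) ⟩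
        fromℤ (ℤ.- (+ m ℤ.* + suc n))      ≈⟨ fromℤ-neg (+ m ℤ.* + suc n) ⟩
        - fromℤ (+ m ℤ.* + suc n)          ≈⟨ -‿cong (fromℤ-*⁺ m (+ suc n)) ⟩
        - (m ℕ· 1# * suc n ℕ· 1#)          ≈⟨ -‿distribʳ-* _ _ ⟩
        m ℕ· 1# * - (suc n ℕ· 1#)          ∎

    fromℤ-* : ∀ a b → fromℤ (a ℤ.* b) ≈ fromℤ a * fromℤ b
    fromℤ-* (+ m)    b = fromℤ-*⁺ m b
    fromℤ-* -[1+ m ] b = begin
      fromℤ (ℤ.- (+ suc m) ℤ.* b)        ≡⟨ ≡.cong fromℤ (≡.sym (ℤₚ.neg-distribˡ-* (+ suc m) b)) ⟩
      fromℤ (ℤ.- (+ suc m ℤ.* b))        ≈⟨ fromℤ-neg (+ suc m ℤ.* b) ⟩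
      - fromℤ (+ suc m ℤ.* b)            ≈⟨ -‿cong (fromℤ-*⁺ (suc m) b) ⟩
      - (suc m ℕ· 1# * fromℤ b)          ≈⟨ -‿distribˡ-* _ _ ⟩
      - (suc m ℕ· 1#) * fromℤ b          ∎

    fromℤ-1 : fromℤ (+ 1) ≈ 1#
    fromℤ-1 = +-identityʳ 1#

  -- The solver's coefficients; unlike fromℤ, `coeff 1` is 1# by computation.
  private
    coeff : ℤ → Carrier
    coeff (+ 0) = 0#
    coeff (+ 1) = 1#
    coeff (+ suc (suc n)) = fromℤ (+ suc (suc n))
    coeff -[1+ 0 ] = - 1#
    coeff -[1+ suc n ] = fromℤ -[1+ suc n ]

    coeff≈ : ∀ a → coeff a ≈ fromℤ a
    coeff≈ (+ 0) = refl
    coeff≈ (+ 1) = sym fromℤ-1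
    coeff≈ (+ suc (suc n)) = refl
    coeff≈ -[1+ 0 ] = -‿cong (sym fromℤ-1)
    coeff≈ -[1+ suc n ] = refl

    ℤ-rawRing : RawRing 0ℓ 0ℓ
    ℤ-rawRing = CommutativeRing.rawRing ℤₚ.+-*-commutativeRing

    morphism : ℤ-rawRing -Raw-AlmostCommutative⟶ fromCommutativeRing commutativeRing
    morphism = record
      { ⟦_⟧    = coeff
      ; +-homo = λ a b → trans (coeff≈ (a ℤ.+ b)) (trans (fromℤ-+ a b) (+-cong (sym (coeff≈ a)) (sym (coeff≈ b))))
      ; *-homo = λ a b → trans (coeff≈ (a ℤ.* b)) (trans (fromℤ-* a b) (*-cong (sym (coeff≈ a)) (sym (coeff≈ b))))
      ; -‿homo = λ a → trans (coeff≈ (ℤ.- a)) (trans (fromℤ-neg a) (-‿cong (sym (coeff≈ a))))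
      ; 0-homo = refl
      ; 1-homo = refl
      }

    coeff-≟ : ∀ a b → Maybe (coeff a ≈ coeff b)
    coeff-≟ a b with a ℤₚ.≟ b
    ... | yes a≡b = just (reflexive (≡.cong coeff a≡b))
    ... | no  _   = nothing

  module Solver = RingSolver ℤ-rawRing (fromCommutativeRing commutativeRing) morphism coeff-≟
  open Solver public using (solve; _:=_; _:+_; _:*_; _:-_; :-_; con)

  ≤-refl : ∀ {x} → x ≤ x
  ≤-refl = ≤.refl
  ≤-reflexive : ∀ {x y} → x ≈ y → x ≤ y
  ≤-reflexive = ≤.reflexive
  ≤-trans : ∀ {x y z} → x ≤ y → y ≤ z → x ≤ z
  ≤-trans = ≤.trans
  ≤-antisym : ∀ {x y} → x ≤ y → y ≤ x → x ≈ y
  ≤-antisym = ≤.antisym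
  ≤-total : ∀ x y → x ≤ y ⊎ y ≤ x
  ≤-total = ≤.total
  ≤-resp : ∀ {x x′ y y′} → x ≈ x′ → y ≈ y′ → x ≤ y → x′ ≤ y′
  ≤-resp p q r = ≤-trans (≤-reflexive (sym p)) (≤-trans r (≤-reflexive q))


  -- The format of most inequality proofs below: e is a certificate, a combination of nonnegative
  -- quantities, and the ring solver checks that it equals the difference of the two sides.
  ≤-by : ∀ {x y} e → 0# ≤ e → e ≈ y - x → x ≤ y
  ≤-by {x} {y} e 0≤e e≈ = ≤-resp (+-identityʳ x)
    (trans (+-congˡ e≈) (solve 2 (λ x y → x :+ (y :- x) := y) refl x y)) (+-monoʳ-≤ x 0≤e)

  0≤- : ∀ {x y} → x ≤ y → 0# ≤ y - x
  0≤- {x} {y} x≤y = ≤-resp (-‿inverseˡ x) (+-comm _ _) (+-monoʳ-≤ (- x) x≤y)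

  ≈-by : ∀ {x y e} → e ≈ 0# → e ≈ y - x → x ≈ y
  ≈-by {x} {y} e≈0 e≈ = trans (sym (+-identityʳ x))
    (trans (+-congˡ (trans (sym e≈0) e≈)) (solve 2 (λ x y → x :+ (y :- x) := y) refl x y))

  -≈0 : ∀ {x y} → x ≈ y → y - x ≈ 0#
  -≈0 {x} x≈y = trans (+-congʳ (sym x≈y)) (-‿inverseʳ x)

  <⇒≤ : ∀ {x y} → x < y → x ≤ y
  <⇒≤ = proj₁

  <⇒≱ : ∀ {x y} → x < y → ¬ (y ≤ x)
  <⇒≱ (x≤y , x≉y) y≤x = x≉y (≤-antisym x≤y y≤x)

  ≰⇒> : ∀ {x y} → ¬ (x ≤ y) → y < x
  ≰⇒> {x} {y} x≰y with ≤-total x y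
  ... | inj₁ x≤y = contradiction x≤y x≰y
  ... | inj₂ y≤x = y≤x , λ y≈x → x≰y (≤-reflexive (sym y≈x))

  ≤⊎> : ∀ x y → x ≤ y ⊎ y < x
  ≤⊎> x y with em {x ≤ y}
  ... | yes x≤y = inj₁ x≤y
  ... | no  x≰y = inj₂ (≰⇒> x≰y)

  ≮⇒≥ : ∀ {x y} → ¬ (x < y) → y ≤ x
  ≮⇒≥ {x} {y} x≮y with ≤⊎> y x
  ... | inj₁ y≤x = y≤x
  ... | inj₂ x<y = contradiction x<y x≮y

  <-≤-trans : ∀ {x y z} → x < y → y ≤ z → x < z
  <-≤-trans x<y y≤z = ≤-trans (<⇒≤ x<y) y≤z , λ x≈z → <⇒≱ x<y (≤-trans y≤z (≤-reflexive (sym x≈z)))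

  ≤-<-trans : ∀ {x y z} → x ≤ y → y < z → x < z
  ≤-<-trans x≤y y<z = ≤-trans x≤y (<⇒≤ y<z) , λ x≈z → <⇒≱ y<z (≤-trans (≤-reflexive (sym x≈z)) x≤y)

  <-resp : ∀ {x x′ y y′} → x ≈ x′ → y ≈ y′ → x < y → x′ < y′
  <-resp p q r = ≤-<-trans (≤-reflexive (sym p)) (<-≤-trans r (≤-reflexive q))

  <-by : ∀ {x y} e → 0# < e → e ≈ y - x → x < y
  <-by {x} {y} e 0<e e≈ = ≤-by e (<⇒≤ 0<e) e≈ , λ x≈y → proj₂ 0<e (sym (trans e≈ (-≈0 x≈y)))

  0<- : ∀ {x y} → x < y → 0# < y - x
  0<- {x} {y} x<y = 0≤- (<⇒≤ x<y) , λ 0≈ → proj₂ x<y (≈-by (sym 0≈) refl)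

  +-nonNeg : ∀ {x y} → 0# ≤ x → 0# ≤ y → 0# ≤ x + y
  +-nonNeg {x} 0≤x 0≤y = ≤-trans 0≤x (≤-resp (+-identityʳ x) refl (+-monoʳ-≤ x 0≤y))

  +-pos-nonNeg : ∀ {x y} → 0# < x → 0# ≤ y → 0# < x + y
  +-pos-nonNeg {x} 0<x 0≤y = <-≤-trans 0<x (≤-resp (+-identityʳ x) refl (+-monoʳ-≤ x 0≤y))

  +-mono-≤ : ∀ {x y u v} → x ≤ y → u ≤ v → x + u ≤ y + v
  +-mono-≤ {x} {y} {u} {v} p q = ≤-by ((y - x) + (v - u)) (+-nonNeg (0≤- p) (0≤- q))
    (solve 4 (λ x y u v → (y :- x) :+ (v :- u) := (y :+ v) :- (x :+ u)) refl x y u v)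

  neg-mono-≤ : ∀ {x y} → x ≤ y → - y ≤ - x
  neg-mono-≤ {x} {y} p = ≤-by (y - x) (0≤- p) (solve 2 (λ x y → y :- x := :- x :- :- y) refl x y)

  *-monoˡ-≤ : ∀ {c x y} → 0# ≤ c → x ≤ y → c * x ≤ c * y
  *-monoˡ-≤ {c} {x} {y} 0≤c p = ≤-by (c * (y - x)) (*-nonNeg 0≤c (0≤- p))
    (solve 3 (λ c x y → c :* (y :- x) := c :* y :- c :* x) refl c x y)

  0≤1 : 0# ≤ 1#
  0≤1 with ≤-total 0# 1#
  ... | inj₁ p = p
  ... | inj₂ p = ≤-resp refl (solve 0 (:- con (+ 1) :* :- con (+ 1) := con (+ 1)) refl) (*-nonNeg q q)
    where q = ≤-resp (solve 0 (con (+ 1) :- con (+ 1) := con (+ 0)) refl)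
                     (solve 0 (con (+ 0) :- con (+ 1) := :- con (+ 1)) refl)
                     (≤-resp (+-comm _ _) (+-comm _ _) (+-monoʳ-≤ (- 1#) p))

  0<1 : 0# < 1#
  0<1 = 0≤1 , 0≉1

  *-≈0 : ∀ {x y} → ¬ (x ≈ 0#) → x * y ≈ 0# → y ≈ 0#
  *-≈0 {x} {y} x≉0 xy≈0 with inverse x x≉0
  ... | (z , xz≈1) = begin
    y             ≈⟨ *-identityˡ y ⟨
    1# * y        ≈⟨ *-congʳ xz≈1 ⟨
    (x * z) * y   ≈⟨ solve 3 (λ x z y → (x :* z) :* y := z :* (x :* y)) refl x z y ⟩
    z * (x * y)   ≈⟨ *-congˡ xy≈0 ⟩
    z * 0#        ≈⟨ zeroʳ z ⟩
    0#            ∎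
    where open ≈-Reasoning

  *-pos : ∀ {x y} → 0# < x → 0# < y → 0# < x * y
  *-pos (0≤x , 0≉x) (0≤y , 0≉y) =
    *-nonNeg 0≤x 0≤y , λ 0≈xy → 0≉y (sym (*-≈0 (λ x≈0 → 0≉x (sym x≈0)) (sym 0≈xy)))

  *-cancelˡ-≤ : ∀ {c x y} → 0# < c → c * x ≤ c * y → x ≤ y
  *-cancelˡ-≤ {c} {x} {y} 0<c p = ≮⇒≥ λ y<x → <⇒≱ (<-by (c * (x - y)) (*-pos 0<c (0<- y<x))
    (solve 3 (λ c x y → c :* (x :- y) := c :* x :- c :* y) refl c x y)) p

  pos-inverse : ∀ {x} → 0# < x → ∃[ y ] (0# < y × x * y ≈ 1#)
  pos-inverse {x} (0≤x , 0≉x) with inverse x (λ x≈0 → 0≉x (sym x≈0))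
  ... | y , xy≈1 with ≤⊎> y 0#
  ...   | inj₂ 0<y = y , 0<y , xy≈1
  ...   | inj₁ y≤0 = contradiction
    (≤-by (x * (0# - y)) (*-nonNeg 0≤x (0≤- y≤0))
      (trans (solve 2 (λ x y → x :* (con (+ 0) :- y) := con (+ 0) :- x :* y) refl x y) (+-congˡ (-‿cong xy≈1))))
    (<⇒≱ 0<1)

  0≤fromℕ : ∀ n → 0# ≤ fromℤ (+ n)
  0≤fromℕ zero    = ≤-refl
  0≤fromℕ (suc n) = +-nonNeg 0≤1 (0≤fromℕ n)

  0<fromℕ : ∀ n → 0# < fromℤ (+ suc n)
  0<fromℕ n = +-pos-nonNeg 0<1 (0≤fromℕ n)

  fromℤ-sub : ∀ a b → fromℤ (a ℤ.- b) ≈ fromℤ a - fromℤ b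
  fromℤ-sub a b = trans (fromℤ-+ a (ℤ.- b)) (+-congˡ (fromℤ-neg b))

  0≤fromℤ : ∀ {a} → 0ℤ ℤ.≤ a → 0# ≤ fromℤ a
  0≤fromℤ (ℤ.+≤+ {n = n} _) = 0≤fromℕ n

  fromℤ-mono : ∀ {a b} → a ℤ.≤ b → fromℤ a ≤ fromℤ b
  fromℤ-mono {a} {b} a≤b = ≤-by (fromℤ (b ℤ.- a)) (0≤fromℤ (ℤₚ.i≤j⇒0≤j-i a≤b)) (fromℤ-sub b a)

  fromℤ-cancel-≤ : ∀ {a b} → fromℤ a ≤ fromℤ b → a ℤ.≤ b
  fromℤ-cancel-≤ {a} {b} p with a ℤₚ.≤? b
  ... | yes q = q
  ... | no ¬q = contradiction p (<⇒≱ (<-≤-trans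
    (<-by 1# 0<1 (trans (solve 2 (λ x b → x := (b :+ x) :- b) refl 1# (fromℤ b))
      (+-congʳ (trans (+-comm _ _) (trans (+-congʳ (sym fromℤ-1)) (sym (fromℤ-+ (+ 1) b)))))))
    (fromℤ-mono (ℤₚ.i<j⇒suc[i]≤j (ℤₚ.≰⇒> ¬q)))))

  fromℤ-injective : ∀ {a b} → fromℤ a ≈ fromℤ b → a ≡ b
  fromℤ-injective p = ℤₚ.≤-antisym (fromℤ-cancel-≤ (≤-reflexive p)) (fromℤ-cancel-≤ (≤-reflexive (sym p)))

  -- If the naturals were bounded with supremum s, then n + 1 ≤ s for all n would make s - 1 an
  -- upper bound as well.
  archimedean : ∀ x → ∃[ n ] x ≤ fromℤ (+ n)
  archimedean x with em {∃[ n ] x ≤ fromℤ (+ n)}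
  ... | yes p = p
  ... | no ¬p = contradiction s≤s-1
    (<⇒≱ (<-by 1# 0<1 (solve 1 (λ s → con (+ 1) := s :- (s :- con (+ 1))) refl s)))
    where
    Natural : Carrier → Set
    Natural y = ∃[ n ] y ≈ fromℤ (+ n)
    sup = supremum Natural (0# , 0 , refl)
      (x , λ y (n , y≈n) → ≤-trans (≤-reflexive y≈n) (<⇒≤ (≰⇒> (λ x≤n → ¬p (n , x≤n)))))
    s = proj₁ sup
    s≤s-1 : s ≤ s - 1#
    s≤s-1 = proj₂ (proj₂ sup) (s - 1#) λ y (n , y≈n) →
      ≤-by (s - (1# + fromℤ (+ n))) (0≤- (proj₁ (proj₂ sup) (fromℤ (+ suc n)) (suc n , refl)))
        (trans (solve 2 (λ s n → s :- (con (+ 1) :+ n) := (s :- con (+ 1)) :- n) refl s (fromℤ (+ n)))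
               (+-congˡ (-‿cong (sym y≈n))))

  -- The upper estimate is weak, so m is not unique for integral x; only the rounding error of at
  -- most 1 matters. The search descends from a natural number above x + n, where -n is below x.
  floor : ∀ x → ∃[ m ] (fromℤ m ≤ x × x ≤ fromℤ m + 1#)
  floor x = below (proj₁ (archimedean (x + fromℤ (+ n)))) (proj₂ (archimedean (x + fromℤ (+ n))))
    where
    n = proj₁ (archimedean (- x))
    -n≤x : fromℤ (ℤ.- (+ n)) ≤ x
    -n≤x = ≤-resp (sym (fromℤ-neg (+ n))) (-‿involutive x) (neg-mono-≤ (proj₂ (archimedean (- x))))
    below : ∀ k → x + fromℤ (+ n) ≤ fromℤ (+ k) → ∃[ m ] (fromℤ m ≤ x × x ≤ fromℤ m + 1#)
    below zero    p = ℤ.- (+ n) , -n≤x , ≤-by ((0# - (x + fromℤ (+ n))) + 1#) (+-nonNeg (0≤- p) 0≤1)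
      (trans (solve 2 (λ x n → (con (+ 0) :- (x :+ n)) :+ con (+ 1) := (:- n :+ con (+ 1)) :- x) refl x
        (fromℤ (+ n)))
             (+-congʳ (+-congʳ (sym (fromℤ-neg (+ n))))))
    below (suc k) p with ≤⊎> (x + fromℤ (+ n)) (fromℤ (+ k))
    ... | inj₁ q = below k q
    ... | inj₂ q = + k ℤ.- + n
      , ≤-by _ (0≤- (<⇒≤ q)) (trans
          (solve 3 (λ x k n → (x :+ n) :- k := x :- (k :- n)) refl x (fromℤ (+ k)) (fromℤ (+ n)))
          (+-congˡ (-‿cong (sym (fromℤ-sub (+ k) (+ n))))))
      , ≤-by _ (0≤- p) (trans (solve 3 (λ x k n → (con (+ 1) :+ k) :- (x :+ n) := ((k :- n) :+ con (+ 1)) :- x)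
          refl x (fromℤ (+ k)) (fromℤ (+ n)))
          (+-congʳ (+-congʳ (sym (fromℤ-sub (+ k) (+ n))))))

  -- Sums, scalar products and projections onto kernels of integral equations

  open SemiringSum semiring public using
    (sum-cong-≋; ∑-distrib-+; *-distribˡ-sum; *-distribʳ-sum; ∑-comm; sum-replicate-zero)

  dot : ∀ {n} → Vector ℤ n → Vector Carrier n → Carrier
  dot a x = sum (λ i → fromℤ (a i) * x i)

  real : ∀ {n} → Vector ℤ n → Vector Carrier n
  real d i = fromℤ (d i)

  dot-cong : ∀ {n} (a : Vector ℤ n) {x y} → x ≋ y → dot a x ≈ dot a y
  dot-cong a x≋y = sum-cong-≋ λ i → *-congˡ (x≋y i)

  dot-linear : ∀ {n} (a : Vector ℤ n) x t y → dot a (λ i → x i + t * y i) ≈ dot a x + t * dot a y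
  dot-linear a x t y = begin
    sum (λ i → fromℤ (a i) * (x i + t * y i))
      ≈⟨ sum-cong-≋ (λ i → solve 4 (λ a x t y → a :* (x :+ t :* y) := a :* x :+ t :* (a :* y)) refl (fromℤ (a i))
        (x i) t (y i)) ⟩
    sum (λ i → fromℤ (a i) * x i + t * (fromℤ (a i) * y i))
      ≈⟨ ∑-distrib-+ (λ i → fromℤ (a i) * x i) (λ i → t * (fromℤ (a i) * y i)) ⟩
    dot a x + sum (λ i → t * (fromℤ (a i) * y i))
      ≈⟨ +-congˡ (*-distribˡ-sum t (λ i → fromℤ (a i) * y i)) ⟨
    dot a x + t * dot a y ∎
    where open ≈-Reasoning

  dot-real : ∀ {n} (a d : Vector ℤ n) → dot a (real d) ≈ fromℤ (a ∙ d)
  dot-real {zero}  a d = refl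
  dot-real {suc n} a d = trans (+-cong (sym (fromℤ-* (head a) (head d))) (dot-real (tail a) (tail d)))
    (sym (fromℤ-+ (head a ℤ.* head d) (tail a ∙ tail d)))

  sum-scale-swap : ∀ {m n} (a : Vector ℤ n) (x : Vector Carrier m) (R : Fin m → Vector ℤ n) →
                   dot a (λ l → sum (λ i → x i * fromℤ (R i l))) ≈ sum (λ i → x i * fromℤ (a ∙ R i))
  sum-scale-swap a x R = begin
    sum (λ l → fromℤ (a l) * sum (λ i → x i * fromℤ (R i l)))
      ≈⟨ sum-cong-≋ (λ l → *-distribˡ-sum (fromℤ (a l)) (λ i → x i * fromℤ (R i l))) ⟩
    sum (λ l → sum (λ i → fromℤ (a l) * (x i * fromℤ (R i l))))
      ≈⟨ ∑-comm (λ l i → fromℤ (a l) * (x i * fromℤ (R i l))) ⟩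
    sum (λ i → sum (λ l → fromℤ (a l) * (x i * fromℤ (R i l))))
      ≈⟨ sum-cong-≋ (λ i → sum-cong-≋ λ l →
        solve 3 (λ a x r → a :* (x :* r) := x :* (a :* r)) refl (fromℤ (a l)) (x i) (fromℤ (R i l))) ⟩
    sum (λ i → sum (λ l → x i * (fromℤ (a l) * fromℤ (R i l))))
      ≈⟨ sum-cong-≋ (λ i → sym (*-distribˡ-sum (x i) (λ l → fromℤ (a l) * fromℤ (R i l)))) ⟩
    sum (λ i → x i * dot a (real (R i)))
      ≈⟨ sum-cong-≋ (λ i → *-congˡ (dot-real a (R i))) ⟩
    sum (λ i → x i * fromℤ (a ∙ R i)) ∎
    where open ≈-Reasoning

  sum-≈0 : ∀ {n} {v : Vector Carrier n} → (∀ i → v i ≈ 0#) → sum v ≈ 0#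
  sum-≈0 {n} v≈0 = trans (sum-cong-≋ v≈0) (sum-replicate-zero n)

  basis : ∀ {n} → Fin n → Vector ℤ n
  basis zero    zero    = 1ℤ
  basis zero    (suc j) = 0ℤ
  basis (suc i) zero    = 0ℤ
  basis (suc i) (suc j) = basis i j

  sum-basis : ∀ {n} (x : Vector Carrier n) l → sum (λ i → x i * fromℤ (basis i l)) ≈ x l
  sum-basis {suc n} x zero = trans
    (+-cong (trans (*-congˡ fromℤ-1) (*-identityʳ (x zero))) (sum-≈0 λ i → zeroʳ (x (suc i))))
    (+-identityʳ (x zero))
  sum-basis {suc n} x (suc l) = trans (+-cong (zeroʳ (x zero)) (sum-basis (tail x) l)) (+-identityˡ (x (suc l)))

  -- The projection for fewer equations is corrected by multiples of a Bézout
  -- combination v of its rows, on which the next equation takes the gcd of its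
  -- values.
  kernel-projection : ∀ {k n} (E : Fin k → Vector ℤ n) →
    ∃ λ (R : Fin n → Vector ℤ n) →
      (∀ j i → E j ∙ R i ≡ 0ℤ) ×
      (∀ x → (∀ j → dot (E j) x ≈ 0#) → ∀ l → sum (λ i → x i * fromℤ (R i l)) ≈ x l)
  kernel-projection {zero} E = basis , (λ ()) , λ x _ → sum-basis x
  kernel-projection {suc k} {n} E with kernel-projection (tail E)
  ... | R , ER≡0 , R-id with bézout-vector (λ i → head E ∙ R i)
  ...   | y , q , c≡ = split (g ℤₚ.≟ 0ℤ)
    where
    open ≈-Reasoning
    u = head E
    c : Vector ℤ n
    c i = u ∙ R i
    g = c ∙ y
    Goal : Set
    Goal = ∃ λ (R : Fin n → Vector ℤ n) →
      (∀ j i → E j ∙ R i ≡ 0ℤ) ×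
      (∀ x → (∀ j → dot (E j) x ≈ 0#) → ∀ l → sum (λ i → x i * fromℤ (R i l)) ≈ x l)

    v : Vector ℤ n
    v l = y ∙ (λ i → R i l)

    v≈ : ∀ l → fromℤ (v l) ≈ sum (λ i → real y i * fromℤ (R i l))
    v≈ l = sym (dot-real y (λ i → R i l))

    dot-v : ∀ a → fromℤ (a ∙ v) ≈ sum (λ i → real y i * fromℤ (a ∙ R i))
    dot-v a = trans (sym (dot-real a v)) (trans (dot-cong a v≈) (sum-scale-swap a (real y) R))

    R′ : Fin n → Vector ℤ n
    R′ i l = R i l ℤ.- q i ℤ.* v l

    R′≈ : ∀ i l → fromℤ (R′ i l) ≈ fromℤ (R i l) + (- fromℤ (q i)) * fromℤ (v l)
    R′≈ i l = trans (fromℤ-sub (R i l) (q i ℤ.* v l)) (trans (+-congˡ (-‿cong (fromℤ-* (q i) (v l))))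
      (solve 3 (λ r q v → r :- q :* v := r :+ (:- q) :* v) refl (fromℤ (R i l)) (fromℤ (q i)) (fromℤ (v l))))

    dot-R′ : ∀ a i → fromℤ (a ∙ R′ i) ≈ fromℤ (a ∙ R i) + (- fromℤ (q i)) * fromℤ (a ∙ v)
    dot-R′ a i = begin
      fromℤ (a ∙ R′ i)                                        ≈⟨ dot-real a (R′ i) ⟨
      dot a (real (R′ i))                                     ≈⟨ dot-cong a (R′≈ i) ⟩
      dot a (λ l → real (R i) l + (- fromℤ (q i)) * real v l)
        ≈⟨ dot-linear a (real (R i)) (- fromℤ (q i)) (real v) ⟩
      dot a (real (R i)) + (- fromℤ (q i)) * dot a (real v)
        ≈⟨ +-cong (dot-real a (R i)) (*-congˡ (dot-real a v)) ⟩
      fromℤ (a ∙ R i) + (- fromℤ (q i)) * fromℤ (a ∙ v)       ∎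

    u∙v : fromℤ (u ∙ v) ≈ fromℤ g
    u∙v = trans (dot-v u) (trans (sum-cong-≋ λ i → *-comm (real y i) (fromℤ (c i))) (dot-real c y))

    split : Dec (g ≡ 0ℤ) → Goal
    -- If the gcd g is 0, all values c i = q i g vanish and R already satisfies the new equation.
    split (yes g≡0) = R
      , (λ { zero i → ≡.trans (c≡ i) (≡.trans (≡.cong (q i ℤ.*_) g≡0) (ℤₚ.*-zeroʳ (q i))) ; (suc j) i →
          ER≡0 j i })
      , λ x Ex≈0 → R-id x (λ j → Ex≈0 (suc j))
    split (no g≢0) = R′ , (λ { zero → u∙R′ ; (suc j) → E∙R′ j }) , R′-id
      where
      u∙R′ : ∀ i → u ∙ R′ i ≡ 0ℤ
      u∙R′ i = fromℤ-injective (begin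
        fromℤ (u ∙ R′ i)                                  ≈⟨ dot-R′ u i ⟩
        fromℤ (c i) + (- fromℤ (q i)) * fromℤ (u ∙ v)
          ≈⟨ +-cong (trans (reflexive (≡.cong fromℤ (c≡ i))) (fromℤ-* (q i) g)) (*-congˡ u∙v) ⟩
        fromℤ (q i) * fromℤ g + (- fromℤ (q i)) * fromℤ g
          ≈⟨ solve 2 (λ q g → q :* g :+ (:- q) :* g := con 0ℤ) refl (fromℤ (q i)) (fromℤ g) ⟩
        0#                                                ∎)
      E∙R′ : ∀ j i → tail E j ∙ R′ i ≡ 0ℤ
      E∙R′ j i = fromℤ-injective (begin
        fromℤ (tail E j ∙ R′ i)                                             ≈⟨ dot-R′ (tail E j) i ⟩
        fromℤ (tail E j ∙ R i) + (- fromℤ (q i)) * fromℤ (tail E j ∙ v)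
          ≈⟨ +-cong (reflexive (≡.cong fromℤ (ER≡0 j i))) (*-congˡ Ev≈0) ⟩
        0# + (- fromℤ (q i)) * 0#
          ≈⟨ solve 1 (λ q → con 0ℤ :+ (:- q) :* con 0ℤ := con 0ℤ) refl (fromℤ (q i)) ⟩
        0#                                                                  ∎)
        where
        Ev≈0 = trans (dot-v (tail E j))
          (sum-≈0 λ i → trans (*-congˡ (reflexive (≡.cong fromℤ (ER≡0 j i)))) (zeroʳ (real y i)))
      R′-id : ∀ x → (∀ j → dot (E j) x ≈ 0#) → ∀ l → sum (λ i → x i * fromℤ (R′ i l)) ≈ x l
      R′-id x Ex≈0 l = begin
        sum (λ i → x i * fromℤ (R′ i l))
          ≈⟨ sum-cong-≋ (λ i → trans (*-congˡ (R′≈ i l))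
            (solve 4 (λ x r q v → x :* (r :+ (:- q) :* v) := x :* r :+ (:- v) :* (x :* q)) refl (x i)
            (fromℤ (R i l)) (fromℤ (q i)) (fromℤ (v l)))) ⟩
        sum (λ i → x i * fromℤ (R i l) + (- fromℤ (v l)) * (x i * fromℤ (q i)))
          ≈⟨ ∑-distrib-+ (λ i → x i * fromℤ (R i l)) (λ i → (- fromℤ (v l)) * (x i * fromℤ (q i))) ⟩
        sum (λ i → x i * fromℤ (R i l)) + sum (λ i → (- fromℤ (v l)) * (x i * fromℤ (q i)))
          ≈⟨ +-cong (R-id x (λ j → Ex≈0 (suc j)) l)
            (sym (*-distribˡ-sum (- fromℤ (v l)) (λ i → x i * fromℤ (q i)))) ⟩
        x l + (- fromℤ (v l)) * sum (λ i → x i * fromℤ (q i))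
          ≈⟨ +-congˡ (trans (*-congˡ xq≈0) (zeroʳ _)) ⟩
        x l + 0# ≈⟨ +-identityʳ (x l) ⟩
        x l ∎
        where
        -- The correction must vanish on solutions x: g times this sum is the new equation evaluated
        -- at x, and g is not 0.
        xq≈0 : sum (λ i → x i * fromℤ (q i)) ≈ 0#
        xq≈0 = *-≈0 (λ g≈0 → g≢0 (fromℤ-injective g≈0)) (begin
          fromℤ g * sum (λ i → x i * fromℤ (q i))       ≈⟨ *-distribˡ-sum (fromℤ g) (λ i → x i * fromℤ (q i)) ⟩
          sum (λ i → fromℤ g * (x i * fromℤ (q i)))
            ≈⟨ sum-cong-≋ (λ i → trans (solve 3 (λ g x q → g :* (x :* q) := x :* (q :* g)) refl (fromℤ g) (x i)
              (fromℤ (q i)))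
                 (*-congˡ (trans (sym (fromℤ-* (q i) g)) (reflexive (≡.cong fromℤ (≡.sym (c≡ i))))))) ⟩
          sum (λ i → x i * fromℤ (c i))                 ≈⟨ sum-scale-swap u x R ⟨
          dot u (λ l → sum (λ i → x i * fromℤ (R i l))) ≈⟨ dot-cong u (R-id x (λ j → Ex≈0 (suc j))) ⟩
          dot u x                                       ≈⟨ Ex≈0 zero ⟩
          0#                                            ∎)

-- Affine functionals over F and rays in integral directions

module Polyhedra (em : ExcludedMiddle 0ℓ) (ℝ : CompleteOrderedField) (F : Subfield ℝ) where

  open import Data.List.Base using ([]; _∷_; _++_)
  open import Data.List.Relation.Unary.All using ([]; _∷_)
  open OrderedField em ℝ
  open Subfield F
  open Polyhedral ℝ F

  fromℕ∈F : ∀ n → fromℤ (+ n) ∈ Member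
  fromℕ∈F zero    = 0-closed
  fromℕ∈F (suc n) = +-closed 1-closed (fromℕ∈F n)

  fromℤ∈F : ∀ z → fromℤ z ∈ Member
  fromℤ∈F (+ n)    = fromℕ∈F n
  fromℤ∈F -[1+ n ] = neg-closed (fromℕ∈F (suc n))

  sub-closed : ∀ {x y} → x ∈ Member → y ∈ Member → x - y ∈ Member
  sub-closed x∈F y∈F = +-closed x∈F (neg-closed y∈F)

  sum-closed : ∀ {n} {x : Vector Carrier n} → (∀ i → x i ∈ Member) → sum x ∈ Member
  sum-closed {zero}  x∈F = 0-closed
  sum-closed {suc n} x∈F = +-closed (x∈F zero) (sum-closed (λ i → x∈F (suc i)))

  ray : ∀ {n} → Point n → Carrier → Vector ℤ n → Point n
  ray x t d i = x i + t * fromℤ (d i)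

  ray∈F : ∀ {n} {x : Point n} {t} d → x ∈ F^ n → t ∈ Member → ray x t d ∈ F^ n
  ray∈F d x∈F t∈F i = +-closed (x∈F i) (*-closed t∈F (fromℤ∈F (d i)))

  module _ {n : ℕ} (l : IntegralAffine n) where

    eval-cong : ∀ {x y} → x ≋ y → eval l x ≈ eval l y
    eval-cong x≋y = +-congʳ (dot-cong (gradient l) x≋y)

    eval∈F : ∀ {x} → x ∈ F^ n → eval l x ∈ Member
    eval∈F x∈F = +-closed (sum-closed λ i → *-closed (fromℤ∈F (gradient l i)) (x∈F i)) (constant∈F l)

    eval-linear : ∀ x t y → eval l (λ i → x i + t * y i) ≈ eval l x + t * dot (gradient l) y
    eval-linear x t y = trans (+-congʳ (dot-linear (gradient l) x t y))
      (solve 3 (λ a b c → a :+ b :+ c := a :+ c :+ b) refl (dot (gradient l) x) (t * dot (gradient l) y)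
        (constant l))

    eval-ray : ∀ x t d → eval l (ray x t d) ≈ eval l x + t * fromℤ (gradient l ∙ d)
    eval-ray x t d = trans (eval-linear x t (real d)) (+-congˡ (*-congˡ (dot-real (gradient l) d)))

    eval-difference : ∀ x y → eval l x ≈ eval l y + dot (gradient l) (λ i → x i - y i)
    eval-difference x y = trans
      (eval-cong λ i → solve 2 (λ x y → x := y :+ con 1ℤ :* (x :- y)) refl (x i) (y i))
      (trans (eval-linear y 1# (λ i → x i - y i)) (+-congˡ (*-identityˡ _)))

  quotient : ∀ {x y} → x ∈ Member → y ∈ Member → 0# < x → 0# < y →
             ∃[ q ] (q ∈ Member × 0# < q × q * y ≈ x)
  quotient {x} {y} x∈F y∈F 0<x 0<y with pos-inverse 0<y
  ... | z , 0<z , yz≈1 = x * z , *-closed x∈F (inv-closed y∈F yz≈1) , *-pos 0<x 0<z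
    , trans (solve 3 (λ x y z → x :* z :* y := x :* (y :* z)) refl x y z) (trans (*-congˡ yz≈1) (*-identityʳ x))

  -- Up to the factor T′, the value at T is the combination of the values at 0 and T′ with weights
  -- T′ - T and T.
  exit-mono : ∀ {T T′ w r} → 0# < T → T ≤ T′ → 0# < w → 0# ≤ w + T′ * r → 0# ≤ w + T * r
  exit-mono {T} {T′} {w} {r} 0<T T≤T′ 0<w p = *-cancelˡ-≤ (<-≤-trans 0<T T≤T′)
    (≤-resp (sym (zeroʳ T′)) (solve 4 (λ T T′ w r → (T′ :- T) :* w :+ T :* (w :+ T′ :* r) := T′ :* (w :+ T :* r))
      refl T T′ w r)
      (+-nonNeg (*-nonNeg (0≤- T≤T′) (<⇒≤ 0<w)) (*-nonNeg (<⇒≤ 0<T) p)))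

  Exit : ∀ {m} (v s : Vector Carrier m) → Set
  Exit v s = ∃[ T ] (T ∈ Member × 0# < T × (∃[ i ] v i + T * s i ≈ 0#) × (∀ j → 0# ≤ v j + T * s j))

  -- The ratio test of the simplex method: each negative slope gives a candidate time v / (-s),
  -- which lies in F because F is a field, and the smallest candidate is kept.
  first-exit : ∀ {m} {v s : Vector Carrier m} → (∀ j → v j ∈ Member) → (∀ j → s j ∈ Member) → (∀ j → 0# < v j) →
    (∀ j → 0# ≤ s j) ⊎ Exit v s
  first-exit {zero} v∈F s∈F 0<v = inj₁ λ ()
  first-exit {suc m} {v} {s} v∈F s∈F 0<v =
    extend (first-exit (λ j → v∈F (suc j)) (λ j → s∈F (suc j)) (λ j → 0<v (suc j))) (≤⊎> 0# (s zero))
    where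
    module _ (s₀<0 : s zero < 0#) where
      q = quotient (v∈F zero) (neg-closed (s∈F zero)) (0<v zero) (<-resp refl (+-identityˡ _) (0<- s₀<0))
      T₀ = proj₁ q
      0<T₀ = proj₁ (proj₂ (proj₂ q))
      exit₀ : v zero + T₀ * s zero ≈ 0#
      exit₀ = trans (+-congʳ (sym (proj₂ (proj₂ (proj₂ q)))))
        (solve 2 (λ t s → t :* (:- s) :+ t :* s := con 0ℤ) refl T₀ (s zero))
      exit-at-T₀ : (∀ j → 0# ≤ v (suc j) + T₀ * s (suc j)) → Exit v s
      exit-at-T₀ inside = T₀ , proj₁ (proj₂ q) , 0<T₀ , (zero , exit₀) ,
        λ { zero → ≤-reflexive (sym exit₀) ; (suc j) → inside j }
      earlier : Exit (tail v) (tail s) → Exit v s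
      earlier (T , T∈F , 0<T , (i , exit) , inside) = choose (≤-total T T₀)
        where
        choose : T ≤ T₀ ⊎ T₀ ≤ T → Exit v s
        choose (inj₁ T≤T₀) = T , T∈F , 0<T , (suc i , exit) ,
          λ { zero → exit-mono 0<T T≤T₀ (0<v zero) (≤-reflexive (sym exit₀)) ; (suc j) → inside j }
        choose (inj₂ T₀≤T) = exit-at-T₀ λ j → exit-mono 0<T₀ T₀≤T (0<v (suc j)) (inside j)
    extend : (∀ j → 0# ≤ s (suc j)) ⊎ Exit (tail v) (tail s) → 0# ≤ s zero ⊎ s zero < 0# → (∀ j → 0# ≤ s j) ⊎
      Exit v s
    extend (inj₁ 0≤s) (inj₁ 0≤s₀) = inj₁ λ { zero → 0≤s₀ ; (suc j) → 0≤s j }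
    extend (inj₂ (T , T∈F , 0<T , (i , exit) , inside)) (inj₁ 0≤s₀) = inj₂ (T , T∈F , 0<T , (suc i , exit) ,
      λ { zero → +-nonNeg (<⇒≤ (0<v zero)) (*-nonNeg (<⇒≤ 0<T) 0≤s₀) ; (suc j) → inside j })
    extend (inj₁ 0≤s) (inj₂ s₀<0) = inj₂
      (exit-at-T₀ s₀<0 λ j → +-nonNeg (<⇒≤ (0<v (suc j))) (*-nonNeg (<⇒≤ (0<T₀ s₀<0)) (0≤s j)))
    extend (inj₂ e) (inj₂ s₀<0) = inj₂ (earlier s₀<0 e)

  -- Finite families containing a largest functional at every point of a face

  zip-All : ∀ {A : Set} {P R : Pred A 0ℓ} {xs} → All P xs → Any R xs → Any (λ x → P x × R x) xs
  zip-All (p ∷ ps) (here r)  = here (p , r)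
  zip-All (p ∷ ps) (there r) = there (zip-All ps r)

  -- The keys lie in a box of integer vectors, so finitely many occur. Q is an arbitrary predicate,
  -- so excluded middle decides which keys occur, and one element is kept for each. The box is
  -- sliced along its first coordinate.
  representatives : ∀ {n} {A : Set} (Q : Pred A 0ℓ) (key : A → Vector ℤ n) (lo hi : Vector ℤ n) →
    (∀ {a} → a ∈ Q → ∀ i → lo i ℤ.≤ key a i) → (∀ {a} → a ∈ Q → ∀ i → key a i ℤ.≤ hi i) →
    ∃ λ (as : List A) → All Q as × (∀ {a} → a ∈ Q → Any (λ b → key b ≗ key a) as)
  representatives {zero} {A} Q key lo hi lo≤ ≤hi with em {∃ Q}
  ... | yes (a , a∈Q) = a ∷ [] , a∈Q ∷ [] , λ _ → here λ ()
  ... | no  ∄         = [] , [] , λ {a} a∈Q → contradiction (a , a∈Q) ∄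
  representatives {suc n} {A} Q key lo hi lo≤ ≤hi =
    -- `within k` treats the half-open range from lo to lo + k; the successor includes the top value
    -- hi.
    let as , as⊆Q , covers = within (suc ℤ.∣ hi zero ℤ.- lo zero ∣)
    in as , as⊆Q , λ a∈Q → covers a∈Q (within-all a∈Q)
    where
    within-all : ∀ {a} → a ∈ Q → key a zero ℤ.< lo zero ℤ.+ + suc ℤ.∣ hi zero ℤ.- lo zero ∣
    within-all {a} a∈Q = ℤₚ.≤-<-trans (≤hi a∈Q zero) (≡.subst (ℤ._< lo zero ℤ.+ + suc ∣w∣) hi≡
        (ℤₚ.+-monoʳ-< (lo zero) (ℤ.+<+ (ℕₚ.n<1+n ∣w∣))))
      where
      ∣w∣ = ℤ.∣ hi zero ℤ.- lo zero ∣
      hi≡ : lo zero ℤ.+ + ∣w∣ ≡ hi zero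
      hi≡ = ≡.trans (≡.cong (λ w → lo zero ℤ.+ w)
        (ℤₚ.0≤i⇒+∣i∣≡i (ℤₚ.i≤j⇒0≤j-i (ℤₚ.≤-trans (lo≤ a∈Q zero) (≤hi a∈Q zero)))))
        (≡.trans (≡.sym (ℤₚ.+-assoc (lo zero) (hi zero) (ℤ.- lo zero)))
          (≡.trans (≡.cong (ℤ._- lo zero) (ℤₚ.+-comm (lo zero) (hi zero)))
            (≡.trans (ℤₚ.+-assoc (hi zero) (lo zero) (ℤ.- lo zero))
              (≡.trans (≡.cong (λ w → hi zero ℤ.+ w) (ℤₚ.+-inverseʳ (lo zero))) (ℤₚ.+-identityʳ (hi zero))))))
    within : ∀ k → ∃ λ (as : List A) → All Q as ×
      (∀ {a} → a ∈ Q → key a zero ℤ.< lo zero ℤ.+ + k → Any (λ b → key b ≗ key a) as)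
    within zero = [] , [] , λ {a} a∈Q lt →
      contradiction (ℤₚ.<-≤-trans lt
        (≡.subst (ℤ._≤ key a zero) (≡.sym (ℤₚ.+-identityʳ (lo zero))) (lo≤ a∈Q zero))) (ℤₚ.<-irrefl ≡.refl)
    within (suc k) =
      let bs , bs⊆ , b-covers = within k
          cs , cs⊆ , c-covers = representatives (λ a → a ∈ Q × key a zero ≡ lo zero ℤ.+ + k) (λ a → tail (key a))
            (tail lo) (tail hi) (λ (a∈Q , _) i → lo≤ a∈Q (suc i)) (λ (a∈Q , _) i → ≤hi a∈Q (suc i))
          both : ∀ {a} → a ∈ Q → key a zero ≡ lo zero ℤ.+ + k → Any (λ b → key b ≗ key a) cs
          both {a} a∈Q a≡ = Any.map (λ { ((_ , b≡) , tails) →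
            λ { zero → ≡.trans b≡ (≡.sym a≡) ; (suc i) → tails i } })
            (zip-All cs⊆ (c-covers (a∈Q , a≡)))
          cover : ∀ {a} → a ∈ Q → key a zero ℤ.< lo zero ℤ.+ + suc k → Any (λ b → key b ≗ key a) (bs ++ cs)
          cover {a} a∈Q lt = split bs cs (b-covers a∈Q) (both a∈Q) (key a zero ℤₚ.<? lo zero ℤ.+ + k) lt
      in bs ++ cs , Allₚ.++⁺ bs⊆ (All.map proj₁ cs⊆) , cover
      where
      split : ∀ {a} (bs cs : List A) → (key a zero ℤ.< lo zero ℤ.+ + k → Any (λ b → key b ≗ key a) bs) →
              (key a zero ≡ lo zero ℤ.+ + k → Any (λ b → key b ≗ key a) cs) →
              Dec (key a zero ℤ.< lo zero ℤ.+ + k) → key a zero ℤ.< lo zero ℤ.+ + suc k →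
                Any (λ b → key b ≗ key a) (bs ++ cs)
      split bs cs below top (yes lt) _  = Anyₚ.++⁺ˡ (below lt)
      split {a} bs cs below top (no ≮) lt = Anyₚ.++⁺ʳ bs (top (ℤₚ.≤-antisym
        (i<suc[j]⇒i≤j (≡.subst (key a zero ℤ.<_) suc-out lt)) (ℤₚ.≮⇒≥ ≮)))
        where
        suc-out : lo zero ℤ.+ + suc k ≡ ℤ.suc (lo zero ℤ.+ + k)
        suc-out = ≡.trans (≡.sym (ℤₚ.+-assoc (lo zero) 1ℤ (+ k)))
          (≡.trans (≡.cong (ℤ._+ + k) (ℤₚ.+-comm (lo zero) 1ℤ)) (ℤₚ.+-assoc 1ℤ (lo zero) (+ k)))

  ≤-upper-bound : {A : Set} (f : A → ℤ) (xs : List A) → ∃[ C ] All (λ x → f x ℤ.≤ C) xs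
  ≤-upper-bound f [] = 0ℤ , []
  ≤-upper-bound f (x ∷ xs) = let C , bounds = ≤-upper-bound f xs in
    f x ℤ.⊔ C , ℤₚ.i≤i⊔j (f x) C ∷ All.map (λ le → ℤₚ.≤-trans le (ℤₚ.i≤j⊔i (f x) C)) bounds

  module _ {n : ℕ} where

    Face : ∀ {k m} → Vector (IntegralAffine n) k → Vector (IntegralAffine n) m → Pred (Point n) 0ℓ
    Face E J w = (∀ j → eval (E j) w ≈ 0#) × (∀ j → 0# ≤ eval (J j) w)

    gradients : ∀ {k} → Vector (IntegralAffine n) k → Fin k → Vector ℤ n
    gradients E j = gradient (E j)

  module TopSelection {n : ℕ} (𝓜 : Pred (IntegralAffine n) 0ℓ) where

    Top : Point n → Pred (IntegralAffine n) 0ℓ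
    Top w l = l ∈ 𝓜 × (∀ {μ} → μ ∈ 𝓜 → eval μ w ≤ eval l w)

    Covers : List (IntegralAffine n) → Pred (Point n) 0ℓ → Set
    Covers B P = All 𝓜 B × (∀ {w} → w ∈ F^ n → w ∈ P → Any (Top w) B)

    BoundedAlong : Vector ℤ n → Set
    BoundedAlong d = ∃[ C ] ∀ {l} → l ∈ 𝓜 → gradient l ∙ d ℤ.≤ C

    -- Add the inequality b ≤ l at w to the inequality l ≤ b at w + t d: the values at w cancel and
    -- t times the difference of the slopes remains.
    top-monotone : ∀ {w t d l b} → 0# < t → Top w l → Top (ray w t d) b → gradient l ∙ d ℤ.≤ gradient b ∙ d
    top-monotone {w} {t} {d} {l} {b} 0<t (l∈ , l-top) (b∈ , b-top) = fromℤ-cancel-≤ (*-cancelˡ-≤ 0<t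
      (≤-by _ (+-nonNeg (0≤- (l-top b∈)) (0≤- (≤-resp (eval-ray l w t d) (eval-ray b w t d) (b-top l∈))))
        (solve 4 (λ x y p q → (x :- y) :+ ((y :+ q) :- (x :+ p)) := q :- p) refl
          (eval l w) (eval b w) (t * fromℤ (gradient l ∙ d)) (t * fromℤ (gradient b ∙ d)))))

    module Step {k m} (E : Vector (IntegralAffine n) k) (J : Vector (IntegralAffine n) m)
      (top : ∀ {w} → w ∈ F^ n → w ∈ Face E J → ∃ (Top w))
      (recession : ∀ d → (∀ j → gradients E j ∙ d ≡ 0ℤ) → (∀ j → 0ℤ ℤ.≤ gradients J j ∙ d) → BoundedAlong d)
      (B∂ : List (IntegralAffine n)) (B∂⊆𝓜 : All 𝓜 B∂)
      (B∂-top : ∀ i {w} → w ∈ F^ n → w ∈ Face E J → eval (J i) w ≈ 0# → Any (Top w) B∂) where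

      Inner : Pred (Point n) 0ℓ
      Inner w = w ∈ F^ n × w ∈ Face E J × (∀ j → 0# < eval (J j) w)

      TopInside : Pred (IntegralAffine n) 0ℓ
      TopInside l = ∃[ w ] (w ∈ Inner × Top w l)

      eval-E-ray : ∀ {w t d} → (∀ j → gradients E j ∙ d ≡ 0ℤ) → (∀ j → eval (E j) w ≈ 0#) → ∀ j →
        eval (E j) (ray w t d) ≈ 0#
      eval-E-ray {w} {t} {d} Ed≡0 Ew≈0 j = trans (eval-ray (E j) w t d)
        (trans (+-cong (Ew≈0 j) (*-congˡ (reflexive (≡.cong fromℤ (Ed≡0 j)))))
          (solve 1 (λ t → con 0ℤ :+ t :* con 0ℤ := con 0ℤ) refl t))

      -- The exit point depends on w, but the functional largest there is always found in the one
      -- finite list `B∂`, so the largest slope in that list bounds all l at once.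
      bounded : ∀ d → (∀ j → gradients E j ∙ d ≡ 0ℤ) → ∃[ C ] ∀ {l} → l ∈ TopInside → gradient l ∙ d ℤ.≤ C
      bounded d Ed≡0 = choose (em {∀ j → 0ℤ ℤ.≤ gradients J j ∙ d})
        where
        C = proj₁ (≤-upper-bound (λ b → gradient b ∙ d) B∂)
        choose : Dec (∀ j → 0ℤ ℤ.≤ gradients J j ∙ d) → ∃[ C ] ∀ {l} → l ∈ TopInside → gradient l ∙ d ℤ.≤ C
        choose (yes Jd≥0) = let C , bound = recession d Ed≡0 Jd≥0 in C , λ (_ , _ , l∈ , _) → bound l∈
        choose (no ¬Jd≥0) = C , λ (w , (w∈F , (Ew≈0 , _) , 0<Jw) , l-top) → exits w∈F Ew≈0 l-top
            (first-exit (λ j → eval∈F (J j) w∈F) (λ j → fromℤ∈F (gradients J j ∙ d)) 0<Jw)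
          where
          exits : ∀ {w l} → w ∈ F^ n → (∀ j → eval (E j) w ≈ 0#) → Top w l →
                  (∀ j → 0# ≤ fromℤ (gradients J j ∙ d)) ⊎
                    Exit (λ j → eval (J j) w) (λ j → fromℤ (gradients J j ∙ d)) →
                  gradient l ∙ d ℤ.≤ C
          exits _ _ _ (inj₁ nonNeg) = contradiction (λ j → fromℤ-cancel-≤ (nonNeg j)) ¬Jd≥0
          exits {w} {l} w∈F Ew≈0 l-top (inj₂ (t , t∈F , 0<t , (i , exit) , inside)) =
            All.lookupWith (λ { le b-top → ℤₚ.≤-trans (top-monotone 0<t l-top b-top) le })
              (proj₂ (≤-upper-bound (λ b → gradient b ∙ d) B∂))
              (B∂-top i (ray∈F d w∈F t∈F)
                (eval-E-ray Ed≡0 Ew≈0 , λ j → ≤-resp refl (sym (eval-ray (J j) w t d)) (inside j))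
                (trans (eval-ray (J i) w t d) exit))

      projection = kernel-projection (gradients E)
      R = proj₁ projection

      key : IntegralAffine n → Vector ℤ n
      key l i = gradient l ∙ R i

      -R : Fin n → Vector ℤ n
      -R i j = ℤ.- 1ℤ ℤ.* R i j

      ∙-negR : ∀ a i → a ∙ -R i ≡ ℤ.- (a ∙ R i)
      ∙-negR a i = ≡.trans (∙-scaleʳ a (ℤ.- 1ℤ) (R i)) (ℤₚ.-1*i≡-i (a ∙ R i))

      upper : ∀ i → ∃[ C ] ∀ {l} → l ∈ TopInside → gradient l ∙ R i ℤ.≤ C
      upper i = bounded (R i) (λ j → proj₁ (proj₂ projection) j i)

      lower : ∀ i → ∃[ C ] ∀ {l} → l ∈ TopInside → gradient l ∙ -R i ℤ.≤ C
      lower i = bounded (-R i) λ j →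
        ≡.trans (∙-negR (gradients E j) i) (≡.cong ℤ.-_ (proj₁ (proj₂ projection) j i))

      reps = representatives TopInside key (λ i → ℤ.- proj₁ (lower i)) (λ i → proj₁ (upper i))
        (λ {l} l∈ i → ≡.subst (ℤ._≤_ (ℤ.- proj₁ (lower i))) (ℤₚ.neg-involutive (gradient l ∙ R i))
          (ℤₚ.neg-mono-≤ (≡.subst (ℤ._≤ proj₁ (lower i)) (∙-negR (gradient l) i) (proj₂ (lower i) l∈))))
        (λ l∈ i → proj₂ (upper i) l∈)

      -- The difference w - w′ lies in the kernel of E, hence is a combination of the vectors `R i`,
      -- on which b and l have equal slopes. So b - l has the same value at w as at w′, where it is
      -- nonnegative because b is largest there. Constant terms need not be compared.
      transfer : ∀ {w l b} → w ∈ Face E J → Top w l → b ∈ TopInside → key b ≗ key l → Top w b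
      transfer {w} {l} {b} (Ew≈0 , _) (l∈ , l-top) (w′ , (_ , (Ew′≈0 , _) , _) , b∈ , b-top) keys≡ =
        b∈ , λ μ∈ → ≤-trans (l-top μ∈) (≤-resp (sym (eval-difference l w w′))
          (trans (+-congˡ (sym same-slope)) (sym (eval-difference b w w′)))
          (+-mono-≤ (b-top l∈) ≤-refl))
        where
        z = λ i → w i - w′ i
        Ez≈0 : ∀ j → dot (gradients E j) z ≈ 0#
        Ez≈0 j = trans (solve 2 (λ a d → d := (a :+ d) :- a) refl (eval (E j) w′) (dot (gradients E j) z))
          (trans (+-cong (trans (sym (eval-difference (E j) w w′)) (Ew≈0 j)) (-‿cong (Ew′≈0 j))) (-‿inverseʳ 0#))
        along-R : ∀ a → dot a z ≈ sum (λ i → z i * fromℤ (a ∙ R i))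
        along-R a = trans (dot-cong a (λ l → sym (proj₂ (proj₂ projection) z Ez≈0 l))) (sum-scale-swap a z R)
        same-slope : dot (gradient b) z ≈ dot (gradient l) z
        same-slope = trans (along-R (gradient b)) (trans
          (sum-cong-≋ λ i → *-congˡ (reflexive (≡.cong fromℤ (keys≡ i)))) (sym (along-R (gradient l))))

      covering : ∃[ B ] Covers B (Face E J)
      covering = proj₁ reps ++ B∂
        , Allₚ.++⁺ (All.map (λ (_ , _ , l∈ , _) → l∈) (proj₁ (proj₂ reps))) B∂⊆𝓜
        , λ {w} w∈F w∈Face → cover w∈F w∈Face (em {∃[ i ] eval (J i) w ≈ 0#})
        where
        cover : ∀ {w} → w ∈ F^ n → w ∈ Face E J → Dec (∃[ i ] eval (J i) w ≈ 0#) → Any (Top w) (proj₁ reps ++ B∂)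
        cover w∈F w∈Face (yes (i , Jw≈0)) = Anyₚ.++⁺ʳ (proj₁ reps) (B∂-top i w∈F w∈Face Jw≈0)
        cover {w} w∈F w∈Face (no ¬∂) = Anyₚ.++⁺ˡ (Any.map (λ (b∈ , keys≡) → transfer w∈Face l-top b∈ keys≡)
            (zip-All (proj₁ (proj₂ reps)) (proj₂ (proj₂ reps) (w , (w∈F , w∈Face , 0<Jw) , l-top))))
          where
          l-top = proj₂ (top w∈F w∈Face)
          0<Jw = λ j → proj₂ w∈Face j , λ 0≈ → ¬∂ (j , sym 0≈)

    -- A facet is the face in which one inequality of J has moved to the equations E, so m
    -- decreases. Faces may be empty, since every claim is about given points. Without inequalities
    -- there is no boundary, and the recession hypothesis bounds the slopes in all directions of the
    -- face.
    finite-cover : ∀ {m k} (E : Vector (IntegralAffine n) k) (J : Vector (IntegralAffine n) m) →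
      (∀ {w} → w ∈ F^ n → w ∈ Face E J → ∃ (Top w)) →
      (∀ d → (∀ j → gradients E j ∙ d ≡ 0ℤ) → (∀ j → 0ℤ ℤ.≤ gradients J j ∙ d) → BoundedAlong d) →
      ∃[ B ] Covers B (Face E J)
    finite-cover {zero}  E J top recession = Step.covering E J top recession [] [] λ ()
    finite-cover {suc m} {k} E J top recession = Step.covering E J top recession
        (List.concat (List.tabulate B)) (Allₚ.concat⁺ (Allₚ.tabulate⁺ {f = B} (λ i → proj₁ (proj₂ (facet i)))))
        λ i w∈F w∈Face Jw≈0 → Anyₚ.concat⁺
          (Anyₚ.tabulate⁺ {f = B} i (proj₂ (proj₂ (facet i)) w∈F (on-facet i w∈Face Jw≈0)))
      where
      E∂ : Fin (suc m) → Vector (IntegralAffine n) (suc k)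
      E∂ i = J i Vector.∷ E
      on-facet : ∀ i {w} → w ∈ Face E J → eval (J i) w ≈ 0# → w ∈ Face (E∂ i) (removeAt J i)
      on-facet i (Ew≈0 , 0≤Jw) Jw≈0 = (λ { zero → Jw≈0 ; (suc j) → Ew≈0 j }) , λ j → 0≤Jw (punchIn i j)
      from-facet : ∀ {P : Pred (IntegralAffine n) 0ℓ} i → P (J i) → (∀ j → P (removeAt J i j)) → ∀ j → P (J j)
      from-facet {P} i p ps j with i Finₚ.≟ j
      ... | yes ≡.refl = p
      ... | no  i≢j    = ≡.subst (λ j → P (J j)) (Finₚ.punchIn-punchOut i≢j) (ps (punchOut i≢j))
      facet : ∀ i → ∃[ B ] Covers B (Face (E∂ i) (removeAt J i))
      facet i = finite-cover (E∂ i) (removeAt J i)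
        (λ w∈F (E∂w≈0 , 0≤Jw) → top w∈F
          ((λ j → E∂w≈0 (suc j)) , from-facet {λ l → 0# ≤ eval l _} i (≤-reflexive (sym (E∂w≈0 zero))) 0≤Jw))
        (λ d E∂d≡0 Jd≥0 → recession d (λ j → E∂d≡0 (suc j))
          (from-facet {λ l → 0ℤ ℤ.≤ gradient l ∙ d} i (ℤₚ.≤-reflexive (≡.sym (E∂d≡0 zero))) Jd≥0))
      B : Fin (suc m) → List (IntegralAffine n)
      B i = proj₁ (facet i)

  -- Properties of all small positive parameters

  -- The filter of right neighbourhoods of 0 in ℝ. Properties that make sense only for parameters in
  -- F carry `t ∈ Member` as a premise of their own.
  Small : Pred Carrier 0ℓ → Set
  Small P = ∃[ ε ] (0# < ε × ∀ {δ} → 0# < δ → δ ≤ ε → P δ)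

  small-map : ∀ {P Q : Pred Carrier 0ℓ} → (∀ {δ} → 0# < δ → P δ → Q δ) → Small P → Small Q
  small-map P⇒Q (ε , 0<ε , p) = ε , 0<ε , λ 0<δ δ≤ε → P⇒Q 0<δ (p 0<δ δ≤ε)

  small-× : ∀ {P Q : Pred Carrier 0ℓ} → Small P → Small Q → Small (λ δ → P δ × Q δ)
  small-× {P} {Q} (ε , 0<ε , p) (ε′ , 0<ε′ , q) = choose (≤-total ε ε′)
    where
    choose : ε ≤ ε′ ⊎ ε′ ≤ ε → Small (λ δ → P δ × Q δ)
    choose (inj₁ le) = ε  , 0<ε  , λ 0<δ δ≤ε → p 0<δ δ≤ε , q 0<δ (≤-trans δ≤ε le)
    choose (inj₂ ge) = ε′ , 0<ε′ , λ 0<δ δ≤ε → p 0<δ (≤-trans δ≤ε ge) , q 0<δ δ≤ε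

  small-all : ∀ {P : Pred Carrier 0ℓ} → (∀ {δ} → 0# < δ → P δ) → Small P
  small-all p = 1# , 0<1 , λ 0<δ _ → p 0<δ

  small-∀ : ∀ {m} {P : Fin m → Pred Carrier 0ℓ} → (∀ j → Small (P j)) → Small (λ δ → ∀ j → P j δ)
  small-∀ {zero}  ps = small-all λ _ ()
  small-∀ {suc m} ps = small-map (λ { _ (p , q) → λ { zero → p ; (suc j) → q j } })
    (small-× (ps zero) (small-∀ (λ j → ps (suc j))))

  small-≤ : ∀ {b} → 0# < b → Small (_≤ b)
  small-≤ {b} 0<b = b , 0<b , λ _ δ≤b → δ≤b

  small-multiple : ∀ K {b} → 0# < b → Small (λ δ → ∀ {s} → 0# ≤ s → s ≤ δ → s * K ≤ b)
  small-multiple K {b} 0<b = choose (≤⊎> K 0#)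
    where
    choose : K ≤ 0# ⊎ 0# < K → Small (λ δ → ∀ {s} → 0# ≤ s → s ≤ δ → s * K ≤ b)
    choose (inj₁ K≤0) = small-all λ _ {s} 0≤s _ → ≤-trans (≤-resp refl (zeroʳ s) (*-monoˡ-≤ 0≤s K≤0)) (<⇒≤ 0<b)
    choose (inj₂ 0<K) = let z , 0<z , Kz≈1 = pos-inverse 0<K in
      b * z , *-pos 0<b 0<z , λ {δ} _ δ≤ {s} 0≤s s≤δ →
        ≤-trans (≤-resp (*-comm K s) refl (*-monoˡ-≤ (<⇒≤ 0<K) (≤-trans s≤δ δ≤)))
          (≤-reflexive (trans (solve 3 (λ K b z → K :* (b :* z) := b :* (K :* z)) refl K b z)
            (trans (*-congˡ Kz≈1) (*-identityʳ b))))

  small-scale : ∀ {P : Pred Carrier 0ℓ} {c} → 0# < c → Small P → Small (λ δ → P (c * δ))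
  small-scale {P} {c} 0<c (ε , 0<ε , p) = let z , 0<z , cz≈1 = pos-inverse 0<c in
    z * ε , *-pos 0<z 0<ε , λ {δ} 0<δ δ≤ → p (*-pos 0<c 0<δ)
      (≤-trans (*-monoˡ-≤ (<⇒≤ 0<c) δ≤)
        (≤-reflexive (trans (sym (*-assoc c z ε)) (trans (*-congʳ cz≈1) (*-identityˡ ε)))))

  reciprocal : ∀ N → ∃[ r ] (r ∈ Member × 0# < r × fromℤ (+ suc N) * r ≈ 1#)
  reciprocal N = let r , 0<r , Nr≈1 = pos-inverse (0<fromℕ N) in
    r , inv-closed (fromℕ∈F (suc N)) Nr≈1 , 0<r , Nr≈1

  -- The bound ε need not lie in F, but every subfield contains the reciprocals of the positive
  -- integers, and these become arbitrarily small.
  small-reciprocal : ∀ {P : Pred Carrier 0ℓ} → Small P →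
    ∃[ N ] ∃[ r ] (r ∈ Member × 0# < r × fromℤ (+ suc N) * r ≈ 1# × P r)
  small-reciprocal {P} (ε , 0<ε , p) =
    N , r , r∈F , 0<r , Nr≈1 , p 0<r (*-cancelˡ-≤ 0<z zr≤)
    where
    inv = pos-inverse 0<ε
    z = proj₁ inv
    0<z = proj₁ (proj₂ inv)
    N = proj₁ (archimedean z)
    rec = reciprocal N
    r = proj₁ rec
    r∈F = proj₁ (proj₂ rec)
    0<r = proj₁ (proj₂ (proj₂ rec))
    Nr≈1 = proj₂ (proj₂ (proj₂ rec))
    zr≤ : z * r ≤ z * ε
    zr≤ = ≤-trans (≤-resp (*-comm r z) (*-comm r (fromℤ (+ suc N))) (*-monoˡ-≤ (<⇒≤ 0<r)
        (≤-trans (proj₂ (archimedean z)) (fromℤ-mono (ℤₚ.i≤suc[i] (+ N))))))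
      (≤-reflexive (trans Nr≈1 (sym (trans (*-comm z ε) (proj₂ (proj₂ inv))))))

  small-witness : ∀ {P : Pred Carrier 0ℓ} → Small P → ∃[ r ] (r ∈ Member × 0# < r × P r)
  small-witness s = let _ , r , r∈F , 0<r , _ , p = small-reciprocal s in r , r∈F , 0<r , p

  ≤-limit : ∀ {a b c e} → Small (λ t → t ∈ Member → a + t * b ≤ c + t * e) → a ≤ c
  ≤-limit {a} {b} {c} {e} s = ≮⇒≥ λ c<a → impossible c<a (small-witness (small-× s (half-small c<a)))
    where
    -- The summand `1#` leaves a margin: added to the hypothesis at t, the estimate yields t ≤ 0.
    half-small : c < a → Small (λ t → t * (1# + (e - b)) ≤ a - c)
    half-small c<a = small-map (λ 0<δ q → q (<⇒≤ 0<δ) ≤-refl) (small-multiple (1# + (e - b)) (0<- c<a))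
    impossible : c < a → ¬ (∃[ t ] (t ∈ Member × 0# < t
      × ((t ∈ Member → a + t * b ≤ c + t * e) × t * (1# + (e - b)) ≤ a - c)))
    impossible c<a (t , t∈F , 0<t , p , q) = <⇒≱ 0<t (≤-by _ (+-nonNeg (0≤- (p t∈F)) (0≤- q))
      (solve 5 (λ a b c e t → ((c :+ t :* e) :- (a :+ t :* b)) :+ ((a :- c) :- t :* (con 1ℤ :+ (e :- b))) := con
        0ℤ :- t) refl a b c e t))

  halve : ∀ {ε} → 0# < ε → ∃[ η ] (0# < η × η + η ≈ ε)
  halve {ε} 0<ε = let z , 0<z , 2z≈1 = pos-inverse (+-pos-nonNeg 0<1 0≤1) in
    z * ε , *-pos 0<z 0<ε , trans (solve 2 (λ z ε → z :* ε :+ z :* ε := (con 1ℤ :+ con 1ℤ) :* z :* ε) refl z ε)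
      (trans (*-congʳ 2z≈1) (*-identityˡ ε))

  -- Relative interiors of polyhedra

  strict-bound : ∀ {n} (v : Vector Carrier n) → ∃[ M ] (0# < M × ∀ i → (- M < v i) × (v i < M))
  strict-bound {zero}  v = 1# , 0<1 , λ ()
  strict-bound {suc n} v = step (strict-bound (tail v)) (≤-total 0# (v zero))
    where
    step : ∃[ M ] (0# < M × ∀ i → (- M < tail v i) × (tail v i < M)) → 0# ≤ v zero ⊎ v zero ≤ 0# →
           ∃[ M ] (0# < M × ∀ i → (- M < v i) × (v i < M))
    step (M , 0<M , bounds) (inj₁ 0≤x) = M + x , +-pos-nonNeg 0<M 0≤x , λ
        { zero → <-by _ (+-pos-nonNeg 0<M (+-nonNeg 0≤x 0≤x))
            (solve 2 (λ M x → M :+ (x :+ x) := x :- :- (M :+ x)) refl M x)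
               , <-by M 0<M (solve 2 (λ M x → M := M :+ x :- x) refl M x)
        ; (suc i) → <-by _ (+-pos-nonNeg (0<- (proj₁ (bounds i))) 0≤x)
            (solve 3 (λ M x y → (y :- :- M) :+ x := y :- :- (M :+ x)) refl M x (v (suc i)))
                  , <-by _ (+-pos-nonNeg (0<- (proj₂ (bounds i))) 0≤x)
                      (solve 3 (λ M x y → (M :- y) :+ x := M :+ x :- y) refl M x (v (suc i))) }
      where x = v zero
    step (M , 0<M , bounds) (inj₂ x≤0) = M - x , <-resp refl (+-congˡ (+-identityˡ (- x))) (+-pos-nonNeg 0<M 0≤-x)
      , λ
        { zero → <-by M 0<M (solve 2 (λ M x → M := x :- :- (M :- x)) refl M x)
               , <-by _ (+-pos-nonNeg 0<M (+-nonNeg 0≤-x 0≤-x))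
                   (solve 2 (λ M x → M :+ ((con 0ℤ :- x) :+ (con 0ℤ :- x)) := M :- x :- x) refl M x)
        ; (suc i) → <-by _ (+-pos-nonNeg (0<- (proj₁ (bounds i))) 0≤-x)
            (solve 3 (λ M x y → (y :- :- M) :+ (con 0ℤ :- x) := y :- :- (M :- x)) refl M x (v (suc i)))
                  , <-by _ (+-pos-nonNeg (0<- (proj₂ (bounds i))) 0≤-x)
                      (solve 3 (λ M x y → (M :- y) :+ (con 0ℤ :- x) := M :- x :- y) refl M x (v (suc i))) }
      where
      x = v zero
      0≤-x = 0≤- x≤0

  -- A is the sum of the absolute values of the coefficients of a, so one A serves cubes of every
  -- size.
  dot-lower-bound : ∀ {n} (a : Vector ℤ n) →
    ∃[ A ] (∀ {ε} {v : Vector Carrier n} → (∀ i → (- ε < v i) × (v i < ε)) → - (ε * A) ≤ dot a v)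
  dot-lower-bound {zero}  a = 0# , λ {ε} _ → ≤-reflexive (solve 1 (λ ε → :- (ε :* con 0ℤ) := con 0ℤ) refl ε)
  dot-lower-bound {suc n} a = step (dot-lower-bound (tail a)) (≤-total 0# α)
    where
    α = fromℤ (head a)
    step : ∃[ A ] (∀ {ε} {v : Vector Carrier n} → (∀ i → (- ε < v i) × (v i < ε)) → - (ε * A) ≤ dot (tail a) v) →
      0# ≤ α ⊎ α ≤ 0# →
           ∃[ A ] (∀ {ε} {v : Vector Carrier (suc n)} → (∀ i → (- ε < v i) × (v i < ε)) → - (ε * A) ≤ dot a v)
    step (A , bound) (inj₁ 0≤α) = α + A , λ {ε} {v} v<ε → ≤-by _
      (+-nonNeg (*-nonNeg 0≤α (0≤- (<⇒≤ (proj₁ (v<ε zero))))) (0≤- (bound (λ i → v<ε (suc i)))))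
      (solve 5 (λ α x ε A d → α :* (x :- :- ε) :+ (d :- :- (ε :* A)) := (α :* x :+ d) :- :- (ε :* (α :+ A))) refl
        α (v zero) ε A (dot (tail a) (tail v)))
    step (A , bound) (inj₂ α≤0) = A - α , λ {ε} {v} v<ε → ≤-by _
      (+-nonNeg (*-nonNeg (0≤- α≤0) (0≤- (<⇒≤ (proj₂ (v<ε zero))))) (0≤- (bound (λ i → v<ε (suc i)))))
      (solve 5 (λ α x ε A d → (con 0ℤ :- α) :* (ε :- x) :+ (d :- :- (ε :* A)) := (α :* x :+ d) :- :-
        (ε :* (A :- α))) refl α (v zero) ε A (dot (tail a) (tail v)))

  eval-combination : ∀ {n k} (l : IntegralAffine n) (c : Vector Carrier k) (p : Fin k → Point n) → sum c ≈ 1# →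
    eval l (λ i → sum (λ j → c j * p j i)) ≈ sum (λ j → c j * eval l (p j))
  eval-combination l c p Σc≈1 = begin
    dot a (λ i → sum (λ j → c j * p j i)) + b
      ≈⟨ +-congʳ (sum-cong-≋ λ i → *-distribˡ-sum (fromℤ (a i)) (λ j → c j * p j i)) ⟩
    sum (λ i → sum (λ j → fromℤ (a i) * (c j * p j i))) + b
      ≈⟨ +-congʳ (∑-comm (λ i j → fromℤ (a i) * (c j * p j i))) ⟩
    sum (λ j → sum (λ i → fromℤ (a i) * (c j * p j i))) + b
      ≈⟨ +-cong (sum-cong-≋ λ j → trans
        (sum-cong-≋ λ i → solve 3 (λ a c p → a :* (c :* p) := c :* (a :* p)) refl (fromℤ (a i)) (c j) (p j i))
           (sym (*-distribˡ-sum (c j) (λ i → fromℤ (a i) * p j i))))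
           (trans (sym (*-identityˡ b)) (trans (*-congʳ (sym Σc≈1)) (*-distribʳ-sum b c))) ⟩
    sum (λ j → c j * dot a (p j)) + sum (λ j → c j * b)
      ≈⟨ ∑-distrib-+ (λ j → c j * dot a (p j)) (λ j → c j * b) ⟨
    sum (λ j → c j * dot a (p j) + c j * b)
      ≈⟨ sum-cong-≋ (λ j → distribˡ (c j) (dot a (p j)) b) ⟨
    sum (λ j → c j * eval l (p j)) ∎
    where
    open ≈-Reasoning
    a = gradient l
    b = constant l

  SameSign : Carrier → Carrier → Set
  SameSign a b = (0# < a × 0# < b) ⊎ (a ≈ 0# × b ≈ 0#)

  module _ {n m : ℕ} (J : Vector (IntegralAffine n) m) (p₀ : Point n) where

    -- The points with the same active constraints as p₀. For p₀ in the relative interior of S this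
    -- is `int S`, now described by signs alone and without affine hulls.
    OpenFace : Pred (Point n) 0ℓ
    OpenFace x = ∀ j → SameSign (eval (J j) p₀) (eval (J j) x)

    ClosedFace : Pred (Point n) 0ℓ
    ClosedFace x = ∀ j → 0# ≤ eval (J j) x × (eval (J j) p₀ ≈ 0# → eval (J j) x ≈ 0#)

  module RelativeInterior {n m : ℕ} {S : Pred (Point n) 0ℓ} (J : Vector (IntegralAffine n) m)
    (S⇒ : ∀ {x} → x ∈ S → ∀ j → 0# ≤ eval (J j) x) (S⇐ : ∀ {x} → (∀ j → 0# ≤ eval (J j) x) → x ∈ S)
    {p₀ : Point n} (p₀∈int : p₀ ∈ int S) where

    private
      D = OpenFace J p₀

    -- The new point has affine coefficients -η at z and 1 + η times those of y, so it stays in the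
    -- affine hull. With M a strict bound for the coordinates of y - z, the choice η = ε / M keeps
    -- it in the cube around y.
    beyond : ∀ {y z} → y ∈ int S → z ∈ S → ∃[ η ] (0# < η × (λ i → y i + η * (y i - z i)) ∈ S)
    beyond {y} {z} ((k , c , p , p∈S , Σc≈1 , y≋) , ε , 0<ε , cube⊆S) = λ z∈S →
      η , 0<η , cube⊆S (in-cube , suc k , - η Vector.∷ (λ j → (1# + η) * c j) , z Vector.∷ p
        , (λ { zero → z∈S ; (suc j) → p∈S j }) , Σ≈1
        , λ i → trans (solve 3 (λ y η z → y :+ η :* (y :- z) := (:- η) :* z :+ (con 1ℤ :+ η) :* y) refl (y i) η
            (z i))
            (+-congˡ (trans (*-congˡ (y≋ i))
              (trans (*-distribˡ-sum (1# + η) (λ j → c j * p j i))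
              (sum-cong-≋ λ j → sym (*-assoc (1# + η) (c j) (p j i)))))))
      where
      M = strict-bound (λ i → y i - z i)
      inv = pos-inverse (proj₁ (proj₂ M))
      η = ε * proj₁ inv
      0<η = *-pos 0<ε (proj₁ (proj₂ inv))
      ηM≈ε : η * proj₁ M ≈ ε
      ηM≈ε = trans (solve 3 (λ ε z M → ε :* z :* M := ε :* (M :* z)) refl ε (proj₁ inv) (proj₁ M))
        (trans (*-congˡ (proj₂ (proj₂ inv))) (*-identityʳ ε))
      in-cube : OpenCube y ε (λ i → y i + η * (y i - z i))
      in-cube i =
          <-by _ (*-pos 0<η (0<- (proj₁ (proj₂ (proj₂ M) i))))
            (trans (solve 4 (λ η y z M → η :* ((y :- z) :- :- M) := y :+ η :* (y :- z) :- y :- :- (η :* M)) refl η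
              (y i) (z i) (proj₁ M))
              (+-congˡ (-‿cong (-‿cong ηM≈ε))))
        , <-by _ (*-pos 0<η (0<- (proj₂ (proj₂ (proj₂ M) i))))
            (trans (solve 4 (λ η y z M → η :* (M :- (y :- z)) := η :* M :- (y :+ η :* (y :- z) :- y)) refl η (y i)
              (z i) (proj₁ M))
              (+-congʳ ηM≈ε))
      Σ≈1 : - η + sum (λ j → (1# + η) * c j) ≈ 1#
      Σ≈1 = trans (+-congˡ (trans (sym (*-distribˡ-sum (1# + η) c)) (*-congˡ Σc≈1)))
        (solve 1 (λ η → :- η :+ (con 1ℤ :+ η) :* con 1ℤ := con 1ℤ) refl η)

    -- If the constraint were positive at z and zero at y, it would be negative slightly beyond y,
    -- at a point that still belongs to S.
    vanishes : ∀ {y z} j → y ∈ int S → eval (J j) y ≈ 0# → z ∈ S → eval (J j) z ≈ 0#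
    vanishes {y} {z} j y∈int Jy≈0 z∈S = ≤-antisym (*-cancelˡ-≤ 0<η (≤-by _ (S⇒ w∈S j) equation)) (S⇒ z∈S j)
      where
      η = proj₁ (beyond y∈int z∈S)
      0<η = proj₁ (proj₂ (beyond y∈int z∈S))
      w∈S = proj₂ (proj₂ (beyond y∈int z∈S))
      equation : eval (J j) (λ i → y i + η * (y i - z i)) ≈ η * 0# - η * eval (J j) z
      equation = trans (eval-linear (J j) y η (λ i → y i - z i)) (trans
        (solve 4 (λ ey η ez d → ey :+ η :* d := η :* ((ez :+ d) :- ez) :+ ey) refl (eval (J j) y) η (eval (J j) z)
          (dot (gradient (J j)) (λ i → y i - z i)))
        (trans (+-cong (*-congˡ (+-congʳ (trans (sym (eval-difference (J j) y z)) Jy≈0))) Jy≈0)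
          (solve 2 (λ η z → η :* (con 0ℤ :- z) :+ con 0ℤ := η :* con 0ℤ :- η :* z) refl η (eval (J j) z))))

    int⊆S : ∀ {x} → x ∈ int S → x ∈ S
    int⊆S {x} (x∈aff , ε , 0<ε , cube⊆S) = cube⊆S ((λ i →
        <-by ε 0<ε (solve 2 (λ ε x → ε := x :- x :- :- ε) refl ε (x i))
      , <-by ε 0<ε (solve 2 (λ ε x → ε := ε :- (x :- x)) refl ε (x i))) , x∈aff)

    p₀∈S : p₀ ∈ S
    p₀∈S = int⊆S p₀∈int

    -- `vanishes` is used from both sides: a constraint active at p₀ or at x is active on all of S.
    int⇒OpenFace : ∀ {x} → x ∈ int S → x ∈ D
    int⇒OpenFace {x} x∈int j = choose (em {eval (J j) p₀ ≈ 0#})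
      where
      choose : Dec (eval (J j) p₀ ≈ 0#) → SameSign (eval (J j) p₀) (eval (J j) x)
      choose (yes Jp₀≈0) = inj₂ (Jp₀≈0 , vanishes j p₀∈int Jp₀≈0 (int⊆S x∈int))
      choose (no  Jp₀≉0) = inj₁ ((S⇒ p₀∈S j , λ 0≈ → Jp₀≉0 (sym 0≈))
        , (S⇒ (int⊆S x∈int) j , λ 0≈ → Jp₀≉0 (vanishes j x∈int (sym 0≈) p₀∈S)))

    D⊆S : ∀ {x} → x ∈ D → x ∈ S
    D⊆S x∈D = S⇐ λ j → nonNeg (x∈D j)
      where
      nonNeg : ∀ {a b} → SameSign a b → 0# ≤ b
      nonNeg (inj₁ (_ , 0<b)) = <⇒≤ 0<b
      nonNeg (inj₂ (_ , b≈0)) = ≤-reflexive (sym b≈0)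

    -- Constraints positive at x remain nonnegative on a small cube. Those active at p₀ vanish on S
    -- and hence on its affine hull, so they restrict nothing there.
    OpenFace⇒int : ∀ {x} → x ∈ D → x ∈ int S
    OpenFace⇒int {x} x∈D =
        (1 , (λ _ → 1#) , (λ _ → x) , (λ _ → D⊆S x∈D) , +-identityʳ 1#
          , λ i → sym (trans (+-identityʳ (1# * x i)) (*-identityˡ (x i))))
      , small .proj₁ , proj₁ (proj₂ small) , λ {y} (y∈cube , y∈aff) → S⇐ λ j →
          proj₂ (proj₂ small) (proj₁ (proj₂ small)) ≤-refl j y y∈cube y∈aff
      where
      near : ∀ j → SameSign (eval (J j) p₀) (eval (J j) x) →
             Small (λ ε → ∀ y → y ∈ OpenCube x ε → y ∈ AffineHull S → 0# ≤ eval (J j) y)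
      near j (inj₁ (_ , 0<Jx)) = small-map (λ {ε} 0<ε le y y∈cube _ →
          ≤-resp refl (sym (eval-difference (J j) y x)) (≤-by _
            (+-nonNeg (0≤- (le (<⇒≤ 0<ε) ≤-refl)) (0≤- (proj₂ lower y∈cube)))
            (solve 4 (λ jx ε A d → (jx :- ε :* A) :+ (d :- :- (ε :* A)) := jx :+ d :- con 0ℤ) refl (eval (J j) x)
              ε (proj₁ lower) (dot (gradient (J j)) (λ i → y i - x i)))))
        (small-multiple (proj₁ lower) 0<Jx)
        where lower = dot-lower-bound (gradient (J j))
      near j (inj₂ (Jp₀≈0 , _)) = small-all λ _ y _ (k , c , p , p∈S , Σc≈1 , y≋) → ≤-reflexive (sym
        (trans (eval-cong (J j) y≋) (trans (eval-combination (J j) c p Σc≈1)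
          (sum-≈0 λ i → trans (*-congˡ (vanishes j p₀∈int Jp₀≈0 (p∈S i))) (zeroʳ (c i))))))
      small = small-∀ (λ j → near j (x∈D j))

    S⇒ClosedFace : ∀ {x} → x ∈ S → x ∈ ClosedFace J p₀
    S⇒ClosedFace x∈S j = S⇒ x∈S j , λ Jp₀≈0 → vanishes j p₀∈int Jp₀≈0 x∈S

  -- Open faces and functions convex along integral directions

  ray-0 : ∀ {n} (x : Point n) {d} → ray x 0# d ≋ x
  ray-0 x {d} i = solve 2 (λ x d → x :+ con 0ℤ :* d := x) refl (x i) (fromℤ (d i))

  combination : ∀ {n k} → Point n → Vector Carrier k → (Fin k → Vector ℤ n) → Point n
  combination x t ds l = x l + sum (λ i → t i * fromℤ (ds i l))

  module OpenFaceGeometry {n m : ℕ} (J : Vector (IntegralAffine n) m) {p₀ : Point n} (p₀∈D : p₀ ∈ OpenFace J p₀)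
    where

    D : Pred (Point n) 0ℓ
    D = OpenFace J p₀

    Direction : Pred (Vector ℤ n) 0ℓ
    Direction d = ∀ j → eval (J j) p₀ ≈ 0# → gradient (J j) ∙ d ≡ 0ℤ

    D-cong : ∀ {x y} → x ≋ y → x ∈ D → y ∈ D
    D-cong x≋y x∈D j with x∈D j
    ... | inj₁ (0<Jp₀ , 0<Jx) = inj₁ (0<Jp₀ , <-resp refl (eval-cong (J j) x≋y) 0<Jx)
    ... | inj₂ (Jp₀≈0 , Jx≈0) = inj₂ (Jp₀≈0 , trans (sym (eval-cong (J j) x≋y)) Jx≈0)

    D⇒ClosedFace : ∀ {x} → x ∈ D → x ∈ ClosedFace J p₀
    D⇒ClosedFace x∈D j with x∈D j
    ... | inj₁ (0<Jp₀ , 0<Jx) = <⇒≤ 0<Jx , λ Jp₀≈0 → contradiction (sym Jp₀≈0) (proj₂ 0<Jp₀)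
    ... | inj₂ (Jp₀≈0 , Jx≈0) = ≤-reflexive (sym Jx≈0) , λ _ → Jx≈0

    -- The start w may lie on the boundary, hence 0 < t: each constraint at w + t d then carries a
    -- positive share of its value at the endpoint in D.
    D-segment : ∀ {w d t T} → w ∈ ClosedFace J p₀ → ray w T d ∈ D → 0# < t → t ≤ T → ray w t d ∈ D
    D-segment {w} {d} {t} {T} w∈C x∈D 0<t t≤T j = go (x∈D j)
      where
      a = eval (J j) w
      s = fromℤ (gradient (J j) ∙ d)
      0<T = <-≤-trans 0<t t≤T
      mix : (T - t) * a + t * (a + T * s) ≈ T * (a + t * s)
      mix = solve 4 (λ T t a s → (T :- t) :* a :+ t :* (a :+ T :* s) := T :* (a :+ t :* s)) refl T t a s
      go : SameSign (eval (J j) p₀) (eval (J j) (ray w T d)) →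
           SameSign (eval (J j) p₀) (eval (J j) (ray w t d))
      go (inj₁ (0<Jp₀ , 0<Jx)) = inj₁ (0<Jp₀ , <-resp refl (sym (eval-ray (J j) w t d)) (≰⇒> λ ≤0 → <⇒≱
        (<-resp refl (trans (+-comm _ _) mix)
          (+-pos-nonNeg (*-pos 0<t (<-resp refl (eval-ray (J j) w T d) 0<Jx))
          (*-nonNeg (0≤- t≤T) (proj₁ (w∈C j)))))
        (≤-resp refl (zeroʳ T) (*-monoˡ-≤ (<⇒≤ 0<T) ≤0))))
      go (inj₂ (Jp₀≈0 , Jx≈0)) = inj₂
        (Jp₀≈0 , trans (eval-ray (J j) w t d) (*-≈0 (λ T≈0 → proj₂ 0<T (sym T≈0)) (trans (sym mix)
        (trans (+-cong (*-congˡ (proj₂ (w∈C j) Jp₀≈0)) (*-congˡ (trans (sym (eval-ray (J j) w T d)) Jx≈0)))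
          (solve 2 (λ T t → (T :- t) :* con 0ℤ :+ t :* con 0ℤ := con 0ℤ) refl T t)))))

    D-between : ∀ {x d t u} → x ∈ D → ray x (t + u) d ∈ D → 0# ≤ t → 0# ≤ u → ray x t d ∈ D
    D-between {x} {d} {t} {u} x∈D y∈D 0≤t 0≤u = go (em {t ≈ 0#})
      where
      go : Dec (t ≈ 0#) → ray x t d ∈ D
      go (yes t≈0) = D-cong (λ i → sym (trans (+-congˡ (*-congʳ t≈0)) (ray-0 x {d} i))) x∈D
      go (no  t≉0) = D-segment {d = d} (D⇒ClosedFace x∈D) y∈D (0≤t , λ 0≈t → t≉0 (sym 0≈t))
        (≤-by u 0≤u (solve 2 (λ t u → u := t :+ u :- t) refl t u))

    D-open : ∀ {x d} → x ∈ D → d ∈ Direction → Small (λ t → ray x t d ∈ D)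
    D-open {x} {d} x∈D d∈Λ = small-∀ λ j → near j (x∈D j)
      where
      near : ∀ j → SameSign (eval (J j) p₀) (eval (J j) x) →
             Small (λ t → SameSign (eval (J j) p₀) (eval (J j) (ray x t d)))
      near j (inj₁ (0<Jp₀ , 0<Jx)) = let η , 0<η , η+η≈Jx = halve 0<Jx in
        small-map (λ {t} 0<t le → inj₁ (0<Jp₀ , <-resp refl (sym (eval-ray (J j) x t d))
          (<-≤-trans 0<η (≤-by _ (0≤- (le (<⇒≤ 0<t) ≤-refl)) (trans
            (solve 3 (λ η t s → η :- t :* (:- s) := η :+ η :+ t :* s :- η) refl η t (fromℤ (gradient (J j) ∙ d)))
            (+-congʳ (+-congʳ η+η≈Jx)))))))
          (small-multiple (- fromℤ (gradient (J j) ∙ d)) 0<η)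
      near j (inj₂ (Jp₀≈0 , Jx≈0)) = small-all λ {t} _ → inj₂ (Jp₀≈0 , trans (eval-ray (J j) x t d)
        (trans (+-cong Jx≈0 (*-congˡ (reflexive (≡.cong fromℤ (d∈Λ j Jp₀≈0)))))
          (solve 1 (λ t → con 0ℤ :+ t :* con 0ℤ := con 0ℤ) refl t)))

    -- Convexity on integral lines only, at parameters in F, and cleared of denominators so that t
    -- and u may vanish separately.
    Convex : (Point n → Carrier) → Set
    Convex g = ∀ {x} d {t u} → x ∈ F^ n → x ∈ D → t ∈ Member → u ∈ Member → 0# ≤ t → 0# ≤ u → 0# < t + u →
      ray x (t + u) d ∈ D → (t + u) * g (ray x t d) ≤ u * g x + t * g (ray x (t + u) d)

    Extensional : (Point n → Carrier) → Set
    Extensional g = ∀ {x y} → x ∈ D → x ∈ F^ n → x ≋ y → g x ≈ g y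

    neg : Vector ℤ n → Vector ℤ n
    neg d i = ℤ.- d i

    neg-direction : ∀ {d} → d ∈ Direction → neg d ∈ Direction
    neg-direction {d} d∈Λ j Jp₀≈0 = fromℤ-injective (begin
      fromℤ (gradient (J j) ∙ neg d)        ≈⟨ dot-real (gradient (J j)) (neg d) ⟨
      dot (gradient (J j)) (real (neg d))
        ≈⟨ dot-cong (gradient (J j)) (λ i →
        trans (fromℤ-neg (d i)) (solve 1 (λ d → :- d := con 0ℤ :+ (:- con 1ℤ) :* d) refl (fromℤ (d i)))) ⟩
      dot (gradient (J j)) (λ i → 0# + - 1# * real d i)
        ≈⟨ dot-linear (gradient (J j)) (λ _ → 0#) (- 1#) (real d) ⟩
      dot (gradient (J j)) (λ _ → 0#) + - 1# * dot (gradient (J j)) (real d)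
        ≈⟨ +-cong (sum-≈0 λ i → zeroʳ (fromℤ (gradient (J j) i)))
          (*-congˡ (trans (dot-real (gradient (J j)) d) (reflexive (≡.cong fromℤ (d∈Λ j Jp₀≈0))))) ⟩
      0# + - 1# * 0#                        ≈⟨ solve 0 (con 0ℤ :+ (:- con 1ℤ) :* con 0ℤ := con 0ℤ) refl ⟩
      0#                                    ∎)
      where open ≈-Reasoning

    module _ {g : Point n → Carrier} (g-cong : Extensional g) (g-convex : Convex g) where

      AlmostBelow : ∀ {k} → (Fin k → Vector ℤ n) → Point n → Carrier → Carrier → Set
      AlmostBelow {k} ds x ε δ = ∀ (t : Vector Carrier k) → (∀ i → t i ∈ Member) → (∀ i → - δ ≤ t i × t i ≤ δ) →
        combination x t ds ∈ D × combination x t ds ∈ F^ n × g (combination x t ds) ≤ g x + ε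

      -- Along a segment from y near x to y + τ d near x + τ d, convexity bounds g
      -- near y by g y, since g is bounded near x + τ d.
      upper-semicontinuous : ∀ {k} (ds : Fin k → Vector ℤ n) → (∀ i → ds i ∈ Direction) →
        ∀ {x ε} → x ∈ F^ n → x ∈ D → 0# < ε → Small (AlmostBelow ds x ε)
      upper-semicontinuous {zero} ds ds∈Λ {x} {ε} x∈F x∈D 0<ε = small-all λ _ t _ _ →
        D-cong (λ i → sym (+-identityʳ (x i))) x∈D , (λ i → +-closed (x∈F i) 0-closed)
        , ≤-trans (≤-reflexive (sym (g-cong x∈D x∈F λ i → sym (+-identityʳ (x i)))))
            (≤-by ε (<⇒≤ 0<ε) (solve 2 (λ g ε → ε := g :+ ε :- g) refl (g x) ε))
      upper-semicontinuous {suc k} ds ds∈Λ {x} {ε} x∈F x∈D 0<ε =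
        -- Convexity is used forward from the base point, so a negative first coefficient is treated
        -- as a positive one along the opposite direction.
        small-map (λ {δ} 0<δ (pos , neg) t t∈F ∣t∣≤δ → cases pos neg t t∈F ∣t∣≤δ (≤-total 0# (t zero)))
          (small-× (one-sided (head ds) (ds∈Λ zero)) (one-sided (neg (head ds)) (neg-direction (ds∈Λ zero))))
        where
        ds′ = tail ds
        OneSided : Vector ℤ n → Carrier → Set
        OneSided d δ = ∀ (t : Vector Carrier k) {s} → (∀ i → t i ∈ Member) → (∀ i → - δ ≤ t i × t i ≤ δ) →
          s ∈ Member → 0# ≤ s → s ≤ δ →
          ray (combination x t ds′) s d ∈ D × ray (combination x t ds′) s d ∈ F^ n
            × g (ray (combination x t ds′) s d) ≤ g x + ε
        one-sided : ∀ d → d ∈ Direction → Small (OneSided d)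
        one-sided d d∈Λ = build (small-witness (D-open x∈D d∈Λ)) (halve 0<ε)
          where
          build : ∃[ τ ] (τ ∈ Member × 0# < τ × ray x τ d ∈ D) → ∃[ η ] (0# < η × η + η ≈ ε) → Small (OneSided d)
          build (τ , τ∈F , 0<τ , x⁺∈D) (η , 0<η , η+η≈ε) =
            -- At x the induction hypothesis is needed with accuracy η. At x⁺ any upper bound on
            -- nearby values would do, and `1#` is an arbitrary excess.
            small-map conclude (small-× (small-× (upper-semicontinuous ds′ (λ i → ds∈Λ (suc i)) x∈F x∈D 0<η)
                (upper-semicontinuous ds′ (λ i → ds∈Λ (suc i)) (ray∈F d x∈F τ∈F) x⁺∈D 0<1))
              (small-× (small-≤ 0<τ) (small-multiple K (*-pos 0<τ 0<η))))
            where
            x⁺ = ray x τ d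
            -- Convexity bounds g by g x + η + (s / τ) K, so s K ≤ τ η leaves an excess of at most η
            -- + η = ε.
            K = (g x⁺ + 1#) - (g x + η)
            conclude : ∀ {δ} → 0# < δ → (AlmostBelow ds′ x η δ × AlmostBelow ds′ x⁺ 1# δ) ×
                       (δ ≤ τ × (∀ {s} → 0# ≤ s → s ≤ δ → s * K ≤ τ * η)) → OneSided d δ
            conclude {δ} 0<δ ((below , below⁺) , δ≤τ , sK≤) t {s} t∈F ∣t∣≤δ s∈F 0≤s s≤δ =
                D-between {d = d} y∈D (D-cong (λ i → +-congˡ (*-congʳ s+u≈τ)) y⁺∈D) 0≤s 0≤u
              , ray∈F d y∈F s∈F
              , *-cancelˡ-≤ 0<τ (≤-by _ (+-nonNeg (+-nonNeg (0≤- convex) (*-nonNeg 0≤u (0≤- gy≤)))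
                  (+-nonNeg (*-nonNeg 0≤s (0≤- gy⁺≤)) (0≤- (sK≤ 0≤s s≤δ)))) certificate)
              where
              y = combination x t ds′
              u = τ - s
              s+u≈τ : τ ≈ s + u
              s+u≈τ = solve 2 (λ τ s → τ := s :+ (τ :- s)) refl τ s
              0≤u : 0# ≤ u
              0≤u = 0≤- (≤-trans s≤δ δ≤τ)
              y∈D = proj₁ (below t t∈F ∣t∣≤δ)
              y∈F = proj₁ (proj₂ (below t t∈F ∣t∣≤δ))
              gy≤ : g y ≤ g x + η
              gy≤ = proj₂ (proj₂ (below t t∈F ∣t∣≤δ))
              shift : combination x⁺ t ds′ ≋ ray y τ d
              shift i = solve 3 (λ x τ c → x :+ τ :+ c := x :+ c :+ τ) refl (x i) (τ * fromℤ (d i))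
                (sum (λ l → t l * fromℤ (ds′ l i)))
              y⁺∈D : ray y τ d ∈ D
              y⁺∈D = D-cong shift (proj₁ (below⁺ t t∈F ∣t∣≤δ))
              gy⁺≤ : g (ray y τ d) ≤ g x⁺ + 1#
              gy⁺≤ = ≤-trans (≤-reflexive (sym
                (g-cong (proj₁ (below⁺ t t∈F ∣t∣≤δ)) (proj₁ (proj₂ (below⁺ t t∈F ∣t∣≤δ))) shift)))
                (proj₂ (proj₂ (below⁺ t t∈F ∣t∣≤δ)))
              convex : τ * g (ray y s d) ≤ u * g y + s * g (ray y τ d)
              convex = ≤-resp (*-congʳ (sym s+u≈τ))
                (+-congˡ (*-congˡ (g-cong (D-cong (λ i → +-congˡ (*-congʳ s+u≈τ)) y⁺∈D)
                  (ray∈F d y∈F (+-closed s∈F (sub-closed τ∈F s∈F))) λ i → +-congˡ (*-congʳ (sym s+u≈τ)))))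
                (g-convex d y∈F y∈D s∈F (sub-closed τ∈F s∈F) 0≤s 0≤u (<-resp refl s+u≈τ 0<τ)
                  (D-cong (λ i → +-congˡ (*-congʳ s+u≈τ)) y⁺∈D))
              certificate : ((u * g y + s * g (ray y τ d)) - τ * g (ray y s d) + u * ((g x + η) - g y))
                  + (s * ((g x⁺ + 1#) - g (ray y τ d)) + (τ * η - s * K)) ≈ τ * (g x + ε) - τ * g (ray y s d)
              certificate = trans (solve 8 (λ τ s gx gy gz gp gx⁺ η →
                  ((((τ :- s) :* gy :+ s :* gp) :- τ :* gz) :+ (τ :- s) :* ((gx :+ η) :- gy))
                    :+ (s :* ((gx⁺ :+ con 1ℤ) :- gp) :+ (τ :* η :- s :* ((gx⁺ :+ con 1ℤ) :- (gx :+ η))))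
                  := τ :* (gx :+ (η :+ η)) :- τ :* gz) refl τ s (g x) (g y) (g (ray y s d)) (g (ray y τ d)) (g x⁺)
                    η)
                (+-congʳ (*-congˡ (+-congˡ η+η≈ε)))
        transport : ∀ {y z} → y ∈ D × y ∈ F^ n × g y ≤ g x + ε → y ≋ z → z ∈ D × z ∈ F^ n × g z ≤ g x + ε
        transport (y∈D , y∈F , gy≤) y≋z = D-cong y≋z y∈D , (λ i → respects (y≋z i) (y∈F i)) , ≤-trans
          (≤-reflexive (sym (g-cong y∈D y∈F y≋z))) gy≤
        cases : ∀ {δ} → OneSided (head ds) δ → OneSided (neg (head ds)) δ → ∀ (t : Vector Carrier (suc k)) →
          (∀ i → t i ∈ Member) → (∀ i → - δ ≤ t i × t i ≤ δ) → 0# ≤ t zero ⊎ t zero ≤ 0# →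
          combination x t ds ∈ D × combination x t ds ∈ F^ n × g (combination x t ds) ≤ g x + ε
        cases {δ} pos neg t t∈F ∣t∣≤δ (inj₁ 0≤t₀) =
          transport (pos (tail t) (λ i → t∈F (suc i)) (λ i → ∣t∣≤δ (suc i)) (t∈F zero) 0≤t₀ (proj₂ (∣t∣≤δ zero)))
            λ i → solve 3 (λ x a b → x :+ a :+ b := x :+ (b :+ a)) refl (x i)
              (sum (λ l → t (suc l) * fromℤ (ds′ l i))) (t zero * fromℤ (head ds i))
        cases {δ} pos neg t t∈F ∣t∣≤δ (inj₂ t₀≤0) =
          transport (neg (tail t) (λ i → t∈F (suc i)) (λ i → ∣t∣≤δ (suc i)) (neg-closed (t∈F zero))
              (≤-resp refl (+-identityˡ _) (0≤- t₀≤0))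
                (≤-resp refl (solve 1 (λ δ → :- :- δ := δ) refl δ) (neg-mono-≤ (proj₁ (∣t∣≤δ zero)))))
            λ i → trans (+-congˡ (*-congˡ (fromℤ-neg (head ds i))))
              (solve 4 (λ x a t d → x :+ a :+ (:- t) :* (:- d) := x :+ (t :* d :+ a)) refl (x i)
                (sum (λ l → t (suc l) * fromℤ (ds′ l i))) (t zero) (fromℤ (head ds i)))

  -- Approximation along integral directions

  module RationalApproximation {n m : ℕ} (J : Vector (IntegralAffine n) m) {p₀ : Point n}
    (p₀∈D : p₀ ∈ OpenFace J p₀) where
    open OpenFaceGeometry J p₀∈D

    private
      -- An inactive constraint contributes the zero equation, so that E keeps the index set of J
      -- while its kernel is the space of directions of the open face.
      equation : ∀ {j} → Dec (eval (J j) p₀ ≈ 0#) → Vector ℤ n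
      equation {j} (yes _) = gradient (J j)
      equation     (no  _) = λ _ → 0ℤ

      E : Fin m → Vector ℤ n
      E j = equation {j} (em {eval (J j) p₀ ≈ 0#})

      projection = kernel-projection E

    R : Fin n → Vector ℤ n
    R = proj₁ projection

    R∈Λ : ∀ i → R i ∈ Direction
    R∈Λ i j Jp₀≈0 = go (em {eval (J j) p₀ ≈ 0#}) (proj₁ (proj₂ projection) j i)
      where
      go : (dec : Dec (eval (J j) p₀ ≈ 0#)) → equation {j} dec ∙ R i ≡ 0ℤ → gradient (J j) ∙ R i ≡ 0ℤ
      go (yes _)     eq = eq
      go (no Jp₀≉0) _  = contradiction Jp₀≈0 Jp₀≉0

    R-id : ∀ x → (∀ j → eval (J j) p₀ ≈ 0# → dot (gradient (J j)) x ≈ 0#) → ∀ l →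
      sum (λ i → x i * fromℤ (R i l)) ≈ x l
    R-id x Jx≈0 = proj₂ (proj₂ projection) x λ j → go j (em {eval (J j) p₀ ≈ 0#})
      where
      go : ∀ j (dec : Dec (eval (J j) p₀ ≈ 0#)) → dot (equation {j} dec) x ≈ 0#
      go j (yes Jp₀≈0) = Jx≈0 j Jp₀≈0
      go j (no _)      = sum-≈0 λ i → zeroˡ (x i)

    -- A retraction of ℤⁿ onto the lattice of directions. Composed with it, a function on that
    -- lattice becomes one on ℤⁿ, where integral Hahn-Banach applies.
    project : Vector ℤ n → Vector ℤ n
    project d l = d ∙ (λ i → R i l)

    project≈ : ∀ d l → fromℤ (project d l) ≈ sum (λ i → real d i * fromℤ (R i l))
    project≈ d l = sym (dot-real d (λ i → R i l))

    project∈Λ : ∀ d → project d ∈ Direction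
    project∈Λ d j Jp₀≈0 = fromℤ-injective (begin
      fromℤ (a ∙ project d)                                   ≈⟨ dot-real a (project d) ⟨
      dot a (real (project d))                                ≈⟨ dot-cong a (project≈ d) ⟩
      dot a (λ l → sum (λ i → real d i * fromℤ (R i l)))      ≈⟨ sum-scale-swap a (real d) R ⟩
      sum (λ i → real d i * fromℤ (a ∙ R i))
        ≈⟨ sum-≈0 (λ i → trans (*-congˡ (reflexive (≡.cong fromℤ (R∈Λ i j Jp₀≈0)))) (zeroʳ (real d i))) ⟩
      0#                                                      ∎)
      where
      open ≈-Reasoning
      a = gradient (J j)

    project-id : ∀ {d} → d ∈ Direction → project d ≗ d
    project-id {d} d∈Λ l = fromℤ-injective (trans (project≈ d l)
      (R-id (real d) (λ j Jp₀≈0 → trans (dot-real (gradient (J j)) d) (reflexive (≡.cong fromℤ (d∈Λ j Jp₀≈0))))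
        l))

    face-difference : ∀ {x w} → x ∈ ClosedFace J p₀ → w ∈ ClosedFace J p₀ → ∀ j → eval (J j) p₀ ≈ 0# →
      dot (gradient (J j)) (λ i → x i - w i) ≈ 0#
    face-difference {x} {w} x∈C w∈C j Jp₀≈0 =
      trans (solve 2 (λ a d → d := (a :+ d) :- a) refl (eval (J j) w) (dot (gradient (J j)) (λ i → x i - w i)))
        (trans (+-cong (trans (sym (eval-difference (J j) x w)) (proj₂ (x∈C j) Jp₀≈0))
          (-‿cong (proj₂ (w∈C j) Jp₀≈0))) (-‿inverseʳ 0#))

    -- With M = 1 / r, round M (x - w) down to an integer vector and project it to a direction.
    -- Since x - w is fixed by the projection, only the rounding error is projected, and the point
    -- reached from w differs from x by a combination of the `R i` with coefficients at most r in
    -- absolute value.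
    rational-approximation : ∀ {x w} {Q : Pred (Point n) 0ℓ} → x ∈ F^ n → x ∈ ClosedFace J p₀ → w ∈ F^ n →
      w ∈ ClosedFace J p₀ →
      (∀ {y z} → y ≋ z → y ∈ Q → z ∈ Q) →
      Small (λ δ → ∀ (t : Vector Carrier n) → (∀ i → t i ∈ Member) → (∀ i → - δ ≤ t i × t i ≤ δ) →
        combination x t R ∈ Q) →
      ∃[ r ] (r ∈ Member × 0# < r × ∃[ d ] (d ∈ Direction × ray w r d ∈ Q))
    rational-approximation {x} {w} {Q} x∈F x∈C w∈F w∈C Q-resp small = build (small-reciprocal small)
      where
      z : Point n
      z i = x i - w i
      build : ∃[ N ] ∃[ r ] (r ∈ Member × 0# < r × fromℤ (+ suc N) * r ≈ 1# ×
                (∀ (t : Vector Carrier n) → (∀ i → t i ∈ Member) → (∀ i → - r ≤ t i × t i ≤ r) →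
                  combination x t R ∈ Q)) →
              ∃[ r ] (r ∈ Member × 0# < r × ∃[ d ] (d ∈ Direction × ray w r d ∈ Q))
      build (N , r , r∈F , 0<r , Nr≈1 , q) = r , r∈F , 0<r , project k , project∈Λ k , Q-resp agree
        (q t t∈F bounds)
        where
        M = fromℤ (+ suc N)
        k : Vector ℤ n
        k i = proj₁ (floor (M * z i))
        t : Vector Carrier n
        t i = r * fromℤ (k i) - z i
        t∈F : ∀ i → t i ∈ Member
        t∈F i = sub-closed (*-closed r∈F (fromℤ∈F (k i))) (sub-closed (x∈F i) (w∈F i))
        rM≈ : ∀ y → r * (M * y) ≈ y
        rM≈ y = trans (solve 3 (λ r M y → r :* (M :* y) := M :* r :* y) refl r M y)
          (trans (*-congʳ Nr≈1) (*-identityˡ y))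
        bounds : ∀ i → - r ≤ t i × t i ≤ r
        bounds i =
            ≤-by _ (0≤- (*-monoˡ-≤ (<⇒≤ 0<r) (proj₂ (proj₂ (floor (M * z i))))))
              (trans (+-congˡ (-‿cong (rM≈ (z i))))
                (solve 3 (λ r k z → r :* (k :+ con 1ℤ) :- z := r :* k :- z :- :- r) refl r (fromℤ (k i)) (z i)))
          , ≤-trans (≤-by _ (0≤- (*-monoˡ-≤ (<⇒≤ 0<r) (proj₁ (proj₂ (floor (M * z i))))))
              (trans (+-congʳ (rM≈ (z i))) (solve 3 (λ r k z → z :- r :* k := con 0ℤ :- (r :* k :- z)) refl r
                (fromℤ (k i)) (z i)))) (<⇒≤ 0<r)
        agree : combination x t R ≋ ray w r (project k)
        agree l = begin
          x l + sum (λ i → t i * fromℤ (R i l))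
            ≈⟨ +-congˡ (sum-cong-≋ λ i → solve 4
              (λ r k z R → (r :* k :- z) :* R := r :* (k :* R) :+ (:- con 1ℤ) :* (z :* R)) refl r (fromℤ (k i))
              (z i) (fromℤ (R i l))) ⟩
          x l + sum (λ i → r * (fromℤ (k i) * fromℤ (R i l)) + - 1# * (z i * fromℤ (R i l)))
            ≈⟨ +-congˡ (trans (∑-distrib-+ (λ i → r * (fromℤ (k i) * fromℤ (R i l)))
              (λ i → - 1# * (z i * fromℤ (R i l))))
                 (+-cong (sym (*-distribˡ-sum r (λ i → fromℤ (k i) * fromℤ (R i l))))
                   (sym (*-distribˡ-sum (- 1#) (λ i → z i * fromℤ (R i l)))))) ⟩
          x l + (r * sum (λ i → fromℤ (k i) * fromℤ (R i l)) + - 1# * sum (λ i → z i * fromℤ (R i l)))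
            ≈⟨ +-congˡ (+-cong (*-congˡ (sym (project≈ k l))) (*-congˡ (R-id z (face-difference x∈C w∈C) l))) ⟩
          x l + (r * fromℤ (project k l) + - 1# * (x l - w l))
            ≈⟨ solve 4 (λ x w r p → x :+ (r :* p :+ (:- con 1ℤ) :* (x :- w)) := w :+ r :* p) refl (x l) (w l) r
              (fromℤ (project k l)) ⟩
          w l + r * fromℤ (project k l) ∎
          where open ≈-Reasoning

  -- Maxima of affine pieces in one variable

  Piece : Set
  Piece = Carrier × ℤ

  value : Piece → Carrier → Carrier
  value (c , m) t = c + t * fromℤ m

  -- Near 0 from the right, pieces are ordered lexicographically: by constant, and by slope when the
  -- constants agree.
  compare-near-0 : ∀ p q → Small (λ t → value p t ≤ value q t) ⊎ Small (λ t → value q t ≤ value p t)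
  compare-near-0 p@(c , k) q@(c′ , k′) with em {c ≈ c′}
  ... | yes c≈c′ with ≤-total (fromℤ k) (fromℤ k′)
  ...   | inj₁ le = inj₁ (small-all λ 0<t → +-mono-≤ (≤-reflexive c≈c′) (*-monoˡ-≤ (<⇒≤ 0<t) le))
  ...   | inj₂ ge = inj₂ (small-all λ 0<t → +-mono-≤ (≤-reflexive (sym c≈c′)) (*-monoˡ-≤ (<⇒≤ 0<t) ge))
  compare-near-0 p@(c , k) q@(c′ , k′) | no c≉c′ with ≤-total c c′
  ...   | inj₁ le = inj₁ (small-map (λ {t} 0<t s → ≤-by _ (0≤- (s (<⇒≤ 0<t) ≤-refl))
            (solve 5 (λ t c k c′ k′ → (c′ :- c) :- t :* (k :- k′) := (c′ :+ t :* k′) :- (c :+ t :* k)) refl t c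
              (fromℤ k) c′ (fromℤ k′)))
          (small-multiple (fromℤ k - fromℤ k′) (0<- (le , c≉c′))))
  ...   | inj₂ ge = inj₂ (small-map (λ {t} 0<t s → ≤-by _ (0≤- (s (<⇒≤ 0<t) ≤-refl))
            (solve 5 (λ t c k c′ k′ → (c′ :- c) :- t :* (k :- k′) := (c′ :+ t :* k′) :- (c :+ t :* k)) refl t c′
              (fromℤ k′) c (fromℤ k)))
          (small-multiple (fromℤ k′ - fromℤ k) (0<- (ge , λ c′≈c → c≉c′ (sym c′≈c)))))

  leading-piece : ∀ p ps → ∃[ q
    ] (q Membership.∈ p ∷ ps × Small (λ t → All (λ r → value r t ≤ value q t) (p ∷ ps)))
  leading-piece p [] = p , here ≡.refl , small-all λ _ → ≤-refl ∷ []
  leading-piece p (p′ ∷ ps) with leading-piece p′ ps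
  ... | q , q∈ , leads with compare-near-0 p q
  ...   | inj₁ le = q , there q∈ , small-map (λ { _ (le , leads) → le ∷ leads }) (small-× le leads)
  ...   | inj₂ ge = p , here ≡.refl , small-map
    (λ { _ (ge , leads) → ≤-refl ∷ All.map (λ le → ≤-trans le ge) leads }) (small-× ge leads)

  module _ {n m : ℕ} (J : Vector (IntegralAffine n) m) {p₀ : Point n} (p₀∈D : p₀ ∈ OpenFace J p₀) where
    open OpenFaceGeometry J p₀∈D

    -- The maximum is encoded as an attained upper bound. This permits the empty list on lines that
    -- miss D, and w itself may lie outside D.
    IsEnvelope : (Point n → Carrier) → Point n → Vector ℤ n → List Piece → Set
    IsEnvelope f w d ps = ∀ {t} → t ∈ Member → ray w t d ∈ D →
      All (λ p → value p t ≤ f (ray w t d)) ps × Any (λ p → f (ray w t d) ≈ value p t) ps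

    Envelope : (Point n → Carrier) → Point n → Vector ℤ n → Set
    Envelope f w d = ∃[ ps ] (All (λ p → proj₁ p ∈ Member) ps × IsEnvelope f w d ps)

  -- Existence and slopes of minorants

  module Minorants {n m : ℕ} (J : Vector (IntegralAffine n) m) {p₀ : Point n} (p₀∈D : p₀ ∈ OpenFace J p₀)
    (p₀∈F : p₀ ∈ F^ n) (f : Point n → Carrier) (f-cong : OpenFaceGeometry.Extensional J p₀∈D f)
    (envelope : ∀ {w} d → w ∈ F^ n → Envelope J p₀∈D f w d) where
    open OpenFaceGeometry J p₀∈D
    open RationalApproximation J p₀∈D

    module _ {x : Point n} (d : Vector ℤ n) where
      at-0 : x ∈ D → ray x 0# d ∈ D
      at-0 = D-cong λ i → sym (ray-0 x {d} i)

      f-at-0 : x ∈ D → x ∈ F^ n → f x ≈ f (ray x 0# d)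
      f-at-0 x∈D x∈F = f-cong x∈D x∈F λ i → sym (ray-0 x {d} i)

    value-0 : ∀ p → value p 0# ≈ proj₁ p
    value-0 (c , k) = solve 2 (λ c k → c :+ con 0ℤ :* k := c) refl c (fromℤ k)

    -- The piece attained at the middle point is affine and lies below f at both ends.
    f-convex : Convex f
    f-convex {x} d {t} {u} x∈F x∈D t∈F u∈F 0≤t 0≤u 0<t+u y∈D = from-piece (envelope d x∈F)
      where
      from-piece : Envelope J p₀∈D f x d →
                   (t + u) * f (ray x t d) ≤ u * f x + t * f (ray x (t + u) d)
      from-piece (ps , _ , env) = All.lookupWith (λ { {p} (v₀≤ , v₁≤) f≈ → ≤-by _
            (+-nonNeg (*-nonNeg 0≤u (0≤- v₀≤)) (*-nonNeg 0≤t (0≤- v₁≤)))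
            (trans (solve 6 (λ u t f₀ f₁ c k →
              u :* (f₀ :- (c :+ con 0ℤ :* k)) :+ t :* (f₁ :- (c :+ (t :+ u) :* k))
                              := (u :* f₀ :+ t :* f₁) :- (t :+ u) :* (c :+ t :* k)) refl u t (f (ray x 0# d))
                                (f (ray x (t + u) d)) (proj₁ p) (fromℤ (proj₂ p)))
              (+-cong (+-congʳ (*-congˡ (sym (f-at-0 d x∈D x∈F)))) (-‿cong (*-congˡ (sym f≈))))) })
        (All.zip (proj₁ (env 0-closed (at-0 d x∈D)) , proj₁ (env (+-closed t∈F u∈F) y∈D)))
        (proj₂ (env t∈F (D-between {d = d} x∈D y∈D 0≤t 0≤u)))

    -- The right tangent of f at w along d: exact for small positive t, and below f on the whole
    -- line, for negative t as well.
    Germ : Point n → Vector ℤ n → Piece → Set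
    Germ w d q = Small (λ t → t ∈ Member → f (ray w t d) ≈ value q t) ×
                 (∀ {t} → t ∈ Member → ray w t d ∈ D → value q t ≤ f (ray w t d))

    germ : ∀ {w} d → w ∈ F^ n → Small (λ t → ray w t d ∈ D) →
      ∃[ q ] (proj₁ q ∈ Member × Germ w d q × (w ∈ D → f w ≈ proj₁ q))
    germ {w} d w∈F inside = from-envelope (envelope d w∈F)
      where
      from-envelope : Envelope J p₀∈D f w d →
                      ∃[ q ] (proj₁ q ∈ Member × Germ w d q × (w ∈ D → f w ≈ proj₁ q))
      from-envelope ([] , _ , env) = let _ , t∈F , _ , x∈D = small-witness inside in
        contradiction (proj₂ (env t∈F x∈D)) λ ()
      from-envelope (p ∷ ps , ps∈F , env) = from-leading (leading-piece p ps)
        where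
        from-leading : ∃[ q ] (q Membership.∈ p ∷ ps × Small (λ t → All (λ r → value r t ≤ value q t) (p ∷ ps))) →
                       ∃[ q ] (proj₁ q ∈ Member × Germ w d q × (w ∈ D → f w ≈ proj₁ q))
        from-leading (q , q∈ , leads) = q , All.lookup ps∈F q∈ ,
            ( small-map (λ { _ (lead , x∈D) t∈F → ≤-antisym
                  (All.lookupWith (λ { le f≈ → ≤-trans (≤-reflexive f≈) le }) lead (proj₂ (env t∈F x∈D)))
                  (below t∈F x∈D) }) (small-× leads inside)
            , below)
          -- The piece attained at t = 0 is below the leading one for small positive t, and passing
          -- to the limit compares their constants.
          , λ w∈D → ≤-antisym
              (let r , r∈ , f≈ = Membership.find (proj₂ (env 0-closed (at-0 d w∈D))) in
                ≤-trans (≤-reflexive (trans (f-at-0 d w∈D w∈F) (trans f≈ (value-0 r))))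
                  (≤-limit {b = fromℤ (proj₂ r)} {e = fromℤ (proj₂ q)}
                    (small-map (λ { _ lead _ → All.lookup lead r∈ }) leads)))
              (≤-resp (value-0 q) (sym (f-at-0 d w∈D w∈F)) (below 0-closed (at-0 d w∈D)))
          where
          below : ∀ {t} → t ∈ Member → ray w t d ∈ D → value q t ≤ f (ray w t d)
          below t∈F x∈D = All.lookup (proj₁ (env t∈F x∈D)) q∈

    slope-cancel : ∀ {c k k′} → Small (λ t → t ∈ Member → value (c , k) t ≤ value (c , k′) t) → k ℤ.≤ k′
    slope-cancel {c} {k} {k′} small = let t , t∈F , 0<t , le = small-witness small in
      fromℤ-cancel-≤ (*-cancelˡ-≤ 0<t (≤-by _ (0≤- (le t∈F))
        (solve 4 (λ t c k k′ → (c :+ t :* k′) :- (c :+ t :* k) := t :* k′ :- t :* k) refl t c (fromℤ k)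
          (fromℤ k′))))

    Minorant : Pred (IntegralAffine n) 0ℓ
    Minorant l = ∀ {x} → x ∈ F^ n → x ∈ D → eval l x ≤ f x

    module At {p : Point n} (p∈F : p ∈ F^ n) (p∈D : p ∈ D) where

      germ-at : ∀ d → d ∈ Direction → ∃[ k ] Germ p d (f p , k)
      germ-at d d∈Λ = let (c , k) , _ , (exact , below) , f≈c = germ d p∈F (D-open p∈D d∈Λ) in
        k , small-map (λ _ eq t∈F → trans (eq t∈F) (+-congʳ (sym (f≈c p∈D)))) exact
          , λ t∈F x∈D → ≤-trans (≤-reflexive (+-congʳ (f≈c p∈D))) (below t∈F x∈D)

      f-p∈F : f p ∈ Member
      f-p∈F = let (c , k) , c∈F , _ , f≈c = germ (project λ _ → 0ℤ) p∈F (D-open p∈D (project∈Λ λ _ → 0ℤ)) in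
        respects (sym (f≈c p∈D)) c∈F

      inside : ∀ d → Small (λ t → ray p t (project d) ∈ D)
      inside d = D-open p∈D (project∈Λ d)

      project-linear : ∀ x y l → fromℤ (project (λ i → x i ℤ.+ y i) l) ≈ fromℤ (project x l) + fromℤ (project y l)
      project-linear x y l = trans (project≈ (λ i → x i ℤ.+ y i) l) (trans
        (sum-cong-≋ λ i → trans (*-congʳ (fromℤ-+ (x i) (y i)))
          (distribʳ (fromℤ (R i l)) (fromℤ (x i)) (fromℤ (y i))))
        (trans (∑-distrib-+ (λ i → real x i * fromℤ (R i l)) (λ i → real y i * fromℤ (R i l)))
          (sym (+-cong (project≈ x l) (project≈ y l)))))

      project-scale : ∀ k x l → fromℤ (project (λ i → k ℤ.* x i) l) ≈ fromℤ k * fromℤ (project x l)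
      project-scale k x l = trans (project≈ (λ i → k ℤ.* x i) l) (trans
        (sum-cong-≋ λ i → trans (*-congʳ (fromℤ-* k (x i))) (*-assoc (fromℤ k) (fromℤ (x i)) (fromℤ (R i l))))
        (trans (sym (*-distribˡ-sum (fromℤ k) (λ i → real x i * fromℤ (R i l)))) (*-congˡ (sym (project≈ x l)))))

      module Support (h : Vector ℤ n → ℤ)
        (h-exact : ∀ d → Small (λ t → t ∈ Member → f (ray p t (project d)) ≈ f p + t * fromℤ (h d)))
        (h-below : ∀ d {t} → t ∈ Member → ray p t (project d) ∈ D →
          f p + t * fromℤ (h d) ≤ f (ray p t (project d))) where

        h-cong : Congruent h
        h-cong {x} {y} x≗y = ℤₚ.≤-antisym (half x≗y) (half (λ i → ≡.sym (x≗y i)))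
          where
          half : ∀ {x y} → x ≗ y → h x ℤ.≤ h y
          half {x} {y} x≗y = slope-cancel {f p}
            (small-map (λ { {t} 0<t ((fx , fy) , x∈D) t∈F → ≤-reflexive (trans (sym (fx t∈F))
              (trans (f-cong x∈D (ray∈F (project x) p∈F t∈F) (λ l → +-congˡ (*-congˡ (trans (project≈ x l)
                  (trans (sum-cong-≋ λ i → *-congʳ (reflexive (≡.cong fromℤ (x≗y i)))) (sym (project≈ y l)))))))
                (fy t∈F))) })
            (small-× (small-× (h-exact x) (h-exact y)) (inside x)))

        h-hom⁺ : ∀ k x → h (λ i → + suc k ℤ.* x i) ≡ + suc k ℤ.* h x
        h-hom⁺ k x = ≡.sym (ℤₚ.≤-antisym (slope-cancel {f p} (small-map (λ _ eq t∈F → ≤-reflexive (eq t∈F)) both))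
                                         (slope-cancel {f p} (small-map (λ _ eq t∈F → ≤-reflexive (sym (eq t∈F)))
                                           both)))
          where
          M = fromℤ (+ suc k)
          kx : Vector ℤ n
          kx i = + suc k ℤ.* x i
          both : Small (λ t → t ∈ Member → value (f p , + suc k ℤ.* h x) t ≈ value (f p , h kx) t)
          both = small-map (λ { {t} 0<t (fkx , (fx , x∈D)) t∈F → begin
              f p + t * fromℤ (+ suc k ℤ.* h x)
                ≈⟨ +-congˡ (trans (*-congˡ (fromℤ-* (+ suc k) (h x)))
                (solve 3 (λ t M h → t :* (M :* h) := M :* t :* h) refl t M (fromℤ (h x)))) ⟩
              f p + M * t * fromℤ (h x)           ≈⟨ fx (*-closed (fromℕ∈F (suc k)) t∈F) ⟨
              f (ray p (M * t) (project x))
                ≈⟨ f-cong x∈D (ray∈F (project x) p∈F (*-closed (fromℕ∈F (suc k)) t∈F))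
                                                       (λ l → +-congˡ (trans (solve 3
                                                         (λ t M v → M :* t :* v := t :* (M :* v)) refl t M
                                                         (fromℤ (project x l)))
                                                         (*-congˡ (sym (project-scale (+ suc k) x l))))) ⟩
              f (ray p t (project kx))            ≈⟨ fkx t∈F ⟩
              f p + t * fromℤ (h kx)              ∎ })
            (small-× (h-exact kx) (small-scale
              {λ s → (s ∈ Member → f (ray p s (project x)) ≈ f p + s * fromℤ (h x)) × ray p s (project x) ∈ D}
              (0<fromℕ k) (small-× (h-exact x) (inside x))))
            where open ≈-Reasoning

        h-hom : Homogeneous h
        h-hom (suc k) x = h-hom⁺ k x
        h-hom zero    x = ℤₚ.≤-antisym
          (slope-cancel {f p} (small-map (λ _ eq t∈F → ≤-reflexive (sym (eq t∈F))) both))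
                                       (slope-cancel {f p} (small-map (λ _ eq t∈F → ≤-reflexive (eq t∈F)) both))
          where
          0x : Vector ℤ n
          0x i = 0ℤ ℤ.* x i
          both : Small (λ t → t ∈ Member → value (f p , 0ℤ) t ≈ value (f p , h 0x) t)
          both = small-map (λ { {t} 0<t (f0x , x∈D) t∈F → trans
              (trans (solve 2 (λ f t → f :+ t :* con 0ℤ := f) refl (f p) t)
                (f-cong p∈D p∈F λ l → sym (trans (+-congˡ (*-congˡ (project-scale 0ℤ x l)))
                (solve 3 (λ p t v → p :+ t :* (con 0ℤ :* v) := p) refl (p l) t (fromℤ (project x l))))))
              (f0x t∈F) })
            (small-× (h-exact 0x) (inside 0x))

        -- p + t (x + y) is the midpoint of p + 2t x and p + 2t y, on the line
        -- through them with the integral direction y − x.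
        h-sub : Subadditive h
        h-sub x y = slope-cancel {f p}
          (small-map (λ { {t} 0<t (fx+y , ((fx , x∈D) , (fy , y∈D))) t∈F → midpoint 0<t t∈F fx+y fx x∈D fy y∈D })
            (small-× (h-exact x+y) (small-scale
              {λ s → ((s ∈ Member → f (ray p s (project x)) ≈ f p + s * fromℤ (h x)) × ray p s (project x) ∈ D)
                                                     × ((s ∈ Member → f (ray p s (project y)) ≈ f p + s * fromℤ
                                                       (h y)) × ray p s (project y) ∈ D)}
              (+-pos-nonNeg 0<1 0≤1) (small-× (small-× (h-exact x) (inside x))
                (small-× (h-exact y) (inside y))))))
          where
          x+y : Vector ℤ n
          x+y i = x i ℤ.+ y i
          2# = 1# + 1#
          2#∈F : 2# ∈ Member
          2#∈F = +-closed 1-closed 1-closed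
          e : Vector ℤ n
          e l = project y l ℤ.- project x l
          midpoint : ∀ {t} → 0# < t → t ∈ Member →
            (t ∈ Member → f (ray p t (project x+y)) ≈ f p + t * fromℤ (h x+y)) →
            (2# * t ∈ Member → f (ray p (2# * t) (project x)) ≈ f p + 2# * t * fromℤ (h x)) →
              ray p (2# * t) (project x) ∈ D →
            (2# * t ∈ Member → f (ray p (2# * t) (project y)) ≈ f p + 2# * t * fromℤ (h y)) →
              ray p (2# * t) (project y) ∈ D →
            value (f p , h x+y) t ≤ value (f p , h x ℤ.+ h y) t
          midpoint {t} 0<t t∈F fx+y fx x∈D fy y∈D =
            *-cancelˡ-≤ 0<2t (≤-resp
              (*-congˡ (trans (f-cong (D-between {d = e} x∈D b∈D (<⇒≤ 0<t) (<⇒≤ 0<t)) (ray∈F e a∈F t∈F) mid≋)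
                (fx+y t∈F)))
              (trans (+-cong (*-congˡ (fx 2t∈F))
                (*-congˡ (trans (f-cong b∈D (ray∈F e a∈F (+-closed t∈F t∈F)) b≋) (fy 2t∈F))))
                (trans (solve 4 (λ t f h k → t :* (f :+ (con 1ℤ :+ con 1ℤ) :* t :* h) :+ t
                  :* (f :+ (con 1ℤ :+ con 1ℤ) :* t :* k) := (t :+ t) :* (f :+ t :* (h :+ k)))
                  refl t (f p) (fromℤ (h x)) (fromℤ (h y)))
                  (*-congˡ (+-congˡ (*-congˡ (sym (fromℤ-+ (h x) (h y))))))))
              (f-convex e a∈F x∈D t∈F t∈F (<⇒≤ 0<t) (<⇒≤ 0<t) 0<2t b∈D))
            where
            0<2t = +-pos-nonNeg 0<t (<⇒≤ 0<t)
            2t∈F = *-closed 2#∈F t∈F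
            a = ray p (2# * t) (project x)
            a∈F = ray∈F (project x) p∈F 2t∈F
            b≋ : ray a (t + t) e ≋ ray p (2# * t) (project y)
            b≋ l = trans (+-congˡ (*-congˡ (fromℤ-sub (project y l) (project x l))))
              (solve 4 (λ p t x y → p :+ (con 1ℤ :+ con 1ℤ) :* t :* x :+ (t :+ t) :* (y :- x) := p
                :+ (con 1ℤ :+ con 1ℤ) :* t :* y)
                refl (p l) t (fromℤ (project x l)) (fromℤ (project y l)))
            b∈D : ray a (t + t) e ∈ D
            b∈D = D-cong (λ l → sym (b≋ l)) y∈D
            mid≋ : ray a t e ≋ ray p t (project x+y)
            mid≋ l = trans (+-congˡ (*-congˡ (fromℤ-sub (project y l) (project x l)))) (trans
              (solve 4 (λ p t x y → p :+ (con 1ℤ :+ con 1ℤ) :* t :* x :+ t :* (y :- x) := p :+ t :* (x :+ y))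
                refl (p l) t (fromℤ (project x l)) (fromℤ (project y l)))
              (+-congˡ (*-congˡ (sym (project-linear x y l)))))

        hb = integral-hahn-banach em h-cong h-sub h-hom

        support : IntegralAffine n
        support = record
          { gradient = proj₁ hb
          ; constant = f p - dot (proj₁ hb) p
          ; constant∈F = sub-closed f-p∈F (sum-closed λ i → *-closed (fromℤ∈F (proj₁ hb i)) (p∈F i))
          }

        support-exact : eval support p ≈ f p
        support-exact = solve 2 (λ d f → d :+ (f :- d) := f) refl (dot (proj₁ hb) p) (f p)

        support-below-ray : ∀ {t d} → d ∈ Direction → t ∈ Member → 0# ≤ t → ray p t d ∈ D →
          eval support (ray p t d) ≤ f (ray p t d)
        support-below-ray {t} {d} d∈Λ t∈F 0≤t x∈D = ≤-trans
          (≤-resp (sym (trans (eval-ray support p t d) (+-congʳ support-exact))) refl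
            (+-mono-≤ ≤-refl (*-monoˡ-≤ 0≤t (fromℤ-mono (proj₂ hb d)))))
          (≤-resp refl (f-cong y∈D (ray∈F (project d) p∈F t∈F) λ l → sym (d≋ l)) (h-below d t∈F y∈D))
          where
          d≋ : ray p t d ≋ ray p t (project d)
          d≋ l = +-congˡ (*-congˡ (reflexive (≡.cong fromℤ (≡.sym (project-id d∈Λ l)))))
          y∈D = D-cong d≋ x∈D

        gap : Point n → Carrier
        gap x = f x - eval support x

        gap-cong : Extensional gap
        gap-cong x∈D x∈F x≋y = +-cong (f-cong x∈D x∈F x≋y) (-‿cong (eval-cong support x≋y))

        gap-convex : Convex gap
        gap-convex {x} d {t} {u} x∈F x∈D t∈F u∈F 0≤t 0≤u 0<t+u y∈D = ≤-by _
          (0≤- (f-convex d x∈F x∈D t∈F u∈F 0≤t 0≤u 0<t+u y∈D))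
          (trans (solve 7 (λ t u f₀ f₁ f₂ e g → (u :* f₀ :+ t :* f₂) :- (t :+ u) :* f₁ :=
                (u :* (f₀ :- e) :+ t :* (f₂ :- (e :+ (t :+ u) :* g))) :- (t :+ u) :* (f₁ :- (e :+ t :* g)))
              refl t u (f x) (f (ray x t d)) (f (ray x (t + u) d)) (eval support x)
                (fromℤ (gradient support ∙ d)))
            (+-cong (+-congˡ (*-congˡ (+-congˡ (-‿cong (sym (eval-ray support x (t + u) d))))))
              (-‿cong (*-congˡ (+-congˡ (-‿cong (sym (eval-ray support x t d))))))))

        -- A point x with f x < support x would have such points nearby on a
        -- ray from p with integral direction.
        support-minorant : Minorant support
        support-minorant {x} x∈F x∈D = ≮⇒≥ λ lt → impossible (halve (0<- lt))
          where
          impossible : ¬ (∃[ η ] (0# < η × η + η ≈ eval support x - f x))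
          -- Here `gap x` is -2 η, so the gap would be at most -η at a point of a ray from p, where
          -- `support-below-ray` makes it nonnegative.
          impossible (η , 0<η , η+η≈) = absurd
            (rational-approximation {Q = λ y → y ∈ D × y ∈ F^ n × gap y ≤ gap x + η}
              x∈F (D⇒ClosedFace x∈D) p∈F (D⇒ClosedFace p∈D)
              (λ { y≋z (y∈D , y∈F , le) → D-cong y≋z y∈D , (λ i → respects (y≋z i) (y∈F i)) , ≤-trans
                (≤-reflexive (sym (gap-cong y∈D y∈F y≋z))) le })
              (upper-semicontinuous gap-cong gap-convex R R∈Λ x∈F x∈D 0<η))
            where
            absurd : ¬ (∃[ r ] (r ∈ Member × 0# < r
              × ∃[ d ] (d ∈ Direction × (ray p r d ∈ D × ray p r d ∈ F^ n × gap (ray p r d) ≤ gap x + η))))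
            absurd (r , r∈F , 0<r , d , d∈Λ , y∈D , _ , le) = <⇒≱ 0<η (≤-by _
              (+-nonNeg (0≤- le) (0≤- (support-below-ray d∈Λ r∈F (<⇒≤ 0<r) y∈D)))
              (trans (solve 5 (λ fx sx η fy sy → ((fx :- sx) :+ η :- (fy :- sy)) :+ (fy :- sy) := η :- (sx :- fx))
                refl (f x) (eval support x) η (f (ray p r d)) (eval support (ray p r d)))
                (trans (+-congˡ (-‿cong (sym η+η≈))) (solve 1 (λ η → η :- (η :+ η) := con 0ℤ :- η) refl η))))

      open Support (λ d → proj₁ (germ-at (project d) (project∈Λ d)))
        (λ d → proj₁ (proj₂ (germ-at (project d) (project∈Λ d))))
        (λ d → proj₂ (proj₂ (germ-at (project d) (project∈Λ d)))) public
        using (support; support-exact; support-minorant)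

    exact-minorant : ∀ {p} → p ∈ F^ n → p ∈ D → ∃[ l ] (l ∈ Minorant × eval l p ≈ f p)
    exact-minorant p∈F p∈D = At.support p∈F p∈D , At.support-minorant p∈F p∈D , At.support-exact p∈F p∈D

    open TopSelection Minorant using (Top; BoundedAlong)

    -- A minorant exact at a point of a germ at w where f is affine is exact along
    -- the germ, and so is the largest minorant at w.
    top-minorant : ∀ {w} → w ∈ F^ n → w ∈ ClosedFace J p₀ → ∃ (Top w)
    top-minorant {w} w∈F w∈C = from-direction
      (rational-approximation {Q = D} p₀∈F (D⇒ClosedFace p₀∈D) w∈F w∈C D-cong
        (small-map (λ _ below t t∈F ∣t∣≤ → proj₁ (below t t∈F ∣t∣≤))
          -- Applied to the zero function for its first component only: combinations with small
          -- coefficients stay in D.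
          (upper-semicontinuous {g = λ _ → 0#} (λ _ _ _ → refl) zero-convex R R∈Λ p₀∈F p₀∈D 0<1)))
      where
      zero-convex : Convex (λ _ → 0#)
      zero-convex _ {t} {u} _ _ _ _ _ _ _ _ = ≤-reflexive
        (solve 2 (λ t u → (t :+ u) :* con 0ℤ := u :* con 0ℤ :+ t :* con 0ℤ) refl t u)
      from-direction : ∃[ r ] (r ∈ Member × 0# < r × ∃[ d ] (d ∈ Direction × ray w r d ∈ D)) → ∃ (Top w)
      from-direction (r , r∈F , 0<r , d , d∈Λ , x∈D) = from-germ (germ d w∈F inside)
        where
        inside : Small (λ t → ray w t d ∈ D)
        inside = r , 0<r , λ 0<t t≤r → D-segment {d = d} w∈C x∈D 0<t t≤r
        from-germ : ∃[ q ] (proj₁ q ∈ Member × Germ w d q × (w ∈ D → f w ≈ proj₁ q)) → ∃ (Top w)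
        from-germ ((c , k) , _ , (exact , _) , _) = at-witness
          (small-witness (small-× here-and-twice inside-twice))
          where
          2# = 1# + 1#
          0<2 = +-pos-nonNeg 0<1 0≤1
          Exact : Carrier → Set
          Exact t = t ∈ Member → f (ray w t d) ≈ value (c , k) t
          here-and-twice : Small (λ t → Exact t × Exact (2# * t))
          here-and-twice = small-× exact (small-scale {Exact} 0<2 exact)
          inside-twice : Small (λ t → ray w t d ∈ D × ray w (2# * t) d ∈ D)
          inside-twice = small-× inside (small-scale {λ t → ray w t d ∈ D} 0<2 inside)
          at-witness : ∃[ t ] (t ∈ Member × 0# < t
            × ((Exact t × Exact (2# * t)) × (ray w t d ∈ D × ray w (2# * t) d ∈ D))) → ∃ (Top w)
          at-witness (t , t∈F , 0<t , (exact₁ , exact₂) , (x₁∈D , x₂∈D)) =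
              support , support-minorant , λ {μ} μ∈ → ≤-trans
                -- f need not be defined at w, but c is its limit along the germ and so bounds every
                -- minorant there.
                (≤-limit {b = fromℤ (gradient μ ∙ d)} {e = fromℤ k}
                  (small-map (λ { _ (eq , y∈D) s∈F →
                    ≤-resp (eval-ray μ w _ d) (eq s∈F) (μ∈ (ray∈F d w∈F s∈F) y∈D) }) (small-× exact inside)))
                c≤
            where
            2t∈F = *-closed (+-closed 1-closed 1-closed) t∈F
            open At (ray∈F d w∈F t∈F) x₁∈D using (support; support-minorant; support-exact)
            s₀ = eval support w
            a = fromℤ (gradient support ∙ d)
            eq₁ : s₀ + t * a ≈ c + t * fromℤ k
            eq₁ = trans (sym (eval-ray support w t d)) (trans support-exact (exact₁ t∈F))
            le₂ : s₀ + 2# * t * a ≤ c + 2# * t * fromℤ k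
            le₂ = ≤-resp (eval-ray support w (2# * t) d) (exact₂ 2t∈F) (support-minorant (ray∈F d w∈F 2t∈F) x₂∈D)
            -- Extrapolation back to w: the value at w is twice the value at t minus the value at 2
            -- t. The support is exact at t and at most f at 2 t, where f is still affine.
            c≤ : c ≤ s₀
            c≤ = ≤-by _ (0≤- le₂) (trans
              (solve 5 (λ s t a c k → (c :+ (con 1ℤ :+ con 1ℤ) :* t :* k) :- (s :+ (con 1ℤ :+ con 1ℤ) :* t :* a)
                  := (s :- c) :+ (con 1ℤ :+ con 1ℤ) :* ((c :+ t :* k) :- (s :+ t :* a))) refl s₀ t a c (fromℤ k))
              (trans (+-congˡ (trans (*-congˡ (-≈0 eq₁)) (zeroʳ 2#))) (+-identityʳ (s₀ - c))))

    -- Along the ray f is at most K + t C. A minorant l of integral slope above C has slope at least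
    -- C + 1 and overtakes this line once t > K - l(p₀). The time depends on l, the bound C does
    -- not.
    recession-bounded : ∀ d → (∀ {t} → 0# ≤ t → ray p₀ t d ∈ D) → BoundedAlong d
    recession-bounded d ray∈D = from-envelope (envelope d p₀∈F)
      where
      constant-bound : ∀ (ps : List Piece) → ∃[ K ] All (λ p → proj₁ p ≤ K) ps
      constant-bound [] = 0# , []
      constant-bound ((c , _) ∷ ps) = let K , bounds = constant-bound ps in pick c bounds (≤-total c K)
        where
        pick : ∀ c {K k ps} → All (λ p → proj₁ p ≤ K) ps → c ≤ K ⊎ K ≤ c →
          ∃[ K ] All (λ p → proj₁ p ≤ K) ((c , k) ∷ ps)
        pick c {K} bounds (inj₁ le) = K , le ∷ bounds
        pick c {K} bounds (inj₂ ge) = c , ≤-refl ∷ All.map (λ le → ≤-trans le ge) bounds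
      from-envelope : Envelope J p₀∈D f p₀ d → BoundedAlong d
      from-envelope (ps , _ , env) = C , λ {l} l∈ → ℤₚ.≮⇒≥ λ C<a →
        impossible l l∈ C<a (archimedean (1# + (K - eval l p₀)))
        where
        C = proj₁ (≤-upper-bound proj₂ ps)
        K = proj₁ (constant-bound ps)
        impossible : ∀ l → Minorant l → C ℤ.< gradient l ∙ d → ¬ (∃[ N ] 1# + (K - eval l p₀) ≤ fromℤ (+ N))
        impossible l l∈ C<a (N , le) = All.lookupWith (λ { {c , k} (k≤C , c≤K) f≈ → <⇒≱ 0<1 (≤-by _
                (+-nonNeg (+-nonNeg (0≤- c≤K) (*-nonNeg (0≤fromℕ N) (0≤- (fromℤ-mono k≤C))))
                  (+-nonNeg (+-nonNeg (0≤- (≤-resp (eval-ray l p₀ t d) f≈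
                    (l∈ (ray∈F d p₀∈F (fromℕ∈F N)) (ray∈D (0≤fromℕ N)))))
                    (*-nonNeg (0≤fromℕ N) (0≤- 1+C≤a))) (0≤- le)))
                (solve 7 (λ K c t C k e a →
                    ((K :- c) :+ t :* (C :- k)) :+
                      ((((c :+ t :* k) :- (e :+ t :* a)) :+ t :* (a :- (con 1ℤ :+ C)))
                      :+ (t :- (con 1ℤ :+ (K :- e))))
                    := con 0ℤ :- con 1ℤ) refl K c t (fromℤ C) (fromℤ k) (eval l p₀) (fromℤ (gradient l ∙ d)))) })
            (All.zip (proj₂ (≤-upper-bound proj₂ ps) , proj₂ (constant-bound ps)))
            (proj₂ (env (fromℕ∈F N) (ray∈D (0≤fromℕ N))))
          where
          t = fromℤ (+ N)
          1+C≤a : 1# + fromℤ C ≤ fromℤ (gradient l ∙ d)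
          1+C≤a = ≤-resp (trans (fromℤ-+ 1ℤ C) (+-congʳ fromℤ-1)) refl (fromℤ-mono (ℤₚ.i<j⇒suc[i]≤j C<a))

  -- Lines in integral directions are rational

  dot-basis : ∀ {n} (i : Fin n) (x : Vector Carrier n) → dot (basis i) x ≈ x i
  dot-basis zero    x = trans (+-cong (trans (*-congʳ fromℤ-1) (*-identityˡ (x zero)))
    (sum-≈0 λ j → zeroˡ (x (suc j)))) (+-identityʳ (x zero))
  dot-basis (suc i) x = trans (+-cong (zeroˡ (x zero)) (dot-basis i (tail x))) (+-identityˡ (x (suc i)))

  dot-difference : ∀ {n} α (a : Vector ℤ n) β b (x : Vector Carrier n) →
    dot (λ j → α ℤ.* a j ℤ.- β ℤ.* b j) x ≈ fromℤ α * dot a x - fromℤ β * dot b x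
  dot-difference α a β b x = begin
    sum (λ j → fromℤ (α ℤ.* a j ℤ.- β ℤ.* b j) * x j)
      ≈⟨ sum-cong-≋ (λ j → trans (*-congʳ
        (trans (fromℤ-sub (α ℤ.* a j) (β ℤ.* b j)) (+-cong (fromℤ-* α (a j)) (-‿cong (fromℤ-* β (b j))))))
           (solve 5 (λ α a β b x → (α :* a :- β :* b) :* x := α :* (a :* x) :+ (:- β) :* (b :* x)) refl (fromℤ α)
             (fromℤ (a j)) (fromℤ β) (fromℤ (b j)) (x j))) ⟩
    sum (λ j → fromℤ α * (fromℤ (a j) * x j) + - fromℤ β * (fromℤ (b j) * x j))
      ≈⟨ ∑-distrib-+ (λ j → fromℤ α * (fromℤ (a j) * x j)) (λ j → - fromℤ β * (fromℤ (b j) * x j)) ⟩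
    sum (λ j → fromℤ α * (fromℤ (a j) * x j)) + sum (λ j → - fromℤ β * (fromℤ (b j) * x j))
      ≈⟨ +-cong (*-distribˡ-sum (fromℤ α) (λ j → fromℤ (a j) * x j))
        (*-distribˡ-sum (- fromℤ β) (λ j → fromℤ (b j) * x j)) ⟨
    fromℤ α * dot a x + - fromℤ β * dot b x
      ≈⟨ solve 4 (λ α a β b → α :* a :+ (:- β) :* b := α :* a :- β :* b) refl (fromℤ α) (dot a x) (fromℤ β)
        (dot b x) ⟩
    fromℤ α * dot a x - fromℤ β * dot b x ∎
    where open ≈-Reasoning

  basis-diagonal : ∀ {n} (i : Fin n) → basis i i ≡ 1ℤ
  basis-diagonal zero    = ≡.refl
  basis-diagonal (suc i) = basis-diagonal i

  basis-off-diagonal : ∀ {n} {i j : Fin n} → ¬ (i ≡ j) → basis i j ≡ 0ℤ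
  basis-off-diagonal {i = zero}  {zero}  i≢j = contradiction ≡.refl i≢j
  basis-off-diagonal {i = zero}  {suc j} i≢j = ≡.refl
  basis-off-diagonal {i = suc i} {zero}  i≢j = ≡.refl
  basis-off-diagonal {i = suc i} {suc j} i≢j = basis-off-diagonal λ i≡j → i≢j (≡.cong suc i≡j)

  module RationalLine {n : ℕ} {w : Point (suc n)} (w∈F : w ∈ F^ (suc n)) (d : Vector ℤ (suc n))
    (k : Fin (suc n)) (dₖ≢0 : ¬ (d k ≡ 0ℤ)) where

    Line : Pred (Point (suc n)) 0ℓ
    Line x = ∃[ t ] x ≋ ray w t d

    fromℤ-dₖ≉0 : ¬ (fromℤ (d k) ≈ 0#)
    fromℤ-dₖ≉0 eq = dₖ≢0 (fromℤ-injective eq)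

    -- The 2 × 2 minor in columns i and j of the matrix with rows x - w and d.
    minor : Fin (suc n) → Fin (suc n) → IntegralAffine (suc n)
    minor i j = record
      { gradient = λ l → d j ℤ.* basis i l ℤ.- d i ℤ.* basis j l
      ; constant = fromℤ (d i) * w j - fromℤ (d j) * w i
      ; constant∈F = sub-closed (*-closed (fromℤ∈F (d i)) (w∈F j)) (*-closed (fromℤ∈F (d j)) (w∈F i))
      }

    eval-minor : ∀ i j x → eval (minor i j) x ≈ fromℤ (d j) * (x i - w i) - fromℤ (d i) * (x j - w j)
    eval-minor i j x = trans (+-congʳ (trans (dot-difference (d j) (basis i) (d i) (basis j) x)
        (+-cong (*-congˡ (dot-basis i x)) (-‿cong (*-congˡ (dot-basis j x))))))
      (solve 6 (λ dj xi di xj wj wi →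
        (dj :* xi :- di :* xj) :+ (di :* wj :- dj :* wi) := dj :* (xi :- wi) :- di :* (xj :- wj))
        refl (fromℤ (d j)) (x i) (fromℤ (d i)) (x j) (w j) (w i))

    eval-minor-on-line : ∀ i j {x} → x ∈ Line → eval (minor i j) x ≈ 0#
    eval-minor-on-line i j {x} (t , x≋) = trans (eval-minor i j x)
      (trans (+-cong (*-congˡ (+-congʳ (x≋ i))) (-‿cong (*-congˡ (+-congʳ (x≋ j)))))
        (solve 5 (λ dj wi t di wj → dj :* (wi :+ t :* di :- wi) :- di :* (wj :+ t :* dj :- wj) := con 0ℤ)
          refl (fromℤ (d j)) (w i) t (fromℤ (d i)) (w j)))

    minor-nonConstant : ∀ i → NonConstant (minor (punchIn k i) k)
    minor-nonConstant i gradient≗0 = dₖ≢0 (≡.trans (≡.sym coefficient) (gradient≗0 (punchIn k i)))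
      where
      coefficient : d k ℤ.* basis (punchIn k i) (punchIn k i) ℤ.- d (punchIn k i) ℤ.* basis k (punchIn k i) ≡ d k
      coefficient = ≡.trans (≡.cong₂ (λ a b → d k ℤ.* a ℤ.- d (punchIn k i) ℤ.* b) (basis-diagonal (punchIn k i))
        (basis-off-diagonal (λ eq → Finₚ.punchInᵢ≢i k i (≡.sym eq))))
        (≡.trans (≡.cong₂ ℤ._-_ (ℤₚ.*-identityʳ (d k)) (ℤₚ.*-zeroʳ (d (punchIn k i)))) (ℤₚ.+-identityʳ (d k)))

    minor-swap-nonConstant : ∀ i → NonConstant (minor k (punchIn k i))
    minor-swap-nonConstant i gradient≗0 = dₖ≢0 (≡.trans (≡.sym (ℤₚ.neg-involutive (d k)))
        (≡.cong ℤ.-_ (≡.trans (≡.sym coefficient) (gradient≗0 (punchIn k i)))))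
      where
      coefficient : d (punchIn k i) ℤ.* basis k (punchIn k i) ℤ.- d k ℤ.* basis (punchIn k i) (punchIn k i) ≡ ℤ.-
        d k
      coefficient = ≡.trans (≡.cong₂ (λ a b → d (punchIn k i) ℤ.* a ℤ.- d k ℤ.* b)
        (basis-off-diagonal (λ eq → Finₚ.punchInᵢ≢i k i (≡.sym eq))) (basis-diagonal (punchIn k i)))
        (≡.trans (≡.cong₂ ℤ._-_ (ℤₚ.*-zeroʳ (d (punchIn k i))) (ℤₚ.*-identityʳ (d k))) (ℤₚ.+-identityˡ (ℤ.- d k)))

    -- Exchanging the two columns negates a minor, so the two lists together force it to vanish.
    -- Minors against the pivot column k suffice; k itself is skipped, since its gradient would be
    -- zero.
    constraints⁺ constraints⁻ : List (IntegralAffine (suc n))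
    constraints⁺ = List.tabulate (λ i → minor (punchIn k i) k)
    constraints⁻ = List.tabulate (λ i → minor k (punchIn k i))

    line-from-constraints : ∀ {x} → All (λ l → 0# ≤ eval l x) (constraints⁺ ++ constraints⁻) → x ∈ Line
    line-from-constraints {x} all = t , on-line
      where
      inv = inverse (fromℤ (d k)) fromℤ-dₖ≉0
      t = (x k - w k) * proj₁ inv
      dₖt≈ : fromℤ (d k) * t ≈ x k - w k
      dₖt≈ = trans (solve 3 (λ d x z → d :* (x :* z) := d :* z :* x) refl (fromℤ (d k)) (x k - w k) (proj₁ inv))
        (trans (*-congʳ (proj₂ inv)) (*-identityˡ _))
      minor≈0 : ∀ i → fromℤ (d k) * (x (punchIn k i) - w (punchIn k i)) - fromℤ (d (punchIn k i))
        * (x k - w k) ≈ 0#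
      minor≈0 i = ≤-antisym
        (≤-by _ (≤-resp refl (eval-minor k (punchIn k i) x)
          (Allₚ.tabulate⁻ {f = λ i → minor k (punchIn k i)} (Allₚ.++⁻ʳ constraints⁺ all) i))
          (solve 4 (λ dk a di b → di :* b :- dk :* a := con 0ℤ :- (dk :* a :- di :* b)) refl (fromℤ (d k))
            (x (punchIn k i) - w (punchIn k i)) (fromℤ (d (punchIn k i))) (x k - w k)))
        (≤-resp refl (eval-minor (punchIn k i) k x)
          (Allₚ.tabulate⁻ {f = λ i → minor (punchIn k i) k} (Allₚ.++⁻ˡ constraints⁺ all) i))
      scaled : ∀ i → fromℤ (d k) * (x i - (w i + t * fromℤ (d i))) ≈ 0#
      scaled i = go (k Finₚ.≟ i)
        where
        distribute : ∀ i → fromℤ (d k) * (x i - (w i + t * fromℤ (d i))) ≈ fromℤ (d k) * (x i - w i) - fromℤ (d i)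
          * (x k - w k)
        distribute i = trans (solve 5
          (λ dk x w t di → dk :* (x :- (w :+ t :* di)) := dk :* (x :- w) :- di :* (dk :* t)) refl (fromℤ (d k))
          (x i) (w i) t (fromℤ (d i)))
          (+-congˡ (-‿cong (*-congˡ dₖt≈)))
        go : Dec (k ≡ i) → fromℤ (d k) * (x i - (w i + t * fromℤ (d i))) ≈ 0#
        go (yes ≡.refl) = trans (distribute k) (-‿inverseʳ _)
        go (no k≢i) = ≡.subst (λ i → fromℤ (d k) * (x i - (w i + t * fromℤ (d i))) ≈ 0#)
          (Finₚ.punchIn-punchOut k≢i)
          (trans (distribute (punchIn k (punchOut k≢i))) (minor≈0 (punchOut k≢i)))
      on-line : x ≋ ray w t d
      on-line i = ≈-by (*-≈0 fromℤ-dₖ≉0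
        (trans (solve 3 (λ d x y → d :* (y :- x) := :- (d :* (x :- y))) refl (fromℤ (d k)) (x i)
        (w i + t * fromℤ (d i)))
        (trans (-‿cong (scaled i)) (solve 0 (:- con 0ℤ := con 0ℤ) refl)))) refl

    isRationalLine : IsRationalLine Line
    isRationalLine = (w , real d , (λ d≋0 → fromℤ-dₖ≉0 (d≋0 k)) , λ x → mk⇔ id id)
      , constraints⁺ ++ constraints⁻
      , Allₚ.++⁺ (Allₚ.tabulate⁺ minor-nonConstant) (Allₚ.tabulate⁺ minor-swap-nonConstant)
      , λ x → mk⇔ (λ x∈L → Allₚ.++⁺
          (Allₚ.tabulate⁺ λ i → ≤-reflexive (sym (eval-minor-on-line (punchIn k i) k x∈L)))
                                    (Allₚ.tabulate⁺ λ i → ≤-reflexive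
                                      (sym (eval-minor-on-line k (punchIn k i) x∈L))))
          line-from-constraints

  -- From the restrictions to lines back to f

  All-lookup : ∀ {A : Set} {P : Pred A 0ℓ} {xs} → All P xs → ∀ j → P (List.lookup xs j)
  All-lookup (p ∷ ps) zero    = p
  All-lookup (p ∷ ps) (suc j) = All-lookup ps j

  All-fromLookup : ∀ {A : Set} {P : Pred A 0ℓ} xs → (∀ j → P (List.lookup xs j)) → All P xs
  All-fromLookup []       p = []
  All-fromLookup (x ∷ xs) p = p zero ∷ All-fromLookup xs (λ j → p (suc j))

  module _ {n : ℕ} {S : Pred (Point (suc n)) 0ℓ} (f : FunctionOn (int S ∩ F^ (suc n))) where

    -- A total function spares the membership proofs. The value `0#` off the domain is arbitrary, as
    -- envelopes and minorants look only at points of D with coordinates in F.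
    extension : Point (suc n) → Carrier
    extension x = value-at (em {x ∈ (int S ∩ F^ (suc n))})
      where
      value-at : Dec (x ∈ (int S ∩ F^ (suc n))) → Carrier
      value-at (yes x∈T) = apply f x x∈T
      value-at (no _)    = 0#

    extension≈ : ∀ {x} (x∈T : x ∈ (int S ∩ F^ (suc n))) → extension x ≈ apply f x x∈T
    extension≈ {x} x∈T with em {x ∈ (int S ∩ F^ (suc n))}
    ... | yes x∈T′ = cong f x∈T′ x∈T (λ _ → refl)
    ... | no  x∉T  = contradiction x∈T x∉T

    module WithConstraints {m} (J : Vector (IntegralAffine (suc n)) m)
      (S⇒ : ∀ {x} → x ∈ S → ∀ j → 0# ≤ eval (J j) x) (S⇐ : ∀ {x} → (∀ j → 0# ≤ eval (J j) x) → x ∈ S)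
      (on-lines : (L : Pred (Point (suc n)) 0ℓ) → IsRationalLine L →
        IsIntegralPolyhedral (restrict {U = (int S ∩ F^ (suc n)) ∩ L} proj₁ f))
      {p₀ : Point (suc n)} (p₀∈int : p₀ ∈ int S) (p₀∈F : p₀ ∈ F^ (suc n)) where

      open RelativeInterior {S = S} J S⇒ S⇐ p₀∈int

      p₀∈D : p₀ ∈ OpenFace J p₀
      p₀∈D = int⇒OpenFace p₀∈int

      open OpenFaceGeometry J {p₀} p₀∈D

      domain : ∀ {x} → x ∈ F^ (suc n) → x ∈ D → x ∈ (int S ∩ F^ (suc n))
      domain x∈F x∈D = OpenFace⇒int x∈D , x∈F

      g = extension

      g-cong : Extensional g
      g-cong {x} {y} x∈D x∈F x≋y = trans (extension≈ x∈T) (trans (cong f x∈T y∈T x≋y) (sym (extension≈ y∈T)))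
        where
        x∈T = domain x∈F x∈D
        y∈T = domain (λ i → respects (x≋y i) (x∈F i)) (D-cong x≋y x∈D)

      piece : Point (suc n) → Vector ℤ (suc n) → IntegralAffine (suc n) → Piece
      piece w d l = eval l w , gradient l ∙ d

      line-envelope : ∀ {w} d → w ∈ F^ (suc n) → ∃[ k ] ¬ (d k ≡ 0ℤ) →
        Envelope J {p₀} p₀∈D g w d
      line-envelope {w} d w∈F (k , dₖ≢0) = pieces (on-lines Line isRationalLine)
        where
        open RationalLine w∈F d k dₖ≢0
        pieces : IsIntegralPolyhedral (restrict {U = (int S ∩ F^ (suc n)) ∩ Line} proj₁ f) →
                 Envelope J {p₀} p₀∈D g w d
        pieces (l , ls , f≈max) = List.map (piece w d) (l ∷ ls)
            , Allₚ.map⁺ (All.universal (λ l → eval∈F l w∈F) (l ∷ ls))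
            , λ t∈F x∈D → is-max t∈F (domain (ray∈F d w∈F t∈F) x∈D)
          where
          is-max : ∀ {t} → t ∈ Member → (x∈T : ray w t d ∈ (int S ∩ F^ (suc n))) →
            All (λ p → value p t ≤ g (ray w t d)) (List.map (piece w d) (l ∷ ls))
              × Any (λ p → g (ray w t d) ≈ value p t) (List.map (piece w d) (l ∷ ls))
          is-max {t} t∈F x∈T =
              Allₚ.map⁺ {f = piece w d} (All.map (λ {l} le → ≤-resp (eval-ray l w t d) (sym g≈) le)
                (All._∷_ {x = l} (Extrema.⊥≤max totalOrder (eval l x) xs)
                  (Allₚ.map⁻ {f = λ l′ → eval l′ x} (Extrema.xs≤max totalOrder (eval l x) xs))))
            , Anyₚ.map⁺ (Any.map (λ {l} eq → trans g≈ (trans eq (eval-ray l w t d)))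
                (attained (Extrema.argmax-sel totalOrder id (eval l x) xs)))
            where
            x = ray w t d
            xs = List.map (λ l → eval l x) ls
            g≈ : g x ≈ max (eval l x) xs
            g≈ = trans (extension≈ x∈T) (f≈max x (x∈T , t , λ _ → refl))
            attained : (max (eval l x) xs ≡ eval l x) ⊎ (max (eval l x) xs Membership.∈ xs) →
              Any (λ l′ → max (eval l x) xs ≈ eval l′ x) (l ∷ ls)
            attained (inj₁ eq) = here (reflexive eq)
            attained (inj₂ ∈)  = there (Anyₚ.map⁻ (Any.map reflexive ∈))

      -- Needed for the zero direction, which spans no line and whose only piece is the constant g
      -- w. Any nonzero direction yields g w as the constant of a piece, and the vector of ones is
      -- taken.
      g∈F : ∀ {w} → w ∈ F^ (suc n) → w ∈ D → g w ∈ Member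
      g∈F {w} w∈F w∈D = from (line-envelope d w∈F (zero , λ ()))
        where
        d : Vector ℤ (suc n)
        d _ = 1ℤ
        from : Envelope J {p₀} p₀∈D g w d → g w ∈ Member
        from (ps , ps∈F , env) = All.lookupWith (λ { {c , k} c∈F eq → respects (sym (trans
              (g-cong w∈D w∈F (λ i → sym (ray-0 w {d} i)))
              (trans eq (solve 2 (λ c k → c :+ con 0ℤ :* k := c) refl c (fromℤ k))))) c∈F })
          ps∈F (proj₂ (env 0-closed (D-cong (λ i → sym (ray-0 w {d} i)) w∈D)))

      envelope : ∀ {w} d → w ∈ F^ (suc n) → Envelope J {p₀} p₀∈D g w d
      envelope {w} d w∈F = choose (em {∃[ k ] ¬ (d k ≡ 0ℤ)})
        where
        choose : Dec (∃[ k ] ¬ (d k ≡ 0ℤ)) → Envelope J {p₀} p₀∈D g w d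
        choose (yes d≢0) = line-envelope d w∈F d≢0
        choose (no d≡0)  = constant-piece (em {w ∈ D})
          where
          ray≋w : ∀ t → ray w t d ≋ w
          ray≋w t i = go (d i ℤₚ.≟ 0ℤ)
            where
            go : Dec (d i ≡ 0ℤ) → ray w t d i ≈ w i
            go (yes dᵢ≡0) = trans (+-congˡ (trans (*-congˡ (reflexive (≡.cong fromℤ dᵢ≡0))) (zeroʳ t)))
              (+-identityʳ (w i))
            go (no dᵢ≢0)  = contradiction (i , dᵢ≢0) d≡0
          constant-piece : Dec (w ∈ D) → Envelope J {p₀} p₀∈D g w d
          constant-piece (yes w∈D) = (g w , 0ℤ) ∷ [] , g∈F w∈F w∈D ∷ [] , λ {t} t∈F x∈D →
            let eq = trans (sym (g-cong w∈D w∈F (λ i → sym (ray≋w t i))))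
                  (solve 2 (λ g t → g := g :+ t :* con 0ℤ) refl (g w) t)
            in ≤-reflexive (sym eq) ∷ [] , here eq
          constant-piece (no w∉D) = [] , [] , λ {t} _ x∈D → contradiction (D-cong (ray≋w t) x∈D) w∉D

      open Minorants J {p₀} p₀∈D p₀∈F g g-cong envelope
      open TopSelection Minorant

      no-equations : Vector (IntegralAffine (suc n)) 0
      no-equations ()

      cover : ∃[ B ] Covers B (Face no-equations J)
      cover = finite-cover no-equations J
        (λ {w} w∈F (_ , 0≤Jw) → top-minorant {w} w∈F (S⇒ClosedFace {w} (S⇐ 0≤Jw)))
        λ d _ 0≤Jd → recession-bounded d λ {t} 0≤t j → stays {d} 0≤Jd 0≤t j (p₀∈D j)
        where
        module _ {d} (0≤Jd : ∀ j → 0ℤ ℤ.≤ gradients J j ∙ d) {t} (0≤t : 0# ≤ t) where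
          growth : ∀ j → 0# ≤ t * fromℤ (gradients J j ∙ d)
          growth j = *-nonNeg 0≤t (0≤fromℤ (0≤Jd j))
          stays : ∀ j → SameSign (eval (J j) p₀) (eval (J j) p₀) →
            SameSign (eval (J j) p₀) (eval (J j) (ray p₀ t d))
          stays j (inj₁ (0<Jp₀ , _)) = inj₁
            (0<Jp₀ , <-resp refl (sym (eval-ray (J j) p₀ t d)) (+-pos-nonNeg 0<Jp₀ (growth j)))
          -- The moved point satisfies all constraints and so lies in S, where a constraint active
          -- at p₀ vanishes.
          stays j (inj₂ (Jp₀≈0 , _)) = inj₂ (Jp₀≈0 , vanishes {z = ray p₀ t d} j p₀∈int Jp₀≈0 (S⇐ λ i →
            ≤-resp refl (sym (eval-ray (J i) p₀ t d)) (+-nonNeg (S⇒ p₀∈S i) (growth i))))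

      -- Minorants never exceed f, and at x a largest member of B is at least the minorant that is
      -- exact at x. The minorant l₀ only makes the list nonempty.
      maximum : ∀ {l₀} B → l₀ ∈ Minorant → Covers B (Face no-equations J) → IsIntegralPolyhedral f
      maximum {l₀} B l₀∈ (B⊆ , covers) = l₀ , B , λ x (x∈int , x∈F) → equal x∈F (int⇒OpenFace x∈int) (x∈int , x∈F)
        where
        equal : ∀ {x} → x ∈ F^ (suc n) → x ∈ D → (x∈T : x ∈ (int S ∩ F^ (suc n))) →
          apply f x x∈T ≈ max (eval l₀ x) (List.map (λ l → eval l x) B)
        equal {x} x∈F x∈D x∈T = trans (sym (extension≈ x∈T)) (≤-antisym (reached (exact-minorant x∈F x∈D))
          (Extrema.max≤v⁺ totalOrder (l₀∈ x∈F x∈D) (Allₚ.map⁺ (All.map (λ l∈ → l∈ x∈F x∈D) B⊆))))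
          where
          reached : ∃[ l ] (l ∈ Minorant × eval l x ≈ g x) → g x ≤ max (eval l₀ x) (List.map (λ l → eval l x) B)
          reached (l , l∈ , exact) = Extrema.v≤max⁺ totalOrder (eval l₀ x) (List.map (λ l → eval l x) B)
            (inj₂ (Anyₚ.map⁺ (Any.map
            (λ (_ , top) → ≤-trans (≤-reflexive (sym exact)) (top {l} l∈))
              (covers {x} x∈F ((λ ()) , S⇒ (D⊆S {x} x∈D))))))

      polyhedral : IsIntegralPolyhedral f
      polyhedral = combine (exact-minorant p₀∈F p₀∈D) cover
        where
        combine : ∃[ l ] (l ∈ Minorant × eval l p₀ ≈ g p₀) → ∃[ B ] Covers B (Face no-equations J) →
          IsIntegralPolyhedral f
        combine (l₀ , l₀∈ , _) (B , covers) = maximum {l₀} B l₀∈ covers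

    integral-polyhedral : IsRationalPolyhedral S →
      ((L : Pred (Point (suc n)) 0ℓ) → IsRationalLine L →
        IsIntegralPolyhedral (restrict {U = (int S ∩ F^ (suc n)) ∩ L} proj₁ f)) →
      IsIntegralPolyhedral f
    integral-polyhedral (ls , _ , S⇔) on-lines = choose (em {∃[ p ] p ∈ (int S ∩ F^ (suc n))})
      where
      choose : Dec (∃[ p ] p ∈ (int S ∩ F^ (suc n))) → IsIntegralPolyhedral f
      choose (yes (p₀ , p₀∈int , p₀∈F)) = WithConstraints.polyhedral (List.lookup ls)
        (λ {x} x∈S → All-lookup (Equivalence.to (S⇔ x) x∈S))
          (λ {x} p → Equivalence.from (S⇔ x) (All-fromLookup ls p)) on-lines p₀∈int p₀∈F
      -- On an empty domain any functional serves.
      choose (no ∄) = record { gradient = λ _ → 0ℤ ; constant = 0# ; constant∈F = 0-closed } , [] , λ x x∈T →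
        contradiction (x , x∈T) ∄

open import Data.Nat.Base using (_≤_)

corollary7p7 : ExcludedMiddle 0ℓ →
    (ℝ : CompleteOrderedField) (F : Subfield ℝ) →
    let open Polyhedral ℝ F in
    (n : ℕ) → 1 ≤ n →
    (S : Pred (Point n) 0ℓ) → IsRationalPolyhedral S →
    (f : FunctionOn (int S ∩ F^ n)) →
    ((L : Pred (Point n) 0ℓ) → IsRationalLine L →
    IsIntegralPolyhedral (restrict {U = (int S ∩ F^ n) ∩ L} proj₁ f)) →
    IsIntegralPolyhedral f
corollary7p7 em ℝ F (suc n) _ S S-polyhedral f on-lines = Polyhedra.integral-polyhedral em ℝ F f S-polyhedral
  on-lines
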